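{- Let $k>1$ be an integer with $k\equiv 1$ or $5 \pmod 6$. Then the $2$-skeleton of the $(k-1)$-simplex $\Delta^{k-1}$ decomposes into (i) $\frac{k-1}{2}$ collections of Möbius strips $$M_{l,k}:=\{(l:l:k-2l)\},\qquad 1\le l\le \tfrac{k-1}{2},$$ where $M_{l,k}$ has $n:=\gcd(l,k)$ isomorphic connected components on $\frac{k}{n}$ vertices each, and (ii) $\frac{k^2-6k+5}{12}$ collections of tori $$S_{l,j,k}:=\{(l:j:k-l-j),\,(l:k-l-j:j)\},\qquad 1\le l<j<k-l-j,$$ where $S_{l,j,k}$ has $m:=\gcd(l,j,k)$ connected components on $\frac{k}{m}$ vertices each.
   Context: For positive integers $a_0,\ldots,a_d$ with $n:=\sum_{i=0}^d a_i$, the difference cycle $(a_0:\ldots:a_d)$ of dimension $d$ on $n$ vertices is the simplicial complex on the vertex set $\mathbb{Z}_n=\{0,\ldots,n-1\}$ whose $d$-simplices are the orbit of $\{0,a_0,a_0+a_1,\ldots,\sum_{i=0}^{d-1}a_i\}$ under the cyclic $\mathbb{Z}_n$-action generated by the shift $v\mapsto v+1 \bmod n$ on subsets of $\mathbb{Z}_n$. A set of difference cycles on the same vertex set denotes the simplicial complex that is their union. The $2$-skeleton $\operatorname{skel}_2(\Delta^{k-1})$ of the $(k-1)$-simplex with vertices $0,\ldots,k-1$ is the set of all faces of dimension at most $2$; its triangles are all $3$-element subsets of $\{0,\ldots,k-1\}$. "Decomposes" means that every triangle belongs to exactly one complex of the listed families. A "collection of Möbius strips" (resp. tori) is a triangulated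 $2$-manifold each of whose connected components is a Möbius strip (resp. a torus $\mathbb{T}^2$). Isomorphic means combinatorially isomorphic, i.e. equal up to a relabeling of the vertices. -}

module Defs where

open import Data.Nat.Base as ℕ using (ℕ; zero; suc; NonZero; _≤_; _<_; _∸_)
open import Data.Nat.DivMod using (_mod_; m/n*n≤m)
import Data.Nat.Properties as ℕₚ
open import Data.Integer.Base as ℤ using (ℤ)
open import Data.Rational.Base as ℚ using (ℚ; 0ℚ; 1ℚ)
import Data.Rational.Properties as ℚₚ
open import Algebra.Properties.CommutativeMonoid.Sum ℚₚ.+-0-commutativeMonoid
  using () renaming (sum to ∑ℚ)
open import Data.Fin.Base using (Fin; toℕ)
open import Data.Fin.Permutation using (Permutation′; _⟨$⟩ˡ_)
open import Data.Fin.Subset using (Subset; _∈_; _∉_; _⊆_; ⁅_⁆; _∪_; ∣_∣; Nonempty; ⋃)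
open import Data.List.Base using (List; []; _∷_)
open import Data.List.Relation.Unary.Any as Any using (Any)
open import Data.Product.Base using (Σ-syntax; ∃-syntax; _×_; _,_; proj₁)
open import Data.Product using (∃!)
open import Data.Vec.Base as Vec using (Vec; []; _∷_)
open import Data.Vec.Relation.Unary.All using (All; []; _∷_)
open import Function.Base using (_∘_)
open import Function.Bundles using (_⇔_)
open import Function.Definitions using (Injective)
open import Relation.Binary.Construct.Closure.Transitive using (TransClosure)
open import Relation.Binary.PropositionalEquality
  using (_≡_; trans; cong; subst; module ≡-Reasoning)

private
  variable
    n d : ℕ

-- Not every element of Fin n has to be a vertex: v is a vertex exactly
-- when ⁅ v ⁆ is a face.  The empty set is not counted as a face.

record SimplicialComplex (n : ℕ) : Set₁ where
  field
    Face       : Subset n → Set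
    nonempty   : ∀ {σ} → Face σ → Nonempty σ
    hereditary : ∀ {σ τ} → Face σ → τ ⊆ σ → Nonempty τ → Face τ

open SimplicialComplex public

infix 4 _⊑_
_⊑_ : SimplicialComplex n → SimplicialComplex n → Set
X ⊑ Y = ∀ {σ} → Face X σ → Face Y σ

-- The simplex with vertices 0, …, n - 1, of dimension n - 1.

fullSimplex : ∀ n → SimplicialComplex n
fullSimplex n = record
  { Face       = Nonempty
  ; nonempty   = λ σ≠∅ → σ≠∅
  ; hereditary = λ _ _ τ≠∅ → τ≠∅
  }

skel : ℕ → SimplicialComplex n → SimplicialComplex n
skel d X = record
  { Face       = λ σ → Face X σ × ∣ σ ∣ ≤ suc d
  ; nonempty   = λ (σ∈X , _) → nonempty X σ∈X
  ; hereditary = λ (σ∈X , ∣σ∣≤) τ⊆σ τ≠∅ →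
      hereditary X σ∈X τ⊆σ τ≠∅ , ℕₚ.≤-trans (p⊆q⇒∣p∣≤∣q∣ τ⊆σ) ∣σ∣≤
  }
  where open import Data.Fin.Subset.Properties using (p⊆q⇒∣p∣≤∣q∣)

infix 8 _↾_
_↾_ : SimplicialComplex n → Subset n → SimplicialComplex n
X ↾ C = record
  { Face       = λ σ → Face X σ × σ ⊆ C
  ; nonempty   = λ (σ∈X , _) → nonempty X σ∈X
  ; hereditary = λ (σ∈X , σ⊆C) τ⊆σ τ≠∅ →
      hereditary X σ∈X τ⊆σ τ≠∅ , λ v∈τ → σ⊆C (τ⊆σ v∈τ)
  }

DecomposesInto : ∀ {I : Set} → SimplicialComplex n → (I → SimplicialComplex n) → Set
DecomposesInto X Y =
  (∀ i → Y i ⊑ X) ×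
  (∀ σ → Face X σ → ∣ σ ∣ ≡ 3 → ∃! _≡_ λ i → Face (Y i) σ)

relabel : Permutation′ n → Subset n → Subset n
relabel π σ = Vec.tabulate λ v → Vec.lookup σ (π ⟨$⟩ˡ v)

Isomorphic : SimplicialComplex n → SimplicialComplex n → Set
Isomorphic {n} X Y =
  Σ[ π ∈ Permutation′ n ] (∀ σ → Face X σ ⇔ Face Y (relabel π σ))

-- Adjacent X v v says that v is a vertex of X, so that the transitive
-- closure below is reflexive precisely on the vertices of X.

Adjacent : SimplicialComplex n → Fin n → Fin n → Set
Adjacent X u v = Face X (⁅ u ⁆ ∪ ⁅ v ⁆)

Connected : SimplicialComplex n → Fin n → Fin n → Set
Connected X = TransClosure (Adjacent X)

-- C is the vertex set of a connected component of X; the component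
-- itself is X ↾ C.

IsComponent : SimplicialComplex n → Subset n → Set
IsComponent X C = Nonempty C × (∀ {u} → u ∈ C → ∀ v → v ∈ C ⇔ Connected X u v)

HasComponents : SimplicialComplex n → ℕ → Set
HasComponents {n} X c = Σ[ C ∈ (Fin c → Subset n) ]
  (∀ i → IsComponent X (C i)) ×
  Injective _≡_ _≡_ C ×
  (∀ D → IsComponent X D → ∃[ i ] D ≡ C i)

-- (a₀ : … : a_d) on the vertex set ℤ_n.

record DifferenceCycle (n d : ℕ) : Set where
  constructor cycle
  field
    entries  : Vec ℕ (suc d)
    positive : All (0 <_) entries
    sums-to  : Vec.sum entries ≡ n

open DifferenceCycle public

-- partialSums s (a₀ ∷ … ∷ a_d ∷ []) is s, s + a₀, …, s + (a₀ + … + a_{d-1}).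

partialSums : ℕ → Vec ℕ n → Vec ℕ n
partialSums s []       = []
partialSums s (a ∷ as) = s ∷ partialSums (s ℕ.+ a) as

fromVertices : Vec (Fin n) d → Subset n
fromVertices = ⋃ ∘ Vec.toList ∘ Vec.map ⁅_⁆

module _ {n} .{{_ : NonZero n}} where

  -- The s-th power of the shift v ↦ v + 1 of ℤ_n.

  rotate : ℕ → Fin n → Fin n
  rotate s v = (s ℕ.+ toℕ v) mod n

  -- The s-th translate of {0, a₀, a₀ + a₁, …}.

  translate : DifferenceCycle n d → ℕ → Subset n
  translate c s =
    fromVertices (Vec.map (rotate s ∘ (_mod n)) (partialSums 0 (entries c)))

  ⟦_⟧ : List (DifferenceCycle n d) → SimplicialComplex n
  ⟦ cs ⟧ = record
    { Face       = λ σ → Nonempty σ × Any (λ c → ∃[ s ] σ ⊆ translate c s) cs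
    ; nonempty   = proj₁
    ; hereditary = λ (_ , any) τ⊆σ τ≠∅ →
        τ≠∅ , Any.map (λ (s , σ⊆) → s , λ {_} v∈τ → σ⊆ (τ⊆σ v∈τ)) any
    }

record MöbiusIndex (k : ℕ) : Set where
  constructor möbiusIndex
  field
    l   : ℕ
    1≤l : 1 ≤ l
    l≤  : l ≤ (k ∸ 1) ℕ./ 2

record TorusIndex (k : ℕ) : Set where
  constructor torusIndex
  field
    l j : ℕ
    1≤l : 1 ≤ l
    l<j : l < j
    j<  : j < k ∸ l ∸ j

triple : ∀ {k} a b c → 0 < a → 0 < b → 0 < c → a ℕ.+ b ℕ.+ c ≡ k → DifferenceCycle k 2
triple a b c 0<a 0<b 0<c eq = cycle (a ∷ b ∷ c ∷ []) (0<a ∷ 0<b ∷ 0<c ∷ []) (begin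
  a ℕ.+ (b ℕ.+ (c ℕ.+ 0))  ≡⟨ cong (λ x → a ℕ.+ (b ℕ.+ x)) (ℕₚ.+-identityʳ c) ⟩
  a ℕ.+ (b ℕ.+ c)          ≡⟨ ℕₚ.+-assoc a b c ⟨
  a ℕ.+ b ℕ.+ c            ≡⟨ eq ⟩
  _                        ∎)
  where open ≡-Reasoning

M : ∀ k .{{_ : NonZero k}} → MöbiusIndex k → SimplicialComplex k
M k@(suc k-1) (möbiusIndex l 1≤l l≤) =
  ⟦ triple l l (k ∸ 2 ℕ.* l) 1≤l 1≤l (ℕₚ.m<n⇒0<n∸m 2l<k) total ∷ [] ⟧
  where
  2l<k : 2 ℕ.* l < k
  2l<k = ℕ.s≤s (begin
    2 ℕ.* l            ≡⟨ ℕₚ.*-comm 2 l ⟩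
    l ℕ.* 2            ≤⟨ ℕₚ.*-monoˡ-≤ 2 l≤ ⟩
    k-1 ℕ./ 2 ℕ.* 2    ≤⟨ m/n*n≤m k-1 2 ⟩
    k-1                ∎)
    where open ℕₚ.≤-Reasoning

  total : l ℕ.+ l ℕ.+ (k ∸ 2 ℕ.* l) ≡ k
  total = begin
    l ℕ.+ l ℕ.+ (k ∸ 2 ℕ.* l)  ≡⟨ cong (λ x → l ℕ.+ x ℕ.+ (k ∸ 2 ℕ.* l)) (ℕₚ.+-identityʳ l) ⟨
    2 ℕ.* l ℕ.+ (k ∸ 2 ℕ.* l)  ≡⟨ ℕₚ.m+[n∸m]≡n (ℕₚ.<⇒≤ 2l<k) ⟩
    k                          ∎
    where open ≡-Reasoning

S : ∀ k .{{_ : NonZero k}} → TorusIndex k → SimplicialComplex k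
S k (torusIndex l j 1≤l l<j j<) =
  ⟦ triple l j (k ∸ l ∸ j) 1≤l 0<j 0<c total
  ∷ triple l (k ∸ l ∸ j) j 1≤l 0<c 0<j (trans swap total)
  ∷ [] ⟧
  where
  0<j : 0 < j
  0<j = ℕₚ.<-trans 1≤l l<j

  0<c : 0 < k ∸ l ∸ j
  0<c = ℕₚ.<-trans 0<j j<

  total : l ℕ.+ j ℕ.+ (k ∸ l ∸ j) ≡ k
  total = begin
    l ℕ.+ j ℕ.+ (k ∸ l ∸ j)      ≡⟨ cong (l ℕ.+ j ℕ.+_) (ℕₚ.∸-+-assoc k l j) ⟩
    l ℕ.+ j ℕ.+ (k ∸ (l ℕ.+ j))  ≡⟨ ℕₚ.m+[n∸m]≡n (ℕₚ.<⇒≤ l+j<k) ⟩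
    k                            ∎
    where
    open ≡-Reasoning
    l+j<k : l ℕ.+ j < k
    l+j<k = ℕₚ.m∸n≢0⇒n<m (ℕₚ.>⇒≢ (subst (0 <_) (ℕₚ.∸-+-assoc k l j) 0<c))

  swap : l ℕ.+ (k ∸ l ∸ j) ℕ.+ j ≡ l ℕ.+ j ℕ.+ (k ∸ l ∸ j)
  swap = begin
    l ℕ.+ (k ∸ l ∸ j) ℕ.+ j    ≡⟨ ℕₚ.+-assoc l (k ∸ l ∸ j) j ⟩
    l ℕ.+ (k ∸ l ∸ j ℕ.+ j)    ≡⟨ cong (l ℕ.+_) (ℕₚ.+-comm (k ∸ l ∸ j) j) ⟩
    l ℕ.+ (j ℕ.+ (k ∸ l ∸ j))  ≡⟨ ℕₚ.+-assoc l j (k ∸ l ∸ j) ⟨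
    l ℕ.+ j ℕ.+ (k ∸ l ∸ j)    ∎
    where open ≡-Reasoning

-- A compact metric space is represented by its dense set of rational
-- points, with Near ε p q meaning that p and q are at distance less than
-- ε.  Points that are near for every ε > 0 represent the same point, so
-- quotients need no separate construction.

record Space : Set₁ where
  field
    Point : Set
    Near  : ℚ → Point → Point → Set

open Space public

Coincide : (A : Space) → Point A → Point A → Set
Coincide A p q = ∀ ε → 0ℚ ℚ.< ε → Near A ε p q

UniformlyContinuous : (A B : Space) → (Point A → Point B) → Set
UniformlyContinuous A B f =
  ∀ ε → 0ℚ ℚ.< ε → ∃[ δ ] 0ℚ ℚ.< δ × (∀ p q → Near A δ p q → Near B ε (f p) (f q))

-- Mutually inverse uniformly continuous maps between the rational points
-- extend uniquely to mutually inverse continuous maps between the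
-- completions, i.e. to a homeomorphism of the real spaces.  Conversely,
-- the spaces considered here are rational polyhedra of dimension at most
-- 2; if two of them are homeomorphic, they are also homeomorphic by a map
-- that is piecewise linear over ℚ, hence Lipschitz in both directions and
-- a bijection of rational points.

record Homeomorphic (A B : Space) : Set where
  field
    to        : Point A → Point B
    from      : Point B → Point A
    to-cont   : UniformlyContinuous A B to
    from-cont : UniformlyContinuous B A from
    from∘to   : ∀ p → Coincide A (from (to p)) p
    to∘from   : ∀ q → Coincide B (to (from q)) q

-- coord lists the (rational) barycentric coordinates.

record RealisationPoint (X : SimplicialComplex n) : Set where
  field
    coord       : Fin n → ℚ
    nonnegative : ∀ v → 0ℚ ℚ.≤ coord v
    sums-to-1   : ∑ℚ coord ≡ 1ℚ
    carrier     : Subset n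
    isFace      : Face X carrier
    supported   : ∀ v → v ∉ carrier → coord v ≡ 0ℚ

Realisation : SimplicialComplex n → Space
Realisation X = record
  { Point = RealisationPoint X
  ; Near  = λ ε p q → ∀ v → ℚ.∣ coord p v ℚ.- coord q v ∣ ℚ.< ε
  }
  where open RealisationPoint

fromℤ : ℤ → ℚ
fromℤ a = a ℚ./ 1

-- ℝ / ℤ

Circle : Space
Circle = record
  { Point = ℚ
  ; Near  = λ ε x x′ → ∃[ a ] ℚ.∣ x ℚ.- (x′ ℚ.+ fromℤ a) ∣ ℚ.< ε
  }

infixr 2 _×ˢ_
_×ˢ_ : Space → Space → Space
A ×ˢ B = record
  { Point = Point A × Point B
  ; Near  = λ ε (x , y) (x′ , y′) → Near A ε x x′ × Near B ε y y′
  }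

Torus : Space
Torus = Circle ×ˢ Circle

-- (-1)^a · y

flip^ : ℕ → ℚ → ℚ
flip^ zero    y = y
flip^ (suc a) y = ℚ.- flip^ a y

-- ℝ × [-1, 1] modulo the ℤ-action generated by (x , y) ↦ (x + 1 , - y).

MöbiusStrip : Space
MöbiusStrip = record
  { Point = ℚ × (Σ[ y ∈ ℚ ] ℚ.∣ y ∣ ℚ.≤ 1ℚ)
  ; Near  = λ ε (x , y , _) (x′ , y′ , _) → Σ[ a ∈ ℤ ]
      ℚ.∣ x ℚ.- (x′ ℚ.+ fromℤ a) ∣ ℚ.< ε ×
      ℚ.∣ y ℚ.- flip^ ℤ.∣ a ∣ y′ ∣ ℚ.< ε
  }

-- If every connected component is homeomorphic to one and the same
-- surface, then the whole complex is a triangulated 2-manifold.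

CollectionOf : Space → SimplicialComplex n → Set
CollectionOf A X = ∀ C → IsComponent X C → Homeomorphic (Realisation (X ↾ C)) A

{-# OPTIONS --safe #-}

-- A triangle u < v < w of ℤ_k determines the cyclic word of gaps
-- (v - u : w - v : k - w + u), which is recovered up to rotation from any
-- difference cycle containing the triangle.  Words with two equal entries are
-- those of exactly one M, and words with three distinct entries are those of
-- exactly one S.  The S are counted by increasing k by 6.
--
-- The components are the cosets of m ℤ_k, by Bézout.  A component of S is the
-- quotient of the triangular lattice of the plane by the kernel of
-- (p , q) ↦ l p + j q mod k, and a component of M is the quotient of the strip
-- ℝ × [-1 , 1], triangulated by the vertices (i , (-1)^i), by a glide
-- reflection, because k / n is odd.  The hypothesis on k makes the labels of
-- the vertices of any two triangles with a common vertex distinct.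
--
-- Both homeomorphisms follow from the same two estimates.  The coordinates at
-- a vertex are bounded by affine functions on the cover that are positive only
-- near this vertex, so they are uniformly continuous.  Conversely, points with
-- close coordinates lie in lifted triangles with a common vertex, and their
-- positions are the means of the same function on the vertices.

module Submission where

open import Data.Nat.Base using (ℕ)
open import Data.Fin.Base using (Fin; toℕ)
open import Data.Fin.Patterns using (0F; 1F; 2F; 3F; 4F; 5F)
open import Data.Product.Base using (Σ-syntax; ∃-syntax; _×_; _,_; proj₁; proj₂)
open import Data.Sum.Base using (_⊎_; inj₁; inj₂)
open import Function.Base using (_∘_)
open import Function.Bundles using (_⇔_; mk⇔; _↔_; module Equivalence)
open import Function.Definitions using (Injective)
open import Relation.Nullary using (¬_; yes; no; contradiction)
open import Relation.Binary.PropositionalEquality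
  using (_≡_; _≢_; refl; sym; trans; cong; cong₂; subst; subst₂; module ≡-Reasoning)
import Data.Fin.Properties as Finₚ

-- A point of a complex lies in several triangles and each triangle has infinitely many lifts, so
-- neither map of a homeomorphism has a canonical formula: each of them chooses a triangle. The
-- choices are never compared with each other. The two estimates are quantified over all pairs of
-- triangles; applied to two descriptions of the same point, with ε arbitrary, they say that the
-- images coincide. Thus well-definedness, continuity and the inverse laws all come from one pair of
-- statements. The modulus 6 has a simple source. Corners of two triangles of the strip with a
-- common vertex are at most four steps apart, so `l`, `2 l`, `3 l` and `4 l` must be nonzero modulo
-- `k`, which is a matter of cancelling 2 and 3. In the plane such corners differ by a point of a
-- hexagon of radius 2, where doubles of the gaps occur, and differences of gaps, which are nonzero
-- because the three gaps are distinct.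

module Rationals where

  open import Defs using (fromℤ)
  open import Data.Nat.Base as ℕ using (zero; suc)
  open import Data.Integer.Base as ℤ using (ℤ; 0ℤ; 1ℤ)
  import Data.Integer.Properties as ℤₚ
  import Data.Integer.DivMod as ℤD
  open import Data.Rational.Base
  open import Data.Rational.Properties
  import Data.Rational.Unnormalised.Base as ℚᵘ
  import Data.Rational.Unnormalised.Properties as ℚᵘₚ
  open import Data.Rational.Solver using (module +-*-Solver)
  open import Algebra.Properties.CommutativeMonoid.Sum +-0-commutativeMonoid
    using (sum-cong-≗; sum-remove; sum-replicate-zero; ∑-distrib-+) renaming (sum to ∑ℚ) public
  open import Data.Fin.Base using (zero; suc; punchIn)

  open +-*-Solver using (solve; _:+_; _:*_; :-_; _:-_; _:=_; con) public

  private
    variable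
      p q r s : ℚ

  -- Order, absolute values, integers and finite sums in the rationals.

  p≤q⇒0≤q-p : p ≤ q → 0ℚ ≤ q - p
  p≤q⇒0≤q-p {p} {q} p≤q = subst (_≤ q - p) (+-inverseʳ p) (+-monoˡ-≤ (- p) p≤q)

  0≤q-p⇒p≤q : 0ℚ ≤ q - p → p ≤ q
  0≤q-p⇒p≤q {q} {p} 0≤ = subst₂ _≤_ (+-identityˡ p)
    (solve 2 (λ q p → q :- p :+ p := q) refl q p) (+-monoˡ-≤ p 0≤)

  +-nonNeg : 0ℚ ≤ p → 0ℚ ≤ q → 0ℚ ≤ p + q
  +-nonNeg = +-mono-≤

  *-nonNeg : 0ℚ ≤ p → 0ℚ ≤ q → 0ℚ ≤ p * q
  *-nonNeg {p} {q} 0≤p 0≤q =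
    subst (_≤ p * q) (*-zeroʳ p) (*-monoˡ-≤-nonNeg p {{nonNegative 0≤p}} 0≤q)

  ∣∣-lub : p ≤ r → - p ≤ r → ∣ p ∣ ≤ r
  ∣∣-lub {p} p≤r -p≤r with ∣p∣≡p∨∣p∣≡-p p
  ... | inj₁ e = subst (_≤ _) (sym e) p≤r
  ... | inj₂ e = subst (_≤ _) (sym e) -p≤r

  p≤∣p∣ : ∀ p → p ≤ ∣ p ∣
  p≤∣p∣ p with ≤-total 0ℚ p
  ... | inj₁ 0≤p = ≤-reflexive (sym (0≤p⇒∣p∣≡p 0≤p))
  ... | inj₂ p≤0 = ≤-trans p≤0 (0≤∣p∣ p)

  ∣p-q∣≡∣q-p∣ : ∀ p q → ∣ p - q ∣ ≡ ∣ q - p ∣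
  ∣p-q∣≡∣q-p∣ p q = trans (sym (∣-p∣≡∣p∣ (p - q)))
    (cong ∣_∣ (solve 2 (λ p q → :- (p :- q) := q :- p) refl p q))

  ∣p-q∣<δ⇒p<q+δ : ∀ p q {δ} → ∣ p - q ∣ < δ → p < q + δ
  ∣p-q∣<δ⇒p<q+δ p q {δ} lt = subst (_< q + δ)
    (solve 2 (λ p q → q :+ (p :- q) := p) refl p q)
    (+-monoʳ-< q (≤-<-trans (p≤∣p∣ (p - q)) lt))

  ∣p*q∣≤ : ∀ p q → ∣ p ∣ ≤ r → ∣ q ∣ ≤ s → 0ℚ ≤ r → ∣ p * q ∣ ≤ r * s
  ∣p*q∣≤ {r} {s} p q p≤ q≤ 0≤r = subst (_≤ r * s) (sym (∣p*q∣≡∣p∣*∣q∣ p q))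
    (≤-trans (*-monoʳ-≤-nonNeg ∣ q ∣ {{nonNegative (0≤∣p∣ q)}} p≤)
             (*-monoˡ-≤-nonNeg r {{nonNegative 0≤r}} q≤))

  ∣p+q∣≤ : ∀ p q → ∣ p ∣ ≤ r → ∣ q ∣ ≤ s → ∣ p + q ∣ ≤ r + s
  ∣p+q∣≤ p q p≤ q≤ = ≤-trans (∣p+q∣≤∣p∣+∣q∣ p q) (+-mono-≤ p≤ q≤)

  private
    toℚᵘ-fromℤ : ∀ a → toℚᵘ (fromℤ a) ℚᵘ.≃ ℚᵘ.mkℚᵘ a 0
    toℚᵘ-fromℤ a = toℚᵘ-fromℚᵘ (ℚᵘ.mkℚᵘ a 0)

  fromℤ-+ : ∀ a b → fromℤ (a ℤ.+ b) ≡ fromℤ a + fromℤ b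
  fromℤ-+ a b = toℚᵘ-injective (begin
    toℚᵘ (fromℤ (a ℤ.+ b))               ≈⟨ toℚᵘ-fromℤ (a ℤ.+ b) ⟩
    ℚᵘ.mkℚᵘ (a ℤ.+ b) 0                  ≈⟨ ℚᵘ.*≡* (cong (ℤ._* 1ℤ) (cong₂ ℤ._+_ (ℤₚ.*-identityʳ a) (ℤₚ.*-identityʳ b))) ⟨
    ℚᵘ.mkℚᵘ a 0 ℚᵘ.+ ℚᵘ.mkℚᵘ b 0         ≈⟨ ℚᵘₚ.+-cong (toℚᵘ-fromℤ a) (toℚᵘ-fromℤ b) ⟨
    toℚᵘ (fromℤ a) ℚᵘ.+ toℚᵘ (fromℤ b)   ≈⟨ toℚᵘ-homo-+ (fromℤ a) (fromℤ b) ⟨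
    toℚᵘ (fromℤ a + fromℤ b)             ∎)
    where open ℚᵘₚ.≃-Reasoning

  fromℤ-* : ∀ a b → fromℤ (a ℤ.* b) ≡ fromℤ a * fromℤ b
  fromℤ-* a b = toℚᵘ-injective (begin
    toℚᵘ (fromℤ (a ℤ.* b))               ≈⟨ toℚᵘ-fromℤ (a ℤ.* b) ⟩
    ℚᵘ.mkℚᵘ a 0 ℚᵘ.* ℚᵘ.mkℚᵘ b 0         ≈⟨ ℚᵘₚ.*-cong (toℚᵘ-fromℤ a) (toℚᵘ-fromℤ b) ⟨
    toℚᵘ (fromℤ a) ℚᵘ.* toℚᵘ (fromℤ b)   ≈⟨ toℚᵘ-homo-* (fromℤ a) (fromℤ b) ⟨
    toℚᵘ (fromℤ a * fromℤ b)             ∎)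
    where open ℚᵘₚ.≃-Reasoning

  fromℤ-neg : ∀ a → fromℤ (ℤ.- a) ≡ - fromℤ a
  fromℤ-neg a = toℚᵘ-injective (begin
    toℚᵘ (fromℤ (ℤ.- a))   ≈⟨ toℚᵘ-fromℤ (ℤ.- a) ⟩
    ℚᵘ.- ℚᵘ.mkℚᵘ a 0       ≈⟨ ℚᵘₚ.-‿cong (toℚᵘ-fromℤ a) ⟨
    ℚᵘ.- toℚᵘ (fromℤ a)    ≈⟨ toℚᵘ-homo‿- (fromℤ a) ⟨
    toℚᵘ (- fromℤ a)       ∎)
    where open ℚᵘₚ.≃-Reasoning

  fromℤ-minus : ∀ a b → fromℤ (a ℤ.- b) ≡ fromℤ a - fromℤ b
  fromℤ-minus a b = trans (fromℤ-+ a (ℤ.- b)) (cong (fromℤ a +_) (fromℤ-neg b))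

  fromℤ-mono-≤ : ∀ {a b} → a ℤ.≤ b → fromℤ a ≤ fromℤ b
  fromℤ-mono-≤ {a} {b} a≤b = toℚᵘ-cancel-≤ (begin
    toℚᵘ (fromℤ a)   ≃⟨ toℚᵘ-fromℤ a ⟩
    ℚᵘ.mkℚᵘ a 0      ≤⟨ ℚᵘ.*≤* (ℤₚ.*-monoʳ-≤-nonNeg 1ℤ a≤b) ⟩
    ℚᵘ.mkℚᵘ b 0      ≃⟨ toℚᵘ-fromℤ b ⟨
    toℚᵘ (fromℤ b)   ∎)
    where open ℚᵘₚ.≤-Reasoning

  ∣fromℤ∣≡ : ∀ a → ∣ fromℤ a ∣ ≡ fromℤ (ℤ.+ ℤ.∣ a ∣)
  ∣fromℤ∣≡ (ℤ.+ n) = 0≤p⇒∣p∣≡p (fromℤ-mono-≤ {0ℤ} {ℤ.+ n} (ℤ.+≤+ ℕ.z≤n))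
  ∣fromℤ∣≡ ℤ.-[1+ n ] = trans (cong ∣_∣ (fromℤ-neg (ℤ.+ suc n)))
    (trans (∣-p∣≡∣p∣ (fromℤ (ℤ.+ suc n))) (∣fromℤ∣≡ (ℤ.+ suc n)))

  ∣fromℤ∣≤ : ∀ a {m} → ℤ.∣ a ∣ ℕ.≤ m → ∣ fromℤ a ∣ ≤ fromℤ (ℤ.+ m)
  ∣fromℤ∣≤ a {m} ∣a∣≤m = subst (_≤ fromℤ (ℤ.+ m)) (sym (∣fromℤ∣≡ a)) (fromℤ-mono-≤ {ℤ.+ ℤ.∣ a ∣} {ℤ.+ m} (ℤ.+≤+ ∣a∣≤m))

  reciprocal : ∀ m .{{_ : ℕ.NonZero m}} → ∃[ q ] fromℤ (ℤ.+ m) * q ≡ 1ℚ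
  reciprocal m@(suc _) = inverse (fromℤ (ℤ.+ m))
    (<-≤-trans (positive⁻¹ 1ℚ) (fromℤ-mono-≤ {ℤ.+ 1} {ℤ.+ m} (ℤ.+≤+ (ℕ.s≤s ℕ.z≤n))))
    where
    inverse : ∀ p → 0ℚ < p → ∃[ q ] p * q ≡ 1ℚ
    inverse p 0<p = (1/ p) {{>-nonZero 0<p}} , *-inverseʳ p {{>-nonZero 0<p}}

  -- The integer is the floor of numerator by denominator. The weak upper bound is harmless: a point
  -- on a common side may be located in either of the two cells.
  integerPart : ∀ p → ∃[ n ] (fromℤ n ≤ p × p ≤ fromℤ n + 1ℚ)
  integerPart p@record{} =
    n , toℚᵘ-cancel-≤ (begin
      toℚᵘ (fromℤ n)       ≃⟨ toℚᵘ-fromℤ n ⟩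
      ℚᵘ.mkℚᵘ n 0          ≤⟨ ℚᵘ.*≤* (subst (n ℤ.* ↧ p ℤ.≤_) (sym (ℤₚ.*-identityʳ (↥ p))) (ℤD.[n/ℕd]*d≤n (↥ p) (↧ₙ p))) ⟩
      toℚᵘ p               ∎) ,
    subst (p ≤_) (trans (cong fromℤ (ℤₚ.+-comm 1ℤ n)) (fromℤ-+ n 1ℤ)) (toℚᵘ-cancel-≤ (begin
      toℚᵘ p                       ≤⟨ ℚᵘ.*≤* (subst (ℤ._≤ ℤ.suc n ℤ.* ↧ p) (sym (ℤₚ.*-identityʳ (↥ p))) (ℤₚ.<⇒≤ (ℤD.n<s[n/ℕd]*d (↥ p) (↧ₙ p)))) ⟩
      ℚᵘ.mkℚᵘ (ℤ.suc n) 0          ≃⟨ toℚᵘ-fromℤ (ℤ.suc n) ⟨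
      toℚᵘ (fromℤ (ℤ.suc n))       ∎))
    where
    open ℚᵘₚ.≤-Reasoning
    n = ↥ p ℤD./ℕ ↧ₙ p

  ⅓ : ℚ
  ⅓ = ℤ.+ 1 / 3

  -- Dividing `ε` by `1 + C` instead of `C` covers `C = 0` and makes the last inequality strict. The
  -- cap `⅓` serves `common-vertex`, where a weight of at least `⅓` must stay positive after a
  -- perturbation by `δ`.
  modulus : ∀ {C ε} → 0ℚ ≤ C → 0ℚ < ε → ∃[ δ ] (0ℚ < δ × δ ≤ ⅓ × C * δ < ε)
  modulus {C} {ε} 0≤C 0<ε = δ , 0<δ , p⊓q≤p ⅓ δ′ , Cδ<ε
    where
    0<1+C : 0ℚ < 1ℚ + C
    0<1+C = +-mono-<-≤ (positive⁻¹ 1ℚ) 0≤C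
    instance
      1+C-pos : Positive (1ℚ + C)
      1+C-pos = positive 0<1+C
      1+C-nonZero : NonZero (1ℚ + C)
      1+C-nonZero = pos⇒nonZero (1ℚ + C)
      ε-pos : Positive ε
      ε-pos = positive 0<ε
    δ′ = ε * 1/ (1ℚ + C)
    δ = ⅓ ⊓ δ′
    instance
      1/-pos : Positive (1/ (1ℚ + C))
      1/-pos = 1/pos⇒pos (1ℚ + C)
      δ′-pos : Positive δ′
      δ′-pos = pos*pos⇒pos ε (1/ (1ℚ + C))
    0<δ : 0ℚ < δ
    0<δ with ⊓-sel ⅓ δ′
    ... | inj₁ e = subst (0ℚ <_) (sym e) (positive⁻¹ ⅓)
    ... | inj₂ e = subst (0ℚ <_) (sym e) (positive⁻¹ δ′)
    Cδ<ε : C * δ < ε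
    Cδ<ε = begin-strict
      C * δ              ≤⟨ *-monoˡ-≤-nonNeg C {{nonNegative 0≤C}} (p⊓q≤q ⅓ δ′) ⟩
      C * δ′             ≡⟨ +-identityˡ (C * δ′) ⟨
      0ℚ + C * δ′        <⟨ +-monoˡ-< (C * δ′) (positive⁻¹ δ′) ⟩
      δ′ + C * δ′        ≡⟨ solve 3 (λ c e i → e :* i :+ c :* (e :* i) := e :* ((con 1ℚ :+ c) :* i)) refl C ε (1/ (1ℚ + C)) ⟩
      ε * ((1ℚ + C) * 1/ (1ℚ + C)) ≡⟨ cong (ε *_) (*-inverseʳ (1ℚ + C)) ⟩
      ε * 1ℚ             ≡⟨ *-identityʳ ε ⟩
      ε                  ∎
      where open ≤-Reasoning

  ≥⅓ : ∀ {b₀ b₁ b₂} → b₀ + b₁ + b₂ ≡ 1ℚ → ⅓ ≤ b₀ ⊎ ⅓ ≤ b₁ ⊎ ⅓ ≤ b₂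
  ≥⅓ {b₀} {b₁} {b₂} eq with ⅓ ≤? b₀ | ⅓ ≤? b₁ | ⅓ ≤? b₂
  ... | yes le | _ | _ = inj₁ le
  ... | no _ | yes le | _ = inj₂ (inj₁ le)
  ... | no _ | no _ | yes le = inj₂ (inj₂ le)
  ... | no n₀ | no n₁ | no n₂ = contradiction eq
    (<⇒≢ (+-mono-< (+-mono-< (≰⇒> n₀) (≰⇒> n₁)) (≰⇒> n₂)))

  sum-zero : ∀ {n} (f : Fin n → ℚ) → (∀ i → f i ≡ 0ℚ) → ∑ℚ f ≡ 0ℚ
  sum-zero {n} f f≡0 = trans (sum-cong-≗ f≡0) (sum-replicate-zero n)

  sum-single : ∀ {n} (f : Fin n → ℚ) i → (∀ j → j ≢ i → f j ≡ 0ℚ) → ∑ℚ f ≡ f i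
  sum-single {suc n} f i off = begin
    ∑ℚ f                             ≡⟨ sum-remove f ⟩
    f i + ∑ℚ (λ j → f (punchIn i j)) ≡⟨ cong (f i +_) (sum-zero _ λ j → off _ (Finₚ.punchInᵢ≢i i j)) ⟩
    f i + 0ℚ                         ≡⟨ +-identityʳ (f i) ⟩
    f i                              ∎
    where open ≡-Reasoning

  private
    ∣∑∣≤∑ : ∀ {n} (f : Fin n → ℚ) {r} → (∀ i → ∣ f i ∣ ≤ r) → ∣ ∑ℚ f ∣ ≤ ∑ℚ {n} (λ _ → r)
    ∣∑∣≤∑ {zero}  f f≤r = ≤-refl
    ∣∑∣≤∑ {suc n} f f≤r = ∣p+q∣≤ (f zero) (∑ℚ (f ∘ suc)) (f≤r zero) (∣∑∣≤∑ (f ∘ suc) (f≤r ∘ suc))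

    ∑-const : ∀ n r → ∑ℚ {n} (λ _ → r) ≡ ∑ℚ {n} (λ _ → 1ℚ) * r
    ∑-const zero    r = sym (*-zeroˡ r)
    ∑-const (suc n) r = trans (cong (r +_) (∑-const n r))
      (solve 2 (λ r x → r :+ x :* r := (con 1ℚ :+ x) :* r) refl r (∑ℚ {n} (λ _ → 1ℚ)))

    0≤∑1 : ∀ n → 0ℚ ≤ ∑ℚ {n} (λ _ → 1ℚ)
    0≤∑1 zero    = ≤-refl
    0≤∑1 (suc n) = +-nonNeg (nonNegative⁻¹ 1ℚ) (0≤∑1 n)

  -- The constant is `n` itself, written as a sum of ones; what matters later is that it depends on
  -- neither `f` nor `r`.
  ∣∑∣≤ : ∀ n → ∃[ N ] (0ℚ ≤ N × ∀ (f : Fin n → ℚ) {r} → (∀ i → ∣ f i ∣ ≤ r) → ∣ ∑ℚ f ∣ ≤ N * r)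
  ∣∑∣≤ n = ∑ℚ {n} (λ _ → 1ℚ) , 0≤∑1 n , λ f {r} f≤r →
    subst (∣ ∑ℚ f ∣ ≤_) (∑-const n r) (∣∑∣≤∑ f f≤r)

  ∑-distrib-neg : ∀ {n} (f g : Fin n → ℚ) → ∑ℚ f - ∑ℚ g ≡ ∑ℚ (λ i → f i - g i)
  ∑-distrib-neg {zero}  f g = refl
  ∑-distrib-neg {suc n} f g = trans
    (solve 4 (λ a b c d → a :+ b :- (c :+ d) := (a :- c) :+ (b :- d)) refl (f zero) (∑ℚ (f ∘ suc)) (g zero) (∑ℚ (g ∘ suc)))
    (cong (f zero - g zero +_) (∑-distrib-neg (f ∘ suc) (g ∘ suc)))

-- Homeomorphisms from parametrised triangles.

module Atlases where

  open import Defs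
  open Rationals
  open import Data.Rational.Base
  open import Data.Rational.Properties
  open import Data.Fin.Subset using (Subset; _∈_; ⁅_⁆; _∪_)
  open import Data.Fin.Subset.Properties using (x∈⁅x⁆; x∈⁅y⁆⇒x≡y; x∈p∪q⁺; x∈p∪q⁻)
  open import Data.Sum.Base using ([_,_])
  open import Relation.Nullary using (does)
  open import Data.Bool.Base using (if_then_else_)

  private
    variable
      n : ℕ

  ∑₃ : (Fin 3 → ℚ) → ℚ
  ∑₃ f = f 0F + f 1F + f 2F

  ∑₃-mono : ∀ {f g} → (∀ i → f i ≤ g i) → ∑₃ f ≤ ∑₃ g
  ∑₃-mono f≤g = +-mono-≤ (+-mono-≤ (f≤g 0F) (f≤g 1F)) (f≤g 2F)

  ∑₃-cong : ∀ {f g} → (∀ i → f i ≡ g i) → ∑₃ f ≡ ∑₃ g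
  ∑₃-cong f≡g = cong₂ _+_ (cong₂ _+_ (f≡g 0F) (f≡g 1F)) (f≡g 2F)

  ∑₃-nonNeg : ∀ {f} → (∀ i → 0ℚ ≤ f i) → 0ℚ ≤ ∑₃ f
  ∑₃-nonNeg h = +-nonNeg (+-nonNeg (h 0F) (h 1F)) (h 2F)

  ≤∑₃ : ∀ {f} → (∀ i → 0ℚ ≤ f i) → ∀ i → f i ≤ ∑₃ f
  ≤∑₃ {f} h 0F = 0≤q-p⇒p≤q (subst (0ℚ ≤_)
    (solve 3 (λ x y z → y :+ z := x :+ y :+ z :- x) refl (f 0F) (f 1F) (f 2F)) (+-nonNeg (h 1F) (h 2F)))
  ≤∑₃ {f} h 1F = 0≤q-p⇒p≤q (subst (0ℚ ≤_)
    (solve 3 (λ x y z → x :+ z := x :+ y :+ z :- y) refl (f 0F) (f 1F) (f 2F)) (+-nonNeg (h 0F) (h 2F)))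
  ≤∑₃ {f} h 2F = 0≤q-p⇒p≤q (subst (0ℚ ≤_)
    (solve 3 (λ x y z → x :+ y := x :+ y :+ z :- z) refl (f 0F) (f 1F) (f 2F)) (+-nonNeg (h 0F) (h 1F)))

  [_≡_]·_ : Fin n → Fin n → ℚ → ℚ
  [ u ≡ v ]· x = if does (u Finₚ.≟ v) then x else 0ℚ

  [≡]·-yes : ∀ {u v : Fin n} x → u ≡ v → [ u ≡ v ]· x ≡ x
  [≡]·-yes {u = u} x refl with u Finₚ.≟ u
  ... | yes _ = refl
  ... | no ≢  = contradiction refl ≢

  [≡]·-no : ∀ {u v : Fin n} x → u ≢ v → [ u ≡ v ]· x ≡ 0ℚ
  [≡]·-no {u = u} {v} x u≢v with u Finₚ.≟ v
  ... | yes eq = contradiction eq u≢v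
  ... | no _   = refl

  [≡]·-nonNeg : ∀ (u v : Fin n) {x} → 0ℚ ≤ x → 0ℚ ≤ [ u ≡ v ]· x
  [≡]·-nonNeg u v 0≤x with u Finₚ.≟ v
  ... | yes _ = 0≤x
  ... | no _  = ≤-refl

  ∑[≡]· : ∀ (u : Fin n) x → ∑ℚ (λ v → [ u ≡ v ]· x) ≡ x
  ∑[≡]· u x = trans (sum-single _ u λ v v≢u → [≡]·-no x (v≢u ∘ sym)) ([≡]·-yes {u = u} x refl)

  record Weights : Set where
    field
      weight    : Fin 3 → ℚ
      weight≥0  : ∀ i → 0ℚ ≤ weight i
      ∑weight≡1 : ∑₃ weight ≡ 1ℚ

  open Weights public

  -- Spreads the weights of three corners over all vertices of the complex, so that points of
  -- different triangles become comparable. Summing over corners is meaningful before the corners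
  -- are known to be distinct.
  coordinate : (Fin 3 → Fin n) → (Fin 3 → ℚ) → Fin n → ℚ
  coordinate V b v = ∑₃ λ i → [ V i ≡ v ]· b i

  vertexSet : (Fin 3 → Fin n) → Subset n
  vertexSet V = ⁅ V 0F ⁆ ∪ (⁅ V 1F ⁆ ∪ ⁅ V 2F ⁆)

  ∈vertexSet⁺ : ∀ (V : Fin 3 → Fin n) i → V i ∈ vertexSet V
  ∈vertexSet⁺ V 0F = x∈p∪q⁺ (inj₁ (x∈⁅x⁆ (V 0F)))
  ∈vertexSet⁺ V 1F = x∈p∪q⁺ {p = ⁅ V 0F ⁆} (inj₂ (x∈p∪q⁺ (inj₁ (x∈⁅x⁆ (V 1F)))))
  ∈vertexSet⁺ V 2F = x∈p∪q⁺ {p = ⁅ V 0F ⁆} (inj₂ (x∈p∪q⁺ {p = ⁅ V 1F ⁆} (inj₂ (x∈⁅x⁆ (V 2F)))))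

  ∈vertexSet⁻ : ∀ (V : Fin 3 → Fin n) {v} → v ∈ vertexSet V → ∃[ i ] V i ≡ v
  ∈vertexSet⁻ V v∈ with x∈p∪q⁻ _ _ v∈
  ... | inj₁ v∈0 = 0F , sym (x∈⁅y⁆⇒x≡y _ v∈0)
  ... | inj₂ v∈′ with x∈p∪q⁻ _ _ v∈′
  ...   | inj₁ v∈1 = 1F , sym (x∈⁅y⁆⇒x≡y _ v∈1)
  ...   | inj₂ v∈2 = 2F , sym (x∈⁅y⁆⇒x≡y _ v∈2)

  module _ (V : Fin 3 → Fin n) where

    coordinate-off : ∀ b {v} → (∀ i → V i ≢ v) → coordinate V b v ≡ 0ℚ
    coordinate-off b V≢v = ∑₃-cong λ i → [≡]·-no (b i) (V≢v i)

    coordinate-nonNeg : ∀ {b} → (∀ i → 0ℚ ≤ b i) → ∀ v → 0ℚ ≤ coordinate V b v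
    coordinate-nonNeg 0≤b v = ∑₃-nonNeg λ i → [≡]·-nonNeg (V i) v (0≤b i)

    ∑coordinate : ∀ b → ∑ℚ (coordinate V b) ≡ ∑₃ b
    ∑coordinate b = trans (∑-distrib-+ (λ v → c 0F v + c 1F v) (c 2F))
      (cong₂ _+_ (trans (∑-distrib-+ (c 0F) (c 1F)) (cong₂ _+_ (∑c 0F) (∑c 1F))) (∑c 2F))
      where
      c : Fin 3 → Fin _ → ℚ
      c i v = [ V i ≡ v ]· b i
      ∑c : ∀ i → ∑ℚ (c i) ≡ b i
      ∑c i = ∑[≡]· (V i) (b i)

    0<coordinate⇒vertex : ∀ b v → 0ℚ < coordinate V b v → ∃[ i ] V i ≡ v
    0<coordinate⇒vertex b v 0<c with Finₚ.any? (λ i → V i Finₚ.≟ v)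
    ... | yes found = found
    ... | no none = contradiction (sym (coordinate-off b λ i eq → none (i , eq))) (<⇒≢ 0<c)

    module _ (V-injective : Injective _≡_ _≡_ V) where

      coordinate-vertex : ∀ b i → coordinate V b (V i) ≡ b i
      coordinate-vertex b 0F = trans (cong₂ _+_ (cong₂ _+_ ([≡]·-yes {u = V 0F} (b 0F) refl) (no≡ 1F 0F λ ())) (no≡ 2F 0F λ ()))
        (solve 1 (λ x → x :+ con 0ℚ :+ con 0ℚ := x) refl (b 0F))
        where no≡ : ∀ i j → i ≢ j → [ V i ≡ V j ]· b i ≡ 0ℚ
              no≡ i j i≢j = [≡]·-no (b i) (i≢j ∘ V-injective)
      coordinate-vertex b 1F = trans (cong₂ _+_ (cong₂ _+_ (no≡ 0F 1F λ ()) ([≡]·-yes {u = V 1F} (b 1F) refl)) (no≡ 2F 1F λ ()))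
        (solve 1 (λ x → con 0ℚ :+ x :+ con 0ℚ := x) refl (b 1F))
        where no≡ : ∀ i j → i ≢ j → [ V i ≡ V j ]· b i ≡ 0ℚ
              no≡ i j i≢j = [≡]·-no (b i) (i≢j ∘ V-injective)
      coordinate-vertex b 2F = trans (cong₂ _+_ (cong₂ _+_ (no≡ 0F 2F λ ()) (no≡ 1F 2F λ ())) ([≡]·-yes {u = V 2F} (b 2F) refl))
        (solve 1 (λ x → con 0ℚ :+ con 0ℚ :+ x := x) refl (b 2F))
        where no≡ : ∀ i j → i ≢ j → [ V i ≡ V j ]· b i ≡ 0ℚ
              no≡ i j i≢j = [≡]·-no (b i) (i≢j ∘ V-injective)

      -- This turns an arbitrary point of the realisation, whose carrier is any face, into weights
      -- on a triangle containing that face.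
      coordinate-unique : ∀ c → (∀ v → (∀ i → V i ≢ v) → c v ≡ 0ℚ) → ∀ v → c v ≡ coordinate V (c ∘ V) v
      coordinate-unique c off v with Finₚ.any? (λ i → V i Finₚ.≟ v)
      ... | yes (i , refl) = sym (coordinate-vertex (c ∘ V) i)
      ... | no none = trans (off v none′) (sym (coordinate-off (c ∘ V) none′))
        where none′ : ∀ i → V i ≢ v
              none′ i eq = none (i , eq)

  Close : ℚ → (Fin n → ℚ) → (Fin n → ℚ) → Set
  Close δ c c′ = ∀ v → ∣ c v - c′ v ∣ < δ

  -- A parametrisation of the space A by the triangles of X in which a
  -- triangle may be parametrised several times.

  record Atlas (X : SimplicialComplex n) (A : Space) : Set₁ where
    field
      Triangle    : Set
      vertex      : Triangle → Fin 3 → Fin n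
      vertex-inj  : ∀ t → Injective _≡_ _≡_ (vertex t)
      isTriangle  : ∀ t → Face X (vertexSet (vertex t))
      triangleOf  : ∀ {σ} → Face X σ → Σ[ t ∈ Triangle ] (∀ {v} → v ∈ σ → ∃[ i ] vertex t i ≡ v)
      at          : Triangle → Weights → Point A
      locate      : ∀ P → Σ[ t ∈ Triangle ] Σ[ b ∈ Weights ] at t b ≡ P

    coord : Triangle → Weights → Fin n → ℚ
    coord t b = coordinate (vertex t) (weight b)

    field
      coord-cont  : ∀ ε → 0ℚ < ε → ∃[ δ ] (0ℚ < δ × (∀ t b t′ b′ →
                    Near A δ (at t b) (at t′ b′) → Close ε (coord t b) (coord t′ b′)))
      at-cont     : ∀ ε → 0ℚ < ε → ∃[ δ ] (0ℚ < δ × (∀ t b t′ b′ →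
                    Close δ (coord t b) (coord t′ b′) → Near A ε (at t b) (at t′ b′)))

  module _ {X : SimplicialComplex n} {A : Space} (𝒜 : Atlas X A) where
    open Atlas 𝒜
    private module R = RealisationPoint

    private
      point : Triangle → Weights → RealisationPoint X
      point t b = record
        { coord       = coord t b
        ; nonnegative = coordinate-nonNeg (vertex t) (weight≥0 b)
        ; sums-to-1   = trans (∑coordinate (vertex t) (weight b)) (∑weight≡1 b)
        ; carrier     = vertexSet (vertex t)
        ; isFace      = isTriangle t
        ; supported   = λ v v∉ → coordinate-off (vertex t) (weight b)
                          λ { i refl → v∉ (∈vertexSet⁺ (vertex t) i) }
        }

      triangle : RealisationPoint X → Triangle
      triangle p = proj₁ (triangleOf (R.isFace p))

      coord-expand : ∀ p v → R.coord p v ≡ coordinate (vertex (triangle p)) (R.coord p ∘ vertex (triangle p)) v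
      coord-expand p = coordinate-unique (vertex (triangle p)) (vertex-inj (triangle p)) (R.coord p)
        λ v none → R.supported p v λ v∈ → none _ (proj₂ (proj₂ (triangleOf (R.isFace p)) v∈))

      weights : RealisationPoint X → Weights
      weights p = record
        { weight    = R.coord p ∘ vertex (triangle p)
        ; weight≥0  = λ i → R.nonnegative p (vertex (triangle p) i)
        ; ∑weight≡1 = begin
            ∑₃ (R.coord p ∘ vertex (triangle p))
              ≡⟨ ∑coordinate (vertex (triangle p)) (R.coord p ∘ vertex (triangle p)) ⟨
            ∑ℚ (coordinate (vertex (triangle p)) (R.coord p ∘ vertex (triangle p)))
              ≡⟨ sum-cong-≗ (coord-expand p) ⟨
            ∑ℚ (R.coord p)
              ≡⟨ R.sums-to-1 p ⟩
            1ℚ ∎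
        }
        where open ≡-Reasoning

      to : RealisationPoint X → Point A
      to p = at (triangle p) (weights p)

      Close-expand : ∀ {ε} p q → Close ε (R.coord p) (R.coord q) →
                     Close ε (coord (triangle p) (weights p)) (coord (triangle q) (weights q))
      Close-expand p q close v = subst₂ (λ x y → ∣ x - y ∣ < _) (coord-expand p v) (coord-expand q v) (close v)

      Close-reflexive : ∀ {ε} {c c′ : Fin n → ℚ} → 0ℚ < ε → (∀ v → c v ≡ c′ v) → Close ε c c′
      Close-reflexive {c = c} 0<ε c≡c′ v =
        subst (_< _) (cong ∣_∣ (sym (trans (cong (λ x → c v - x) (sym (c≡c′ v))) (+-inverseʳ (c v))))) 0<ε

      from : Point A → RealisationPoint X
      from P = let t , b , _ = locate P in point t b

    -- The triangle found by `locate` for `to p` may differ from the one chosen for `p`, but both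
    -- parametrise the same point of `A`, so `coord-cont` forces equal coordinates. The other
    -- composite is symmetric, with `at-cont`.
    homeomorphic : Homeomorphic (Realisation X) A
    homeomorphic = record
      { to        = to
      ; from      = from
      ; to-cont   = λ ε 0<ε → let δ , 0<δ , cont = at-cont ε 0<ε in
          δ , 0<δ , λ p q close → cont _ _ _ _ (Close-expand p q close)
      ; from-cont = λ ε 0<ε → let δ , 0<δ , cont = coord-cont ε 0<ε in
          δ , 0<δ , λ P Q near → let _ , _ , eqP = locate P ; _ , _ , eqQ = locate Q in
            cont _ _ _ _ (subst₂ (Near A δ) (sym eqP) (sym eqQ) near)
      ; from∘to   = λ p ε 0<ε v → let
          t = triangle p ; b = weights p
          t′ , b′ , eq = locate (to p)
          δ , 0<δ , cont = coord-cont ε 0<ε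
          δ′ , 0<δ′ , cont′ = at-cont δ 0<δ
          -- A `Space` carries no reflexivity law. That `at t b` is near itself is extracted from
          -- `at-cont`, applied to equal coordinates.
          near = cont′ t b t b (Close-reflexive {c = coord t b} {coord t b} 0<δ′ λ _ → refl)
          in subst (λ x → ∣ coord t′ b′ v - x ∣ < ε) (sym (coord-expand p v))
               (cont t′ b′ t b (subst (λ P → Near A δ P (to p)) (sym eq) near) v)
      ; to∘from   = λ P ε 0<ε → let
          t , b , eq = locate P
          p = point t b
          δ , 0<δ , cont = at-cont ε 0<ε
          in subst (Near A ε (to p)) eq (cont (triangle p) (weights p) t b
               (Close-reflexive 0<δ λ v → sym (coord-expand p v)))
      }

-- The two continuity estimates on a universal cover.

module Covers where

  open import Defs
  open Rationals
  open Atlases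
  open import Data.Rational.Base
  open import Data.Rational.Properties
  open import Data.Fin.Subset using (_∈_)
  open import Data.Sum.Base using ([_,_])

  private
    variable
      n : ℕ

  ∑₃-+ : ∀ f g → ∑₃ (λ i → f i + g i) ≡ ∑₃ f + ∑₃ g
  ∑₃-+ f g = solve 6 (λ a b c d e h → (a :+ d) :+ (b :+ e) :+ (c :+ h) := (a :+ b :+ c) :+ (d :+ e :+ h)) refl
    (f 0F) (f 1F) (f 2F) (g 0F) (g 1F) (g 2F)

  ∑₃-* : ∀ c f → ∑₃ (λ i → c * f i) ≡ c * ∑₃ f
  ∑₃-* c f = solve 4 (λ c x y z → c :* x :+ c :* y :+ c :* z := c :* (x :+ y :+ z)) refl c (f 0F) (f 1F) (f 2F)

  mean : (Fin 3 → ℚ) → (Fin 3 → ℚ) → ℚ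
  mean b x = ∑₃ λ i → b i * x i

  mean-shift : ∀ (b : Weights) x a → mean (weight b) (λ i → x i - a) ≡ mean (weight b) x - a
  mean-shift b x a = begin
    mean w (λ i → x i - a)          ≡⟨ ∑₃-cong (λ i → solve 3 (λ w x a → w :* (x :- a) := w :* x :+ (:- a) :* w) refl (w i) (x i) a) ⟩
    ∑₃ (λ i → w i * x i + - a * w i) ≡⟨ ∑₃-+ (λ i → w i * x i) (λ i → - a * w i) ⟩
    mean w x + ∑₃ (λ i → - a * w i) ≡⟨ cong (mean w x +_) (∑₃-* (- a) w) ⟩
    mean w x + - a * ∑₃ w           ≡⟨ cong (λ s → mean w x + - a * s) (∑weight≡1 b) ⟩
    mean w x + - a * 1ℚ             ≡⟨ cong (mean w x +_) (*-identityʳ (- a)) ⟩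
    mean w x - a                    ∎
    where
    open ≡-Reasoning
    w = weight b

  mean-translate : ∀ (b : Weights) x a → mean (weight b) (λ i → x i + a) ≡ mean (weight b) x + a
  mean-translate b x a = begin
    mean (weight b) (λ i → x i + a)     ≡⟨ ∑₃-cong (λ i → cong (λ c → weight b i * (x i + c)) (neg-involutive a)) ⟨
    mean (weight b) (λ i → x i - (- a)) ≡⟨ mean-shift b x (- a) ⟩
    mean (weight b) x - (- a)           ≡⟨ cong (mean (weight b) x +_) (neg-involutive a) ⟩
    mean (weight b) x + a               ∎
    where
    open ≡-Reasoning
    neg-involutive : ∀ a → - (- a) ≡ a
    neg-involutive = solve 1 (λ a → :- (:- a) := a) refl

  mean-cong : ∀ b {x y : Fin 3 → ℚ} → (∀ i → x i ≡ y i) → mean b x ≡ mean b y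
  mean-cong b x≡y = ∑₃-cong λ i → cong (b i *_) (x≡y i)

  -- Normalised to be 1 at the origin, because it will be evaluated at positions relative to the
  -- vertex whose coordinate it bounds.
  affine : ℚ → ℚ → ℚ → ℚ → ℚ
  affine p q x y = 1ℚ + (p * x + q * y)

  mean-affine : ∀ (b : Weights) p q x y →
                mean (weight b) (λ i → affine p q (x i) (y i)) ≡
                affine p q (mean (weight b) x) (mean (weight b) y)
  mean-affine b p q x y = begin
    mean w (λ i → affine p q (x i) (y i))
      ≡⟨ ∑₃-cong (λ i → solve 5 (λ w p q x y → w :* (con 1ℚ :+ (p :* x :+ q :* y)) := w :+ (p :* (w :* x) :+ q :* (w :* y))) refl (w i) p q (x i) (y i)) ⟩
    ∑₃ (λ i → w i + (p * (w i * x i) + q * (w i * y i)))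
      ≡⟨ ∑₃-+ w (λ i → p * (w i * x i) + q * (w i * y i)) ⟩
    ∑₃ w + ∑₃ (λ i → p * (w i * x i) + q * (w i * y i))
      ≡⟨ cong₂ _+_ (∑weight≡1 b) (∑₃-+ (λ i → p * (w i * x i)) (λ i → q * (w i * y i))) ⟩
    1ℚ + (∑₃ (λ i → p * (w i * x i)) + ∑₃ (λ i → q * (w i * y i)))
      ≡⟨ cong (1ℚ +_) (cong₂ _+_ (∑₃-* p (λ i → w i * x i)) (∑₃-* q (λ i → w i * y i))) ⟩
    affine p q (mean w x) (mean w y) ∎
    where
    open ≡-Reasoning
    w = weight b

  -- Expresses a mean over corners by the coordinates alone, without mention of the triangle. This
  -- is how closeness of coordinates reaches the centres.
  ∑coordinate* : ∀ (V : Fin 3 → Fin n) b ξ →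
                 ∑ℚ (λ v → coordinate V b v * ξ v) ≡ mean b (ξ ∘ V)
  ∑coordinate* V b ξ = trans (sum-cong-≗ pointwise) (∑coordinate V (λ i → b i * ξ (V i)))
    where
    [≡]·-* : ∀ u v x → [ u ≡ v ]· x * ξ v ≡ [ u ≡ v ]· (x * ξ u)
    [≡]·-* u v x with u Finₚ.≟ v
    ... | yes refl = refl
    ... | no _     = *-zeroˡ (ξ v)
    pointwise : ∀ v → coordinate V b v * ξ v ≡ coordinate V (λ i → b i * ξ (V i)) v
    pointwise v = trans
      (solve 4 (λ x y z w → (x :+ y :+ z) :* w := x :* w :+ y :* w :+ z :* w) refl
        ([ V 0F ≡ v ]· b 0F) ([ V 1F ≡ v ]· b 1F) ([ V 2F ≡ v ]· b 2F) (ξ v))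
      (∑₃-cong λ i → [≡]·-* (V i) v (b i))

  -- A triangulated part of ℚ², the universal cover of A.  π sends its vertices
  -- to those of the complex; triangles with the same image under π are related
  -- by deck transformations.

  record Lifting (n : ℕ) : Set₁ where
    field
      Vertex     : Set
      π          : Vertex → Fin n
      x y        : Vertex → ℚ
      Triangle   : Set
      vertex     : Triangle → Fin 3 → Vertex

    centreX centreY : Triangle → Weights → ℚ
    centreX t b = mean (weight b) (x ∘ vertex t)
    centreY t b = mean (weight b) (y ∘ vertex t)

    infix 4 _∼_
    _∼_ : Triangle → Triangle → Set
    t ∼ t′ = ∀ i → π (vertex t i) ≡ π (vertex t′ i)

    record Within (δ : ℚ) (t : Triangle) (b : Weights) (t′ : Triangle) (b′ : Weights) : Set where
      constructor within
      field
        close-x : ∣ centreX t b - centreX t′ b′ ∣ < δ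
        close-y : ∣ centreY t b - centreY t′ b′ ∣ < δ

    -- One affine function that bounds the coordinate of v from above on t and
    -- from below on t′; since it is Lipschitz, so are the coordinates.

    record Separates (B : ℚ) (v : Vertex) (t t′ : Triangle) : Set where
      field
        p q        : ℚ
        ∣p∣≤       : ∣ p ∣ ≤ B
        ∣q∣≤       : ∣ q ∣ ≤ B
      value : Vertex → ℚ
      value w = affine p q (x w - x v) (y w - y v)
      field
        value≥0     : ∀ i → 0ℚ ≤ value (vertex t i)
        value≤0     : ∀ i → value (vertex t′ i) ≤ 0ℚ ⊎ vertex t′ i ≡ v

  -- `near⇒within` and `lift` translate between `A` and the plane: nearness in `A` is closeness in
  -- the plane after moving one triangle by a deck transformation, and a common label lets one
  -- triangle be moved so that the corners with this label coincide. By `star-inj`, the projection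
  -- is injective on the star of a vertex. The bounds in `edgeBound` and `separation` are uniform
  -- over all triangles, as uniform continuity demands.
  record Cover (X : SimplicialComplex n) (A : Space) : Set₁ where
    field
      lifting : Lifting n

    open Lifting lifting public

    field
      π∘vertex-inj  : ∀ t → Injective _≡_ _≡_ (π ∘ vertex t)
      isTriangle    : ∀ t → Face X (vertexSet (π ∘ vertex t))
      triangleOf    : ∀ {σ} → Face X σ → Σ[ t ∈ Triangle ] (∀ {v} → v ∈ σ → ∃[ i ] π (vertex t i) ≡ v)
      at            : Triangle → Weights → Point A
      locate        : ∀ P → Σ[ t ∈ Triangle ] Σ[ b ∈ Weights ] at t b ≡ P
      near⇒within   : ∀ δ t b t′ b′ → Near A δ (at t b) (at t′ b′) →
                      Σ[ t″ ∈ Triangle ] t″ ∼ t′ × Within δ t b t″ b′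
      lift          : ∀ t i t′ i′ → π (vertex t i) ≡ π (vertex t′ i′) →
                      Σ[ t″ ∈ Triangle ] t″ ∼ t′ × vertex t″ i′ ≡ vertex t i ×
                      (∀ δ b b′ → Within δ t b t″ b′ → Near A δ (at t b) (at t′ b′))
      star-inj      : ∀ t i t′ i′ → vertex t i ≡ vertex t′ i′ →
                      ∀ j j′ → π (vertex t j) ≡ π (vertex t′ j′) → vertex t j ≡ vertex t′ j′
      edgeBound     : ∃[ D ] (0ℚ ≤ D × (∀ t i j → ∣ x (vertex t i) - x (vertex t j) ∣ ≤ D
                                                × ∣ y (vertex t i) - y (vertex t j) ∣ ≤ D))
      separation    : ∃[ B ] (0ℚ ≤ B × (∀ t i t′ → Separates B (vertex t i) t t′))

  module _ {X : SimplicialComplex n} {A : Space} (𝒞 : Cover X A) where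
    open Cover 𝒞

    private
      coord : Triangle → Weights → Fin n → ℚ
      coord t b = coordinate (π ∘ vertex t) (weight b)

      coord-∼ : ∀ {t t′} → t ∼ t′ → ∀ b v → coord t b v ≡ coord t′ b v
      coord-∼ t∼t′ b v = ∑₃-cong λ i → cong (λ u → [ u ≡ v ]· weight b i) (t∼t′ i)

      module _ {B} (0≤B : 0ℚ ≤ B) {t i t′} (s : Separates B (vertex t i) t t′) where
        open Separates s

        private
          v = vertex t i
          value-v : value v ≡ 1ℚ
          value-v = solve 4 (λ p q x y → con 1ℚ :+ (p :* (x :- x) :+ q :* (y :- y)) := con 1ℚ) refl p q (x v) (y v)

          F F′ : Fin 3 → ℚ
          F j  = value (vertex t j)
          F′ j = value (vertex t′ j)

          mean-value : ∀ t b → mean (weight b) (value ∘ vertex t) ≡ affine p q (centreX t b - x v) (centreY t b - y v)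
          mean-value t b = trans (mean-affine b p q (λ j → x (vertex t j) - x v) (λ j → y (vertex t j) - y v))
            (cong₂ (affine p q) (mean-shift b (x ∘ vertex t) (x v)) (mean-shift b (y ∘ vertex t) (y v)))

        -- `value` is 1 at `v` and nonnegative on `t`, so the weight of `v` is at most the mean of
        -- `value` over `t`. On `t′` only corners equal to `v` contribute positively, so the mean
        -- there is at most the coordinate of `π v`. The two means are values of one affine function
        -- at the two centres, and slopes bounded by `B` control their difference.
        weight≤ : ∀ {δ b b′} → Within δ t b t′ b′ →
                  weight b i ≤ coord t′ b′ (π v) + (B * δ + B * δ)
        weight≤ {δ} {b} {b′} (within close-x close-y) = begin
          weight b i
            ≡⟨ trans (cong (weight b i *_) value-v) (*-identityʳ (weight b i)) ⟨
          weight b i * F i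
            ≤⟨ ≤∑₃ (λ j → *-nonNeg (weight≥0 b j) (value≥0 j)) i ⟩
          mean (weight b) F
            ≡⟨ solve 2 (λ p q → p := q :+ (p :- q)) refl (mean (weight b) F) (mean (weight b′) F′) ⟩
          mean (weight b′) F′ + (mean (weight b) F - mean (weight b′) F′)
            ≤⟨ +-mono-≤ (∑₃-mono term) (≤-trans (p≤∣p∣ _) difference) ⟩
          coord t′ b′ (π v) + (B * δ + B * δ) ∎
          where
          open ≤-Reasoning
          term : ∀ j → weight b′ j * F′ j ≤ [ π (vertex t′ j) ≡ π v ]· weight b′ j
          term j with value≤0 j
          ... | inj₁ F′≤0 = ≤-trans
            (subst (weight b′ j * F′ j ≤_) (*-zeroʳ (weight b′ j)) (*-monoˡ-≤-nonNeg (weight b′ j) {{nonNegative (weight≥0 b′ j)}} F′≤0))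
            ([≡]·-nonNeg (π (vertex t′ j)) (π v) (weight≥0 b′ j))
          ... | inj₂ eq = ≤-reflexive (trans
            (trans (cong (weight b′ j *_) (trans (cong value eq) value-v)) (*-identityʳ (weight b′ j)))
            (sym ([≡]·-yes (weight b′ j) (cong π eq))))
          difference : ∣ mean (weight b) F - mean (weight b′) F′ ∣ ≤ B * δ + B * δ
          difference = subst (_≤ B * δ + B * δ) (cong ∣_∣ (trans
            (solve 8 (λ p q X Y X′ Y′ a c → p :* (X :- X′) :+ q :* (Y :- Y′) :=
              con 1ℚ :+ (p :* (X :- a) :+ q :* (Y :- c)) :- (con 1ℚ :+ (p :* (X′ :- a) :+ q :* (Y′ :- c)))) refl
              p q (centreX t b) (centreY t b) (centreX t′ b′) (centreY t′ b′) (x v) (y v))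
            (sym (cong₂ _-_ (mean-value t b) (mean-value t′ b′)))))
            (∣p+q∣≤ (p * (centreX t b - centreX t′ b′)) (q * (centreY t b - centreY t′ b′))
              (∣p*q∣≤ p (centreX t b - centreX t′ b′) ∣p∣≤ (<⇒≤ close-x) 0≤B)
              (∣p*q∣≤ q (centreY t b - centreY t′ b′) ∣q∣≤ (<⇒≤ close-y) 0≤B))

      coord≤ : ∀ {δ t b t′ b′} → 0ℚ ≤ δ → Within δ t b t′ b′ →
               let B = proj₁ separation in
               ∀ v → coord t b v ≤ coord t′ b′ v + (B * δ + B * δ)
      coord≤ {δ} {t} {b} {t′} {b′} 0≤δ w v with separation
      ... | B , 0≤B , sep with Finₚ.any? (λ i → π (vertex t i) Finₚ.≟ v)
      ...   | yes (i , refl) = subst (_≤ _) (sym (coordinate-vertex (π ∘ vertex t) (π∘vertex-inj t) (weight b) i))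
                                 (weight≤ 0≤B (sep t i t′) {b = b} {b′} w)
      ...   | no none = subst (_≤ coord t′ b′ v + (B * δ + B * δ))
                          (sym (coordinate-off (π ∘ vertex t) (weight b) λ i eq → none (i , eq)))
                          (+-nonNeg (coordinate-nonNeg (π ∘ vertex t′) (weight≥0 b′) v)
                                    (+-nonNeg (*-nonNeg 0≤B 0≤δ) (*-nonNeg 0≤B 0≤δ)))

      within-sym : ∀ {δ t b t′ b′} → Within δ t b t′ b′ → Within δ t′ b′ t b
      within-sym {t = t} {b} {t′} {b′} (within cx cy) = within
        (subst (_< _) (∣p-q∣≡∣q-p∣ (centreX t b) (centreX t′ b′)) cx)
        (subst (_< _) (∣p-q∣≡∣q-p∣ (centreY t b) (centreY t′ b′)) cy)

      coord-cont : ∀ ε → 0ℚ < ε → ∃[ δ ] (0ℚ < δ × (∀ t b t′ b′ →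
                   Near A δ (at t b) (at t′ b′) → Close ε (coord t b) (coord t′ b′)))
      coord-cont ε 0<ε = δ , 0<δ , λ t b t′ b′ near v →
        let t″ , t″∼t′ , w = near⇒within δ t b t′ b′ near
            c = coord t b v
            c″ = coord t″ b′ v
            w≤ : ∀ {p q} → p ≤ q + (B * δ + B * δ) → p - q ≤ B * δ + B * δ
            w≤ {p} {q} le = subst (p - q ≤_)
              (solve 2 (λ q e → q :+ e :- q := e) refl q (B * δ + B * δ)) (+-monoˡ-≤ (- q) le)
            -- The estimate `coord≤` is one-sided; exchanging the two triangles gives the bound on
            -- the absolute value.
            small = ∣∣-lub (w≤ {c} {c″} (coord≤ {b = b} {b′ = b′} (<⇒≤ 0<δ) w v))
              (subst (_≤ _) (solve 2 (λ p q → q :- p := :- (p :- q)) refl c c″)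
                (w≤ {c″} {c} (coord≤ {b = b′} {b′ = b} (<⇒≤ 0<δ) (within-sym {b = b} {b′ = b′} w) v)))
        in subst (λ z → ∣ c - z ∣ < ε) (coord-∼ t″∼t′ b′ v)
             (≤-<-trans small (subst (_< ε) (*-distribʳ-+ δ B B) Cδ<ε))
        where
        B = proj₁ separation
        0≤B = proj₁ (proj₂ separation)
        m = modulus (+-nonNeg 0≤B 0≤B) 0<ε
        δ = proj₁ m
        0<δ = proj₁ (proj₂ m)
        Cδ<ε = proj₂ (proj₂ (proj₂ m))

      -- Both centres are the means, with respect to the coordinates on X, of one
      -- and the same function on the vertices of X.

      module _ (z : Vertex → ℚ) (t t′ : Triangle) (v : Vertex)
               (agree : ∀ j j′ → π (vertex t j) ≡ π (vertex t′ j′) → z (vertex t j) ≡ z (vertex t′ j′))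
               {D : ℚ} (0≤D : 0ℚ ≤ D)
               (edge : ∀ j → ∣ z (vertex t j) - z v ∣ ≤ D) (edge′ : ∀ j → ∣ z (vertex t′ j) - z v ∣ ≤ D) where

        private
          -- `z` is unbounded on the cover, whereas its increments from the common vertex `v` are
          -- bounded by `D`. For a label occurring in both triangles the increment taken from `t` is
          -- also the right one for `t′`, by `agree`. The default 0 is taken at labels where both
          -- coordinates vanish.
          ξ : Fin n → ℚ
          ξ w with Finₚ.any? (λ j → π (vertex t j) Finₚ.≟ w)
          ... | yes (j , _) = z (vertex t j) - z v
          ... | no _ with Finₚ.any? (λ j → π (vertex t′ j) Finₚ.≟ w)
          ...   | yes (j , _) = z (vertex t′ j) - z v
          ...   | no _ = 0ℚ

          ξ≤ : ∀ w → ∣ ξ w ∣ ≤ D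
          ξ≤ w with Finₚ.any? (λ j → π (vertex t j) Finₚ.≟ w)
          ... | yes (j , _) = edge j
          ... | no _ with Finₚ.any? (λ j → π (vertex t′ j) Finₚ.≟ w)
          ...   | yes (j , _) = edge′ j
          ...   | no _ = 0≤D

          ξ-vertex : ∀ i → ξ (π (vertex t i)) ≡ z (vertex t i) - z v
          ξ-vertex i with Finₚ.any? (λ j → π (vertex t j) Finₚ.≟ π (vertex t i))
          ... | yes (j , eq) = cong (λ k → z (vertex t k) - z v) (π∘vertex-inj t eq)
          ... | no none = contradiction (i , refl) none

          ξ-vertex′ : ∀ i → ξ (π (vertex t′ i)) ≡ z (vertex t′ i) - z v
          ξ-vertex′ i with Finₚ.any? (λ j → π (vertex t j) Finₚ.≟ π (vertex t′ i))
          ... | yes (j , eq) = cong (_- z v) (agree j i eq)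
          ... | no _ with Finₚ.any? (λ j → π (vertex t′ j) Finₚ.≟ π (vertex t′ i))
          ...   | yes (j , eq) = cong (λ k → z (vertex t′ k) - z v) (π∘vertex-inj t′ eq)
          ...   | no none = contradiction (i , refl) none

          centre : ∀ u → (∀ i → ξ (π (vertex u i)) ≡ z (vertex u i) - z v) → ∀ b →
                   mean (weight b) (z ∘ vertex u) - z v ≡ ∑ℚ (λ w → coord u b w * ξ w)
          centre u ξ-u b = trans (sym (mean-shift b (z ∘ vertex u) (z v))) (trans
            (∑₃-cong λ i → cong (weight b i *_) (sym (ξ-u i)))
            (sym (∑coordinate* (π ∘ vertex u) (weight b) ξ)))

        centres≤ : ∀ {δ b b′} → 0ℚ ≤ δ → Close δ (coord t b) (coord t′ b′) →
                   let N = proj₁ (∣∑∣≤ n) in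
                   ∣ mean (weight b) (z ∘ vertex t) - mean (weight b′) (z ∘ vertex t′) ∣ ≤ N * (δ * D)
        centres≤ {δ} {b} {b′} 0≤δ close = subst (_≤ N * (δ * D)) (cong ∣_∣ (begin
          ∑ℚ (λ w → (coord t b w - coord t′ b′ w) * ξ w)
            ≡⟨ sum-cong-≗ (λ w → solve 3 (λ c d e → (c :- d) :* e := c :* e :- d :* e) refl (coord t b w) (coord t′ b′ w) (ξ w)) ⟩
          ∑ℚ (λ w → coord t b w * ξ w - coord t′ b′ w * ξ w)
            ≡⟨ ∑-distrib-neg (λ w → coord t b w * ξ w) (λ w → coord t′ b′ w * ξ w) ⟨
          ∑ℚ (λ w → coord t b w * ξ w) - ∑ℚ (λ w → coord t′ b′ w * ξ w)
            ≡⟨ cong₂ _-_ (centre t ξ-vertex b) (centre t′ ξ-vertex′ b′) ⟨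
          (c - z v) - (c′ - z v)
            ≡⟨ solve 3 (λ c d e → (c :- e) :- (d :- e) := c :- d) refl c c′ (z v) ⟩
          c - c′ ∎))
          (bounded (λ w → (coord t b w - coord t′ b′ w) * ξ w) λ w →
            ∣p*q∣≤ (coord t b w - coord t′ b′ w) (ξ w) (<⇒≤ (close w)) (ξ≤ w) 0≤δ)
          where
          open ≡-Reasoning
          N = proj₁ (∣∑∣≤ n)
          bounded = proj₂ (proj₂ (∣∑∣≤ n))
          c  = mean (weight b) (z ∘ vertex t)
          c′ = mean (weight b′) (z ∘ vertex t′)

      -- Some corner of `t` has weight at least `⅓`. The coordinate of `t′` at that label differs by
      -- less than `⅓`, hence is positive, and only labels of corners have positive coordinates.
      common-vertex : ∀ {δ t b t′ b′} → δ ≤ ⅓ → Close δ (coord t b) (coord t′ b′) →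
                      ∃[ i ] ∃[ i′ ] π (vertex t i) ≡ π (vertex t′ i′)
      common-vertex {δ} {t} {b} {t′} {b′} δ≤⅓ close =
        let i , ⅓≤b = heavy
            i′ , eq = 0<coordinate⇒vertex (π ∘ vertex t′) (weight b′) (π (vertex t i)) (positive-at i ⅓≤b)
        in i , i′ , sym eq
        where
        heavy : ∃[ i ] ⅓ ≤ weight b i
        heavy with ≥⅓ {weight b 0F} {weight b 1F} {weight b 2F} (∑weight≡1 b)
        ... | inj₁ le = 0F , le
        ... | inj₂ (inj₁ le) = 1F , le
        ... | inj₂ (inj₂ le) = 2F , le
        positive-at : ∀ i → ⅓ ≤ weight b i → 0ℚ < coord t′ b′ (π (vertex t i))
        positive-at i ⅓≤b = subst₂ _<_ (+-inverseʳ ⅓) (solve 2 (λ c d → c :+ d :- d := c) refl c′ ⅓)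
          (+-monoˡ-< (- ⅓) (begin-strict
            ⅓           ≤⟨ ⅓≤b ⟩
            weight b i  ≡⟨ coordinate-vertex (π ∘ vertex t) (π∘vertex-inj t) (weight b) i ⟨
            c           <⟨ ∣p-q∣<δ⇒p<q+δ c c′ (close v) ⟩
            c′ + δ      ≤⟨ +-monoʳ-≤ c′ δ≤⅓ ⟩
            c′ + ⅓      ∎))
          where
          open ≤-Reasoning
          v = π (vertex t i)
          c = coord t b v
          c′ = coord t′ b′ v

      -- Close coordinates yield a common label; moving `t′` so that the corresponding corners
      -- coincide puts both triangles into one star. There a position is a function of the label,
      -- which is the hypothesis `agree` of `centres≤`.
      at-cont : ∀ ε → 0ℚ < ε → ∃[ δ ] (0ℚ < δ × (∀ t b t′ b′ →
                Close δ (coord t b) (coord t′ b′) → Near A ε (at t b) (at t′ b′)))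
      at-cont ε 0<ε = δ , 0<δ , λ t b t′ b′ close → let
          i , i′ , eq = common-vertex {b = b} {b′ = b′} δ≤⅓ close
          t″ , t″∼t′ , eq″ , near = lift t i t′ i′ eq
          close″ : Close δ (coord t b) (coord t″ b′)
          close″ v = subst (λ c → ∣ coord t b v - c ∣ < δ) (sym (coord-∼ t″∼t′ b′ v)) (close v)
          agree = star-inj t i t″ i′ (sym eq″)
          edge₁ = λ j → edge t j i
          edge₂ : ∀ j → ∣ x (vertex t″ j) - x (vertex t i) ∣ ≤ D × ∣ y (vertex t″ j) - y (vertex t i) ∣ ≤ D
          edge₂ j = subst (λ w → ∣ x (vertex t″ j) - x w ∣ ≤ D × ∣ y (vertex t″ j) - y w ∣ ≤ D) eq″ (edge t″ j i′)
        in near ε b b′ (within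
          (≤-<-trans (centres≤ x t t″ (vertex t i) (λ j j′ e → cong x (agree j j′ e)) 0≤D
            (λ j → proj₁ (edge₁ j)) (λ j → proj₁ (edge₂ j)) {b = b} {b′} (<⇒≤ 0<δ) close″) small)
          (≤-<-trans (centres≤ y t t″ (vertex t i) (λ j j′ e → cong y (agree j j′ e)) 0≤D
            (λ j → proj₂ (edge₁ j)) (λ j → proj₂ (edge₂ j)) {b = b} {b′} (<⇒≤ 0<δ) close″) small))
        where
        D = proj₁ edgeBound
        0≤D = proj₁ (proj₂ edgeBound)
        edge = proj₂ (proj₂ edgeBound)
        N = proj₁ (∣∑∣≤ n)
        m = modulus (*-nonNeg (proj₁ (proj₂ (∣∑∣≤ n))) 0≤D) 0<ε
        δ = proj₁ m
        0<δ = proj₁ (proj₂ m)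
        δ≤⅓ = proj₁ (proj₂ (proj₂ m))
        small : N * (δ * D) < ε
        small = subst (_< ε) (solve 3 (λ N D d → N :* D :* d := N :* (d :* D)) refl N D δ) (proj₂ (proj₂ (proj₂ m)))

    atlas : Atlas X A
    atlas = record
      { Triangle   = Triangle
      ; vertex     = λ t → π ∘ vertex t
      ; vertex-inj = π∘vertex-inj
      ; isTriangle = isTriangle
      ; triangleOf = triangleOf
      ; at         = at
      ; locate     = locate
      ; coord-cont = coord-cont
      ; at-cont    = at-cont
      }

-- Residues modulo k and translates of a triangle.

module Residues where

  open import Defs
  open Atlases using (vertexSet; ∈vertexSet⁺; ∈vertexSet⁻)
  open import Data.Nat.Base as ℕ using (NonZero)
  import Data.Nat.Properties as ℕₚ
  import Data.Nat.DivMod as ℕD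
  import Data.Nat.Divisibility as ℕ∣
  open import Data.Nat.GCD using (gcd; gcd-GCD; module Bézout)
  open import Data.Integer.Base hiding (NonZero)
  open import Data.Integer.Properties
  open import Data.Integer.DivMod using (n%ℕd<d; a≡a%ℕn+[a/ℕn]*n)
  open import Data.Integer.Divisibility.Signed
  open import Data.Integer.Tactic.RingSolver using (solve-∀)
  open import Data.Fin.Base using (fromℕ<)
  open import Data.Fin.Subset using (Subset; _∈_; _⊆_; ⁅_⁆; _∪_)
  open import Data.Fin.Subset.Properties using (∪-identityʳ)
  open import Data.Vec.Base as Vec using (Vec; []; _∷_)
  open import Data.Sum.Base using ([_,_])

  ∣-resp : ∀ {d x y} → x ≡ y → d ∣ x → d ∣ y
  ∣-resp refl d∣x = d∣x

  ∣-swap : ∀ {d} x y → d ∣ x - y → d ∣ y - x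
  ∣-swap x y d∣ = ∣-resp (neg-minus x y) (∣m⇒∣-m d∣)
    where neg-minus : ∀ x y → - (x - y) ≡ y - x
          neg-minus = solve-∀

  ∣-chain : ∀ {d} x y z → d ∣ x - y → d ∣ y - z → d ∣ x - z
  ∣-chain x y z d∣ d∣′ = ∣-resp (telescope x y z) (∣m∣n⇒∣m+n d∣ d∣′)
    where telescope : ∀ x y z → (x - y) + (y - z) ≡ x - z
          telescope = solve-∀

  ∣-ℕ : ∀ {a b} → a ℕ∣.∣ b → + a ∣ + b
  ∣-ℕ = ∣ᵤ⇒∣

  0<n<d⇒d∤n : ∀ {d n} → 0 ℕ.< n → n ℕ.< d → ¬ (+ d ∣ + n)
  0<n<d⇒d∤n 0<n n<d d∣n = ℕₚ.<⇒≱ n<d (ℕ∣.∣⇒≤ {{ℕ.>-nonZero 0<n}} (∣⇒∣ᵤ d∣n))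

  module _ {k : ℕ} .{{_ : NonZero k}} where

    ι : ℤ → Fin k
    ι z = fromℕ< (n%ℕd<d z k)

    ι-toℕ-∣ : ∀ z → + k ∣ z - + toℕ (ι z)
    ι-toℕ-∣ z = divides (z /ℕ k) (begin
      z - + toℕ (ι z)                                ≡⟨ cong (λ r → z - + r) (Finₚ.toℕ-fromℕ< (n%ℕd<d z k)) ⟩
      z - + (z %ℕ k)                                 ≡⟨ cong (_- + (z %ℕ k)) (a≡a%ℕn+[a/ℕn]*n z k) ⟩
      + (z %ℕ k) + (z /ℕ k) * + k - + (z %ℕ k)       ≡⟨ cancel (+ (z %ℕ k)) ((z /ℕ k) * + k) ⟩
      (z /ℕ k) * + k                                 ∎)
      where
      open ≡-Reasoning
      cancel : ∀ r q → r + q - r ≡ q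
      cancel = solve-∀

    ι-injective : ∀ x y → ι x ≡ ι y → + k ∣ x - y
    ι-injective x y eq = ∣-chain x (+ toℕ (ι x)) y (ι-toℕ-∣ x)
      (subst (λ v → + k ∣ + toℕ v - y) (sym eq) (∣-swap y (+ toℕ (ι y)) (ι-toℕ-∣ y)))

    private
      toℕ-unique-≤ : ∀ (u v : Fin k) → toℕ u ℕ.≤ toℕ v → + k ∣ + toℕ v - + toℕ u → u ≡ v
      toℕ-unique-≤ u v u≤v k∣ with ℕₚ.m≤n⇒m<n∨m≡n u≤v
      ... | inj₂ eq = Finₚ.toℕ-injective eq
      ... | inj₁ u<v = contradiction (subst (+ k ∣_) (trans (m-n≡m⊖n (toℕ v) (toℕ u)) (⊖-≥ u≤v)) k∣)
        (0<n<d⇒d∤n (ℕₚ.m<n⇒0<n∸m u<v) (ℕₚ.≤-<-trans (ℕₚ.m∸n≤m (toℕ v) (toℕ u)) (Finₚ.toℕ<n v)))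

    toℕ-unique : ∀ (u v : Fin k) → + k ∣ + toℕ u - + toℕ v → u ≡ v
    toℕ-unique u v k∣ with ℕₚ.≤-total (toℕ u) (toℕ v)
    ... | inj₁ u≤v = toℕ-unique-≤ u v u≤v (∣-swap (+ toℕ u) (+ toℕ v) k∣)
    ... | inj₂ v≤u = sym (toℕ-unique-≤ v u v≤u k∣)

    ι-cong : ∀ x y → + k ∣ x - y → ι x ≡ ι y
    ι-cong x y k∣ = toℕ-unique (ι x) (ι y)
      (∣-chain (+ toℕ (ι x)) x (+ toℕ (ι y)) (∣-swap x (+ toℕ (ι x)) (ι-toℕ-∣ x))
        (∣-chain x y (+ toℕ (ι y)) k∣ (ι-toℕ-∣ y)))

    ι-toℕ : ∀ v → ι (+ toℕ v) ≡ v
    ι-toℕ v = toℕ-unique (ι (+ toℕ v)) v (∣-swap (+ toℕ v) (+ toℕ (ι (+ toℕ v))) (ι-toℕ-∣ (+ toℕ v)))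

    ι-translate : ∀ x y z → + k ∣ x - y → ι (x + z) ≡ ι (y + z)
    ι-translate x y z k∣ = ι-cong (x + z) (y + z) (∣-resp (shift x y z) k∣)
      where shift : ∀ x y z → x - y ≡ x + z - (y + z)
            shift = solve-∀

    corner : ℤ → ℤ → ℤ → Fin 3 → ℤ
    corner s a b 0F = s
    corner s a b 1F = s + a
    corner s a b 2F = s + a + b

    corner-cong : ∀ s s′ a b i → + k ∣ s - s′ → ι (corner s a b i) ≡ ι (corner s′ a b i)
    corner-cong s s′ a b 0F k∣ = ι-cong s s′ k∣
    corner-cong s s′ a b 1F k∣ = ι-translate s s′ a k∣
    corner-cong s s′ a b 2F k∣ = trans (cong ι (+-assoc s a b))
      (trans (ι-translate s s′ (a + b) k∣) (cong ι (sym (+-assoc s′ a b))))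

    -- The base is an integer rather than a residue, so that moving it is plain addition. The third
    -- gap is left implicit, being determined by the sum `k`. Containment instead of equality covers
    -- the faces of all dimensions.
    Fits : Subset k → ℤ → ℤ → Set
    Fits σ a b = Σ[ s ∈ ℤ ] (∀ {v} → v ∈ σ → ∃[ i ] ι (corner s a b i) ≡ v)

    -- The second corner becomes the base. The third gap then leads from the old third corner to
    -- `s + k`, which is the old base modulo `k`.
    Fits-rotate : ∀ {σ a b c} → a + b + c ≡ + k → Fits σ a b → Fits σ b c
    Fits-rotate {σ} {a} {b} {c} eq (s , fits) = s + a , λ v∈σ → next (fits v∈σ)
      where
      next : ∀ {v} → ∃[ i ] ι (corner s a b i) ≡ v → ∃[ i ] ι (corner (s + a) b c i) ≡ v
      next (0F , e) = 2F , trans (ι-cong (s + a + b + c) s (divides 1ℤ (trans (regroup s a b c) (trans eq (sym (*-identityˡ (+ k))))))) e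
        where regroup : ∀ s a b c → s + a + b + c - s ≡ a + b + c
              regroup = solve-∀
      next (1F , e) = 0F , e
      next (2F , e) = 1F , e

    rotate-ι : ∀ s t → rotate s (t ℕD.mod k) ≡ ι (+ s + + t)
    rotate-ι s t = toℕ-unique _ _ (∣-chain (+ toℕ (rotate s t′)) (+ s + + t) (+ toℕ (ι (+ s + + t)))
      (∣-chain (+ toℕ (rotate s t′)) (+ (s ℕ.+ toℕ t′)) (+ s + + t) (mod-∣ (s ℕ.+ toℕ t′))
        (∣-resp (shift (+ s) (+ toℕ t′) (+ t)) (mod-∣ t)))
      (ι-toℕ-∣ (+ s + + t)))
      where
      t′ = t ℕD.mod k
      shift : ∀ s x y → x - y ≡ (s + x) - (s + y)
      shift = solve-∀
      mod-∣ : ∀ n → + k ∣ + toℕ (n ℕD.mod k) - + n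
      mod-∣ n = subst (λ r → + k ∣ + r - + n) (sym (Finₚ.toℕ-fromℕ< (ℕD.m%n<n n k)))
        (divides (- + (n ℕ./ k)) (begin
          + r - + n                        ≡⟨ cong (λ m → + r - + m) (ℕD.m≡m%n+[m/n]*n n k) ⟩
          + r - (+ (r ℕ.+ q ℕ.* k))        ≡⟨ cong (λ m → + r - (+ r + m)) (pos-* q k) ⟩
          + r - (+ r + + q * + k)          ≡⟨ cancel (+ r) (+ q) (+ k) ⟩
          - + q * + k                      ∎))
        where
        open ≡-Reasoning
        r = n ℕ.% k
        q = n ℕ./ k
        cancel : ∀ r q k → r - (r + q * k) ≡ - q * k
        cancel = solve-∀

    -- This is translate (triple a b c …) s by definition, without c and the proofs,
    -- which could not be inferred from it.

    translateOf : ℕ → ℕ → ℕ → Subset k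
    translateOf a b s = fromVertices (Vec.map (rotate s ∘ (ℕD._mod k)) (0 ∷ a ∷ a ℕ.+ b ∷ []))

    translateOf≡ : ∀ a b s → translateOf a b s ≡ vertexSet (ι ∘ corner (+ s) (+ a) (+ b))
    translateOf≡ a b s = cong₂ _∪_ (cong ⁅_⁆ e₀)
      (cong₂ _∪_ (cong ⁅_⁆ (rotate-ι s a))
        (trans (∪-identityʳ _) (cong ⁅_⁆ e₂)))
      where
      e₀ : rotate s (0 ℕD.mod k) ≡ ι (+ s)
      e₀ = trans (rotate-ι s 0) (cong ι (+-identityʳ (+ s)))
      e₂ : rotate s ((a ℕ.+ b) ℕD.mod k) ≡ ι (+ s + + a + + b)
      e₂ = trans (rotate-ι s (a ℕ.+ b)) (cong ι (sym (+-assoc (+ s) (+ a) (+ b))))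

    ⊆translate⇒Fits : ∀ {σ a b} → ∃[ s ] σ ⊆ translateOf a b s → Fits σ (+ a) (+ b)
    ⊆translate⇒Fits {a = a} {b} (s , σ⊆) = + s , λ v∈σ → ∈vertexSet⁻ _
      (subst (_ ∈_) (translateOf≡ a b s) (σ⊆ v∈σ))

    Fits⇒⊆translate : ∀ {σ a b} → Fits σ (+ a) (+ b) → ∃[ s ] σ ⊆ translateOf a b s
    Fits⇒⊆translate {a = a} {b} (s , fits) = toℕ (ι s) , λ v∈σ →
      subst (_ ∈_) (sym (translateOf≡ a b (toℕ (ι s)))) (member (fits v∈σ))
      where
      s′ = + toℕ (ι s)
      member : ∀ {v} → ∃[ i ] ι (corner s (+ a) (+ b) i) ≡ v → v ∈ vertexSet (ι ∘ corner s′ (+ a) (+ b))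
      member (i , refl) = subst (_∈ vertexSet (ι ∘ corner s′ (+ a) (+ b)))
        (corner-cong s′ s (+ a) (+ b) i (∣-swap s s′ (ι-toℕ-∣ s)))
        (∈vertexSet⁺ (ι ∘ corner s′ (+ a) (+ b)) i)

  bézout : ∀ m n → Σ[ u ∈ ℤ ] Σ[ v ∈ ℤ ] u * + m + v * + n ≡ + gcd m n
  bézout m n with Bézout.identity (gcd-GCD m n)
  ... | Bézout.Identity.+- x y eq = + x , - + y , (begin
    + x * + m + - + y * + n            ≡⟨ cong (_+ - + y * + n) (pos-* x m) ⟨
    + (x ℕ.* m) + - + y * + n          ≡⟨ cong (λ e → + e + - + y * + n) eq ⟨
    + gcd m n + + (y ℕ.* n) + - + y * + n ≡⟨ cong (λ e → + gcd m n + e + - + y * + n) (pos-* y n) ⟩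
    + gcd m n + + y * + n + - + y * + n ≡⟨ cancel (+ gcd m n) (+ y) (+ n) ⟩
    + gcd m n                          ∎)
    where
    open ≡-Reasoning
    cancel : ∀ g y n → g + y * n + - y * n ≡ g
    cancel = solve-∀
  ... | Bézout.Identity.-+ x y eq = - + x , + y , (begin
    - + x * + m + + y * + n            ≡⟨ cong (λ e → - + x * + m + e) (pos-* y n) ⟨
    - + x * + m + + (y ℕ.* n)          ≡⟨ cong (λ e → - + x * + m + + e) eq ⟨
    - + x * + m + (+ gcd m n + + (x ℕ.* m)) ≡⟨ cong (λ e → - + x * + m + (+ gcd m n + e)) (pos-* x m) ⟩
    - + x * + m + (+ gcd m n + + x * + m) ≡⟨ cancel (+ gcd m n) (+ x) (+ m) ⟩
    + gcd m n                          ∎)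
    where
    open ≡-Reasoning
    cancel : ∀ g x m → - x * m + (g + x * m) ≡ g
    cancel = solve-∀

-- The triangulated plane with vertex set ℤ².

module KuhnPlane where

  open import Data.Nat.Base as ℕ using (suc)
  import Data.Nat.Properties as ℕₚ
  open import Data.Integer.Base hiding (suc)
  open import Data.Integer.Properties
  open import Data.Integer.Tactic.RingSolver using (solve-∀)
  open import Relation.Nullary using (Dec)
  open import Relation.Nullary.Decidable using (from-yes; _×-dec_)

  -- The squares of ℤ² are subdivided by their diagonals of slope 1.

  record Lattice : Set where
    constructor _,_
    field
      px py : ℤ

  open Lattice public

  Cell : Set
  Cell = Fin 2 × Lattice

  -- A triangle is a monotone path from one end of the diagonal of a unit square to the other: type
  -- `0F` goes right and then up, type `1F` up and then right.
  offX offY : Fin 2 → Fin 3 → ℤ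
  offX τ  0F = 0ℤ
  offX τ  2F = 1ℤ
  offX 0F 1F = 1ℤ
  offX 1F 1F = 0ℤ
  offY τ  0F = 0ℤ
  offY τ  2F = 1ℤ
  offY 0F 1F = 0ℤ
  offY 1F 1F = 1ℤ

  corners : Cell → Fin 3 → Lattice
  corners (τ , (p , q)) i = p + offX τ i , q + offY τ i

  shift : Lattice → Cell → Cell
  shift (P , Q) (τ , (p , q)) = τ , (p + P , q + Q)

  -- The norm whose unit ball is the star of the origin.

  Hexagon : ℕ → ℤ → ℤ → Set
  Hexagon r a b = ∣ a ∣ ℕ.≤ r × ∣ b ∣ ℕ.≤ r × ∣ a - b ∣ ℕ.≤ r

  Hexagon? : ∀ r a b → Dec (Hexagon r a b)
  Hexagon? r a b = ∣ a ∣ ℕₚ.≤? r ×-dec ∣ b ∣ ℕₚ.≤? r ×-dec ∣ a - b ∣ ℕₚ.≤? r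

  edge-Hexagon : ∀ τ i j → Hexagon 1 (offX τ i - offX τ j) (offY τ i - offY τ j)
  edge-Hexagon = from-yes (Finₚ.all? λ τ → Finₚ.all? λ i → Finₚ.all? λ j →
    Hexagon? 1 (offX τ i - offX τ j) (offY τ i - offY τ j))

  Hexagon-minus : ∀ a b c d → Hexagon 1 a b → Hexagon 1 c d → Hexagon 2 (a - c) (b - d)
  Hexagon-minus a b c d (∣a∣≤1 , ∣b∣≤1 , ∣a-b∣≤1) (∣c∣≤1 , ∣d∣≤1 , ∣c-d∣≤1) =
    ∣-∣≤2 a c ∣a∣≤1 ∣c∣≤1 , ∣-∣≤2 b d ∣b∣≤1 ∣d∣≤1 ,
    subst (λ z → ∣ z ∣ ℕ.≤ 2) (regroup a b c d) (∣-∣≤2 (a - b) (c - d) ∣a-b∣≤1 ∣c-d∣≤1)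
    where
    ∣-∣≤2 : ∀ x y → ∣ x ∣ ℕ.≤ 1 → ∣ y ∣ ℕ.≤ 1 → ∣ x - y ∣ ℕ.≤ 2
    ∣-∣≤2 x y x≤ y≤ = ℕₚ.≤-trans (∣i-j∣≤∣i∣+∣j∣ x y) (ℕₚ.+-mono-≤ x≤ y≤)
    regroup : ∀ a b c d → (a - b) - (c - d) ≡ (a - c) - (b - d)
    regroup = solve-∀

  offset-injective : ∀ τ i j → offX τ i - offX τ j ≡ 0ℤ → offY τ i - offY τ j ≡ 0ℤ → i ≡ j
  offset-injective τ  0F 0F _ _ = refl
  offset-injective 0F 0F 1F () _
  offset-injective 1F 0F 1F _ ()
  offset-injective τ  0F 2F () _
  offset-injective 0F 1F 0F () _
  offset-injective 1F 1F 0F _ ()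
  offset-injective τ  1F 1F _ _ = refl
  offset-injective 0F 1F 2F _ ()
  offset-injective 1F 1F 2F () _
  offset-injective τ  2F 0F () _
  offset-injective 0F 2F 1F _ ()
  offset-injective 1F 2F 1F () _
  offset-injective τ  2F 2F _ _ = refl

  normalX normalY : Fin 6 → ℤ
  normalX 0F = 1ℤ
  normalX 1F = -1ℤ
  normalX 2F = 0ℤ
  normalX 3F = 0ℤ
  normalX 4F = 1ℤ
  normalX 5F = -1ℤ
  normalY 0F = 0ℤ
  normalY 1F = 0ℤ
  normalY 2F = 1ℤ
  normalY 3F = -1ℤ
  normalY 4F = -1ℤ
  normalY 5F = 1ℤ

  -- The star of the origin is the set where all these forms are at most 1.

  form : Fin 6 → ℤ → ℤ → ℤ
  form h a b = normalX h * a + normalY h * b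

  ∣normal∣≤1 : ∀ h → ∣ normalX h ∣ ℕ.≤ 1 × ∣ normalY h ∣ ℕ.≤ 1
  ∣normal∣≤1 = from-yes (Finₚ.all? λ h → ∣ normalX h ∣ ℕₚ.≤? 1 ×-dec ∣ normalY h ∣ ℕₚ.≤? 1)

  form-edge : ∀ h τ i j → form h (offX τ i - offX τ j) (offY τ i - offY τ j) ≤ 1ℤ
  form-edge = from-yes (Finₚ.all? λ h → Finₚ.all? λ τ → Finₚ.all? λ i → Finₚ.all? λ j →
    form h (offX τ i - offX τ j) (offY τ i - offY τ j) ≤? 1ℤ)

  private
    0≤offX : ∀ τ i → 0ℤ ≤ offX τ i
    0≤offX = from-yes (Finₚ.all? λ τ → Finₚ.all? λ i → 0ℤ ≤? offX τ i)
    0≤offY : ∀ τ i → 0ℤ ≤ offY τ i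
    0≤offY = from-yes (Finₚ.all? λ τ → Finₚ.all? λ i → 0ℤ ≤? offY τ i)
    offX≤1 : ∀ τ i → offX τ i ≤ 1ℤ
    offX≤1 = from-yes (Finₚ.all? λ τ → Finₚ.all? λ i → offX τ i ≤? 1ℤ)
    offY≤1 : ∀ τ i → offY τ i ≤ 1ℤ
    offY≤1 = from-yes (Finₚ.all? λ τ → Finₚ.all? λ i → offY τ i ≤? 1ℤ)

    1≤suc+ : ∀ m {o} → 0ℤ ≤ o → 1ℤ ≤ +[1+ m ] + o
    1≤suc+ m 0≤o = +-mono-≤ (+≤+ (ℕ.s≤s (ℕ.z≤n {m}))) 0≤o

    1≤-neg : ∀ m {o} → o ≤ 1ℤ → 1ℤ ≤ - (-[1+ suc m ] + o)
    1≤-neg m {o} o≤1 = neg-mono-≤ (≤-trans (+-monoʳ-≤ -[1+ suc m ] o≤1) (-≤- ℕ.z≤n))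

    form-0 : ∀ a b → a ≡ 1ℤ * a + 0ℤ * b
    form-0 = solve-∀
    form-1 : ∀ a b → - a ≡ -1ℤ * a + 0ℤ * b
    form-1 = solve-∀
    form-2 : ∀ a b → b ≡ 0ℤ * a + 1ℤ * b
    form-2 = solve-∀
    form-3 : ∀ a b → - b ≡ 0ℤ * a + -1ℤ * b
    form-3 = solve-∀

  separating-form : ∀ τ m n → ∃[ h ] (∀ i →
    1ℤ ≤ form h (m + offX τ i) (n + offY τ i) ⊎ (m + offX τ i ≡ 0ℤ × n + offY τ i ≡ 0ℤ))
  separating-form τ +[1+ m ] n = 0F , λ i → inj₁ (subst (1ℤ ≤_) (form-0 _ (n + offY τ i)) (1≤suc+ m (0≤offX τ i)))
  separating-form τ -[1+ suc m ] n = 1F , λ i → inj₁ (subst (1ℤ ≤_) (form-1 _ (n + offY τ i)) (1≤-neg m (offX≤1 τ i)))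
  separating-form τ m@(+ 0) +[1+ n ] = 2F , λ i → inj₁ (subst (1ℤ ≤_) (form-2 (m + offX τ i) _) (1≤suc+ n (0≤offY τ i)))
  separating-form τ m@(+ 0) -[1+ suc n ] = 3F , λ i → inj₁ (subst (1ℤ ≤_) (form-3 (m + offX τ i) _) (1≤-neg n (offY≤1 τ i)))
  separating-form τ m@(-[1+ 0 ]) +[1+ n ] = 2F , λ i → inj₁ (subst (1ℤ ≤_) (form-2 (m + offX τ i) _) (1≤suc+ n (0≤offY τ i)))
  separating-form τ m@(-[1+ 0 ]) -[1+ suc n ] = 3F , λ i → inj₁ (subst (1ℤ ≤_) (form-3 (m + offX τ i) _) (1≤-neg n (offY≤1 τ i)))
  separating-form 0F (+ 0) (+ 0) = 0F , λ
    { 0F → inj₂ (refl , refl) ; 1F → inj₁ ≤-refl ; 2F → inj₁ ≤-refl }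
  separating-form 0F (+ 0) -[1+ 0 ] = 4F , λ
    { 0F → inj₁ ≤-refl ; 1F → inj₁ (+≤+ (ℕ.s≤s ℕ.z≤n)) ; 2F → inj₁ ≤-refl }
  separating-form 0F -[1+ 0 ] (+ 0) = 5F , λ
    { 0F → inj₁ ≤-refl ; 1F → inj₂ (refl , refl) ; 2F → inj₁ ≤-refl }
  separating-form 0F -[1+ 0 ] -[1+ 0 ] = 3F , λ
    { 0F → inj₁ ≤-refl ; 1F → inj₁ ≤-refl ; 2F → inj₂ (refl , refl) }
  separating-form 1F (+ 0) (+ 0) = 2F , λ
    { 0F → inj₂ (refl , refl) ; 1F → inj₁ ≤-refl ; 2F → inj₁ ≤-refl }
  separating-form 1F (+ 0) -[1+ 0 ] = 4F , λ
    { 0F → inj₁ ≤-refl ; 1F → inj₂ (refl , refl) ; 2F → inj₁ ≤-refl }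
  separating-form 1F -[1+ 0 ] (+ 0) = 5F , λ
    { 0F → inj₁ ≤-refl ; 1F → inj₁ (+≤+ (ℕ.s≤s ℕ.z≤n)) ; 2F → inj₁ ≤-refl }
  separating-form 1F -[1+ 0 ] -[1+ 0 ] = 1F , λ
    { 0F → inj₁ ≤-refl ; 1F → inj₁ ≤-refl ; 2F → inj₂ (refl , refl) }

-- The torus as a quotient of the triangulated plane.

module TorusCovers where

  open import Defs
  open Rationals
  open Atlases
  open Covers
  open Residues
  open KuhnPlane
  open import Data.Nat.Base as ℕ using (NonZero)
  open import Data.Integer.Base as ℤ using (ℤ; 0ℤ; 1ℤ)
  import Data.Integer.Properties as ℤₚ
  open import Data.Integer.Divisibility.Signed using (_∣_; ∣n⇒∣m*n)
  open import Data.Integer.Tactic.RingSolver using (solve-∀)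
  open import Data.Rational.Base hiding (NonZero)
  open import Data.Rational.Properties
  open import Data.Fin.Subset using (_∈_)

  linear : ℚ → ℚ → Lattice → ℚ
  linear A B w = A * fromℤ (px w) + B * fromℤ (py w)

  linear-minus : ∀ A B w w′ → linear A B w - linear A B w′ ≡
             A * fromℤ (px w ℤ.- px w′) + B * fromℤ (py w ℤ.- py w′)
  linear-minus A B w w′ = trans
    (solve 6 (λ A B a b c d → A :* a :+ B :* b :- (A :* c :+ B :* d) := A :* (a :- c) :+ B :* (b :- d)) refl
      A B (fromℤ (px w)) (fromℤ (py w)) (fromℤ (px w′)) (fromℤ (py w′)))
    (sym (cong₂ (λ a b → A * a + B * b) (fromℤ-minus (px w) (px w′)) (fromℤ-minus (py w) (py w′))))

  corners-minus : ∀ p o o′ → (p ℤ.+ o) ℤ.- (p ℤ.+ o′) ≡ o ℤ.- o′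
  corners-minus = solve-∀

  linear-edge : ∀ A B t i j →
                ∣ linear A B (corners t i) - linear A B (corners t j) ∣ ≤ ∣ A ∣ * 1ℚ + ∣ B ∣ * 1ℚ
  linear-edge A B t@(τ , (p , q)) i j =
    subst (_≤ ∣ A ∣ * 1ℚ + ∣ B ∣ * 1ℚ) (cong ∣_∣ (sym (linear-minus A B (corners t i) (corners t j))))
      (∣p+q∣≤ (A * fromℤ a) (B * fromℤ b)
        (∣p*q∣≤ A (fromℤ a) ≤-refl (∣fromℤ∣≤ a ∣a∣≤1) (0≤∣p∣ A))
        (∣p*q∣≤ B (fromℤ b) ≤-refl (∣fromℤ∣≤ b ∣b∣≤1) (0≤∣p∣ B)))
    where
    a = px (corners t i) ℤ.- px (corners t j)
    b = py (corners t i) ℤ.- py (corners t j)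
    ∣a∣≤1 : ℤ.∣ a ∣ ℕ.≤ 1
    ∣a∣≤1 = subst (λ z → ℤ.∣ z ∣ ℕ.≤ 1) (sym (corners-minus p (offX τ i) (offX τ j))) (proj₁ (edge-Hexagon τ i j))
    ∣b∣≤1 : ℤ.∣ b ∣ ℕ.≤ 1
    ∣b∣≤1 = subst (λ z → ℤ.∣ z ∣ ℕ.≤ 1) (sym (corners-minus q (offY τ i) (offY τ j))) (proj₁ (proj₂ (edge-Hexagon τ i j)))

  linear-shift : ∀ A B a b P Q →
    linear A B (a ℤ.+ P , b ℤ.+ Q) ≡ linear A B (a , b) + linear A B (P , Q)
  linear-shift A B a b P Q = trans
    (cong₂ (λ x y → A * x + B * y) (fromℤ-+ a P) (fromℤ-+ b Q))
    (solve 6 (λ A B a b c d → A :* (a :+ c) :+ B :* (b :+ d) := A :* a :+ B :* b :+ (A :* c :+ B :* d)) refl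
      A B (fromℤ a) (fromℤ b) (fromℤ P) (fromℤ Q))

  corners-shift : ∀ P Q t i → corners (shift (P , Q) t) i ≡ (px (corners t i) ℤ.+ P , py (corners t i) ℤ.+ Q)
  corners-shift P Q (τ , (p , q)) i = cong₂ _,_ (swap p P (offX τ i)) (swap q Q (offY τ i))
    where swap : ∀ p P o → (p ℤ.+ P) ℤ.+ o ≡ (p ℤ.+ o) ℤ.+ P
          swap = solve-∀

  -- The order of the two fractional parts decides on which side of the diagonal the point lies, and
  -- the barycentric weights are the successive differences of 1, the larger part, the smaller part
  -- and 0. Quantifying over all `A` and `B` lets the same weights serve both coordinates of the
  -- torus.
  kuhn-locate : ∀ x y → Σ[ t ∈ Cell ] Σ[ b ∈ Weights ]
                (∀ A B → mean (weight b) (linear A B ∘ corners t) ≡ A * x + B * y)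
  kuhn-locate x y with integerPart x | integerPart y
  ... | p , p≤x , x≤p+1 | q , q≤y , y≤q+1 with ≤-total g f
    where
    f = x - fromℤ p
    g = y - fromℤ q
  ... | inj₁ g≤f = (0F , (p , q)) , b , mean≡
    where
    f = x - fromℤ p
    g = y - fromℤ q
    w : Fin 3 → ℚ
    w 0F = 1ℚ - f
    w 1F = f - g
    w 2F = g
    b : Weights
    b = record
      { weight    = w
      ; weight≥0  = λ { 0F → p≤q⇒0≤q-p (subst (f ≤_) (solve 1 (λ p → p :+ con 1ℚ :- p := con 1ℚ) refl (fromℤ p)) (+-monoˡ-≤ (- fromℤ p) x≤p+1))
                      ; 1F → p≤q⇒0≤q-p g≤f
                      ; 2F → p≤q⇒0≤q-p q≤y }
      ; ∑weight≡1 = solve 2 (λ f g → con 1ℚ :- f :+ (f :- g) :+ g := con 1ℚ) refl f g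
      }
    mean≡ : ∀ A B → mean w (linear A B ∘ corners (0F , (p , q))) ≡ A * x + B * y
    mean≡ A B = trans
      (mean-cong w λ i → linear-shift A B p q (offX 0F i) (offY 0F i))
      (solve 6 (λ A B x y p q →
        (con 1ℚ :- (x :- p)) :* (A :* p :+ B :* q :+ (A :* con 0ℚ :+ B :* con 0ℚ)) :+
        ((x :- p) :- (y :- q)) :* (A :* p :+ B :* q :+ (A :* con 1ℚ :+ B :* con 0ℚ)) :+
        (y :- q) :* (A :* p :+ B :* q :+ (A :* con 1ℚ :+ B :* con 1ℚ)) := A :* x :+ B :* y) refl
        A B x y (fromℤ p) (fromℤ q))
  ... | inj₂ f≤g = (1F , (p , q)) , b , mean≡
    where
    f = x - fromℤ p
    g = y - fromℤ q
    w : Fin 3 → ℚ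
    w 0F = 1ℚ - g
    w 1F = g - f
    w 2F = f
    b : Weights
    b = record
      { weight    = w
      ; weight≥0  = λ { 0F → p≤q⇒0≤q-p (subst (g ≤_) (solve 1 (λ p → p :+ con 1ℚ :- p := con 1ℚ) refl (fromℤ q)) (+-monoˡ-≤ (- fromℤ q) y≤q+1))
                      ; 1F → p≤q⇒0≤q-p f≤g
                      ; 2F → p≤q⇒0≤q-p p≤x }
      ; ∑weight≡1 = solve 2 (λ f g → con 1ℚ :- g :+ (g :- f) :+ f := con 1ℚ) refl f g
      }
    mean≡ : ∀ A B → mean w (linear A B ∘ corners (1F , (p , q))) ≡ A * x + B * y
    mean≡ A B = trans
      (mean-cong w λ i → linear-shift A B p q (offX 1F i) (offY 1F i))
      (solve 6 (λ A B x y p q →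
        (con 1ℚ :- (y :- q)) :* (A :* p :+ B :* q :+ (A :* con 0ℚ :+ B :* con 0ℚ)) :+
        ((y :- q) :- (x :- p)) :* (A :* p :+ B :* q :+ (A :* con 0ℚ :+ B :* con 1ℚ)) :+
        (x :- p) :* (A :* p :+ B :* q :+ (A :* con 1ℚ :+ B :* con 1ℚ)) := A :* x :+ B :* y) refl
        A B x y (fromℤ p) (fromℤ q))

  -- In the application `d` is `gcd l j`, with `l = d α` and `j = d β`, and `e` is a vertex of the
  -- component: a step to the right adds `l` to the index and a step upwards adds `j`.
  module TorusLifting {k : ℕ} .{{_ : NonZero k}} (e d α β : ℤ) where

    index : Lattice → ℤ
    index (p , q) = e ℤ.+ d ℤ.* (α ℤ.* p ℤ.+ β ℤ.* q)

    label : Lattice → Fin k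
    label w = ι (index w)

    index-minus : ∀ w w′ → index w ℤ.- index w′ ≡ d ℤ.* (α ℤ.* (px w ℤ.- px w′) ℤ.+ β ℤ.* (py w ℤ.- py w′))
    index-minus (p , q) (p′ , q′) = regroup e d α β p q p′ q′
      where regroup : ∀ e d α β p q p′ q′ → e ℤ.+ d ℤ.* (α ℤ.* p ℤ.+ β ℤ.* q) ℤ.- (e ℤ.+ d ℤ.* (α ℤ.* p′ ℤ.+ β ℤ.* q′))
                      ≡ d ℤ.* (α ℤ.* (p ℤ.- p′) ℤ.+ β ℤ.* (q ℤ.- q′))
            regroup = solve-∀

    -- The vertices of ℤ² with the same label form a coset of the lattice
    -- { (P , Q) : k ∣ d (α P + β Q) }.  The coordinates (α p + β q) / K and
    -- u q - v p map this lattice onto ℤ².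

    module _
      (X : SimplicialComplex k)
      (isTriangle : ∀ t → Face X (vertexSet (label ∘ corners t)))
      (triangleOf : ∀ {σ} → Face X σ → Σ[ t ∈ Cell ] (∀ {x} → x ∈ σ → ∃[ i ] label (corners t i) ≡ x))
      (nondegenerate : ∀ a b → Hexagon 2 a b → ℤ.+ k ∣ d ℤ.* (α ℤ.* a ℤ.+ β ℤ.* b) → a ≡ 0ℤ × b ≡ 0ℤ)
      (K : ℕ) .{{_ : NonZero K}}
      (period : ∀ w → ℤ.+ k ∣ d ℤ.* w → ℤ.+ K ∣ w) (isPeriod : ℤ.+ k ∣ d ℤ.* ℤ.+ K)
      (u v : ℤ) (unimodular : u ℤ.* α ℤ.+ v ℤ.* β ≡ 1ℤ)
      where

      private
        α′ = fromℤ α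
        β′ = fromℤ β
        u′ = fromℤ u
        v′ = fromℤ v
        K′ = fromℤ (ℤ.+ K)
        κ = proj₁ (reciprocal K)

        Kκ≡1 : K′ * κ ≡ 1ℚ
        Kκ≡1 = proj₂ (reciprocal K)

        unimodular′ : u′ * α′ + v′ * β′ ≡ 1ℚ
        unimodular′ = trans (sym (trans (fromℤ-+ (u ℤ.* α) (v ℤ.* β)) (cong₂ _+_ (fromℤ-* u α) (fromℤ-* v β))))
          (cong fromℤ unimodular)

        xA xB yA yB : ℚ
        xA = α′ * κ
        xB = β′ * κ
        yA = - v′
        yB = u′

        lifting : Lifting k
        lifting = record
          { Vertex   = Lattice
          ; π        = label
          ; x        = linear xA xB
          ; y        = linear yA yB
          ; Triangle = Cell
          ; vertex   = corners
          }

        open Lifting lifting using (centreX; centreY; _∼_; Within; within; Separates)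

        label-injective : ∀ w w′ → Hexagon 2 (px w ℤ.- px w′) (py w ℤ.- py w′) → label w ≡ label w′ →
                          px w ℤ.- px w′ ≡ 0ℤ × py w ℤ.- py w′ ≡ 0ℤ
        label-injective w w′ hex eq = nondegenerate _ _ hex
          (∣-resp (index-minus w w′) (ι-injective (index w) (index w′) eq))

        corners-Hexagon : ∀ t i j → Hexagon 1 (px (corners t i) ℤ.- px (corners t j)) (py (corners t i) ℤ.- py (corners t j))
        corners-Hexagon (τ , (p , q)) i j = subst₂ (Hexagon 1)
          (sym (corners-minus p (offX τ i) (offX τ j))) (sym (corners-minus q (offY τ i) (offY τ j))) (edge-Hexagon τ i j)

        Hexagon-1⇒2 : ∀ a b → Hexagon 1 a b → Hexagon 2 a b
        Hexagon-1⇒2 a b (h₁ , h₂ , h₃) = weaken h₁ , weaken h₂ , weaken h₃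
          where weaken : ∀ {m} → m ℕ.≤ 1 → m ℕ.≤ 2
                weaken ℕ.z≤n = ℕ.z≤n
                weaken (ℕ.s≤s ℕ.z≤n) = ℕ.s≤s ℕ.z≤n

        label∘corners-injective : ∀ t → Injective _≡_ _≡_ (label ∘ corners t)
        label∘corners-injective t@(τ , (p , q)) {i} {j} eq =
          let x≡0 , y≡0 = label-injective (corners t i) (corners t j) (Hexagon-1⇒2 (px (corners t i) ℤ.- px (corners t j)) (py (corners t i) ℤ.- py (corners t j)) (corners-Hexagon t i j)) eq
          in offset-injective τ i j (trans (sym (corners-minus p (offX τ i) (offX τ j))) x≡0)
                                    (trans (sym (corners-minus q (offY τ i) (offY τ j))) y≡0)

        Lattice-≡ : ∀ w w′ → px w ℤ.- px w′ ≡ 0ℤ → py w ℤ.- py w′ ≡ 0ℤ → w ≡ w′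
        Lattice-≡ (p , q) (p′ , q′) ex ey = cong₂ _,_ (ℤₚ.i-j≡0⇒i≡j p p′ ex) (ℤₚ.i-j≡0⇒i≡j q q′ ey)

        -- Relative to the common corner both vertices lie in the hexagon of radius 1, so their
        -- difference lies in that of radius 2, the range of `nondegenerate`.
        star-injective : ∀ t i t′ i′ → corners t i ≡ corners t′ i′ →
          ∀ j j′ → label (corners t j) ≡ label (corners t′ j′) → corners t j ≡ corners t′ j′
        star-injective t i t′ i′ common j j′ eq =
          let ex , ey = label-injective (corners t j) (corners t′ j′) hexagon eq
          in Lattice-≡ _ _ ex ey
          where
          through : ∀ x y z → (x ℤ.- z) ℤ.- (y ℤ.- z) ≡ x ℤ.- y
          through = solve-∀
          hexagon : Hexagon 2 (px (corners t j) ℤ.- px (corners t′ j′)) (py (corners t j) ℤ.- py (corners t′ j′))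
          hexagon = subst₂ (Hexagon 2)
            (through (px (corners t j)) (px (corners t′ j′)) (px (corners t i)))
            (through (py (corners t j)) (py (corners t′ j′)) (py (corners t i)))
            (Hexagon-minus (px (corners t j) ℤ.- px (corners t i)) (py (corners t j) ℤ.- py (corners t i))
              (px (corners t′ j′) ℤ.- px (corners t i)) (py (corners t′ j′) ℤ.- py (corners t i)) (corners-Hexagon t j i)
              (subst (λ w → Hexagon 1 (px (corners t′ j′) ℤ.- px w) (py (corners t′ j′) ℤ.- py w)) (sym common)
                (corners-Hexagon t′ j′ i′)))

        shift-∼ : ∀ P Q t → ℤ.+ k ∣ d ℤ.* (α ℤ.* P ℤ.+ β ℤ.* Q) → shift (P , Q) t ∼ t
        shift-∼ P Q t k∣ i = ι-cong (index (corners (shift (P , Q) t) i)) (index (corners t i)) (∣-resp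
          (sym (trans (index-minus (corners (shift (P , Q) t) i) (corners t i))
            (cong₂ (λ a b → d ℤ.* (α ℤ.* a ℤ.+ β ℤ.* b))
              (trans (cong (λ w → px w ℤ.- px (corners t i)) (corners-shift P Q t i)) (cancel (px (corners t i)) P))
              (trans (cong (λ w → py w ℤ.- py (corners t i)) (corners-shift P Q t i)) (cancel (py (corners t i)) Q)))))
          k∣)
          where cancel : ∀ a P → a ℤ.+ P ℤ.- a ≡ P
                cancel = solve-∀

        centre-shift : ∀ A B P Q t b → mean (weight b) (linear A B ∘ corners (shift (P , Q) t)) ≡
                       mean (weight b) (linear A B ∘ corners t) + linear A B (P , Q)
        centre-shift A B P Q t b = trans
          (mean-cong (weight b) λ i → trans (cong (linear A B) (corners-shift P Q t i)) (linear-shift A B (px (corners t i)) (py (corners t i)) P Q))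
          (mean-translate b (linear A B ∘ corners t) (linear A B (P , Q)))

        x-period : ∀ P Q a → α ℤ.* P ℤ.+ β ℤ.* Q ≡ a ℤ.* ℤ.+ K → linear xA xB (P , Q) ≡ fromℤ a
        x-period P Q a eq = begin
          α′ * κ * fromℤ P + β′ * κ * fromℤ Q
            ≡⟨ solve 5 (λ α β κ P Q → α :* κ :* P :+ β :* κ :* Q := (α :* P :+ β :* Q) :* κ) refl α′ β′ κ (fromℤ P) (fromℤ Q) ⟩
          (α′ * fromℤ P + β′ * fromℤ Q) * κ
            ≡⟨ cong (_* κ) (trans (fromℤ-+ (α ℤ.* P) (β ℤ.* Q)) (cong₂ _+_ (fromℤ-* α P) (fromℤ-* β Q))) ⟨
          fromℤ (α ℤ.* P ℤ.+ β ℤ.* Q) * κ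
            ≡⟨ cong (_* κ) (trans (cong fromℤ eq) (fromℤ-* a (ℤ.+ K))) ⟩
          fromℤ a * K′ * κ
            ≡⟨ trans (*-assoc (fromℤ a) K′ κ) (trans (cong (fromℤ a *_) Kκ≡1) (*-identityʳ (fromℤ a))) ⟩
          fromℤ a ∎
          where open ≡-Reasoning

        y-period : ∀ P Q → linear yA yB (P , Q) ≡ fromℤ (u ℤ.* Q ℤ.- v ℤ.* P)
        y-period P Q = sym (begin
          fromℤ (u ℤ.* Q ℤ.- v ℤ.* P)      ≡⟨ fromℤ-minus (u ℤ.* Q) (v ℤ.* P) ⟩
          fromℤ (u ℤ.* Q) - fromℤ (v ℤ.* P) ≡⟨ cong₂ _-_ (fromℤ-* u Q) (fromℤ-* v P) ⟩
          u′ * fromℤ Q - v′ * fromℤ P      ≡⟨ solve 4 (λ u v P Q → u :* Q :- v :* P := :- v :* P :+ u :* Q) refl u′ v′ (fromℤ P) (fromℤ Q) ⟩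
          - v′ * fromℤ P + u′ * fromℤ Q    ∎)
          where open ≡-Reasoning

        at : Cell → Weights → Point Torus
        at t b = centreX t b , centreY t b

        locate : ∀ P → Σ[ t ∈ Cell ] Σ[ b ∈ Weights ] at t b ≡ P
        locate (X , Y) =
          -- The arguments are the inverse of the coordinate change: `unimodular` makes the
          -- determinant of the latter `1 / K`.
          let t , b , mean≡ = kuhn-locate (u′ * K′ * X - β′ * Y) (v′ * K′ * X + α′ * Y)
          in t , b , cong₂ _,_ (trans (mean≡ xA xB) x≡) (trans (mean≡ yA yB) y≡)
          where
          open ≡-Reasoning
          x≡ : xA * (u′ * K′ * X - β′ * Y) + xB * (v′ * K′ * X + α′ * Y) ≡ X
          x≡ = begin
            α′ * κ * (u′ * K′ * X - β′ * Y) + β′ * κ * (v′ * K′ * X + α′ * Y)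
              ≡⟨ solve 8 (λ α β u v K κ X Y → α :* κ :* (u :* K :* X :- β :* Y) :+ β :* κ :* (v :* K :* X :+ α :* Y)
                   := (u :* α :+ v :* β) :* (K :* κ) :* X) refl α′ β′ u′ v′ K′ κ X Y ⟩
            (u′ * α′ + v′ * β′) * (K′ * κ) * X ≡⟨ cong₂ (λ s r → s * r * X) unimodular′ Kκ≡1 ⟩
            1ℚ * 1ℚ * X                        ≡⟨ *-identityˡ X ⟩
            X                                  ∎
          y≡ : yA * (u′ * K′ * X - β′ * Y) + yB * (v′ * K′ * X + α′ * Y) ≡ Y
          y≡ = begin
            - v′ * (u′ * K′ * X - β′ * Y) + u′ * (v′ * K′ * X + α′ * Y)
              ≡⟨ solve 7 (λ α β u v K X Y → :- v :* (u :* K :* X :- β :* Y) :+ u :* (v :* K :* X :+ α :* Y)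
                   := (u :* α :+ v :* β) :* Y) refl α′ β′ u′ v′ K′ X Y ⟩
            (u′ * α′ + v′ * β′) * Y            ≡⟨ cong (_* Y) unimodular′ ⟩
            1ℚ * Y                             ≡⟨ *-identityˡ Y ⟩
            Y                                  ∎

        near⇒within : ∀ δ t b t′ b′ → Near Torus δ (at t b) (at t′ b′) →
                      Σ[ t″ ∈ Cell ] t″ ∼ t′ × Within δ t b t″ b′
        near⇒within δ t b t′ b′ ((a , near-x) , (c , near-y)) = shift (P , Q) t′ , shift-∼ P Q t′ k∣ , within
          (subst (λ z → ∣ centreX t b - z ∣ < δ)
            (sym (trans (centre-shift xA xB P Q t′ b′) (cong (centreX t′ b′ +_) (x-period P Q a W≡)))) near-x)
          (subst (λ z → ∣ centreY t b - z ∣ < δ)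
            (sym (trans (centre-shift yA yB P Q t′ b′) (cong (centreY t′ b′ +_) (trans (y-period P Q) (cong fromℤ Z≡))))) near-y)
          where
          -- The same inverse matrix, applied to the integral translation `(a , c)` of the torus,
          -- produces the deck transformation inducing it.
          P = u ℤ.* (a ℤ.* ℤ.+ K) ℤ.- β ℤ.* c
          Q = v ℤ.* (a ℤ.* ℤ.+ K) ℤ.+ α ℤ.* c
          W≡ : α ℤ.* P ℤ.+ β ℤ.* Q ≡ a ℤ.* ℤ.+ K
          W≡ = trans (expand α β u v (a ℤ.* ℤ.+ K) c) (trans (cong (ℤ._* (a ℤ.* ℤ.+ K)) unimodular) (ℤₚ.*-identityˡ _))
            where expand : ∀ α β u v m c → α ℤ.* (u ℤ.* m ℤ.- β ℤ.* c) ℤ.+ β ℤ.* (v ℤ.* m ℤ.+ α ℤ.* c) ≡ (u ℤ.* α ℤ.+ v ℤ.* β) ℤ.* m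
                  expand = solve-∀
          Z≡ : u ℤ.* Q ℤ.- v ℤ.* P ≡ c
          Z≡ = trans (expand α β u v (a ℤ.* ℤ.+ K) c) (trans (cong (ℤ._* c) unimodular) (ℤₚ.*-identityˡ c))
            where expand : ∀ α β u v m c → u ℤ.* (v ℤ.* m ℤ.+ α ℤ.* c) ℤ.- v ℤ.* (u ℤ.* m ℤ.- β ℤ.* c) ≡ (u ℤ.* α ℤ.+ v ℤ.* β) ℤ.* c
                  expand = solve-∀
          k∣ : ℤ.+ k ∣ d ℤ.* (α ℤ.* P ℤ.+ β ℤ.* Q)
          k∣ = ∣-resp (trans (swap d a (ℤ.+ K)) (cong (d ℤ.*_) (sym W≡))) (∣n⇒∣m*n a isPeriod)
            where swap : ∀ d a K → a ℤ.* (d ℤ.* K) ≡ d ℤ.* (a ℤ.* K)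
                  swap = solve-∀

        lift : ∀ t i t′ i′ → label (corners t i) ≡ label (corners t′ i′) →
               Σ[ t″ ∈ Cell ] t″ ∼ t′ × corners t″ i′ ≡ corners t i ×
               (∀ δ b b′ → Within δ t b t″ b′ → Near Torus δ (at t b) (at t′ b′))
        lift t i t′ i′ eq = shift (P , Q) t′ , shift-∼ P Q t′ k∣ ,
          trans (corners-shift P Q t′ i′) (cong₂ _,_ (cancel (px (corners t i)) (px (corners t′ i′))) (cancel (py (corners t i)) (py (corners t′ i′)))) ,
          λ δ b b′ (within close-x close-y) →
            (a , subst (λ z → ∣ centreX t b - z ∣ < δ)
              (trans (centre-shift xA xB P Q t′ b′) (cong (centreX t′ b′ +_) (x-period P Q a W≡))) close-x) ,
            (u ℤ.* Q ℤ.- v ℤ.* P , subst (λ z → ∣ centreY t b - z ∣ < δ)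
              (trans (centre-shift yA yB P Q t′ b′) (cong (centreY t′ b′ +_) (y-period P Q))) close-y)
          where
          P = px (corners t i) ℤ.- px (corners t′ i′)
          Q = py (corners t i) ℤ.- py (corners t′ i′)
          cancel : ∀ a b → b ℤ.+ (a ℤ.- b) ≡ a
          cancel = solve-∀
          k∣ : ℤ.+ k ∣ d ℤ.* (α ℤ.* P ℤ.+ β ℤ.* Q)
          k∣ = ∣-resp (index-minus (corners t i) (corners t′ i′)) (ι-injective (index (corners t i)) (index (corners t′ i′)) eq)
          -- The quotient `a` is the number of turns by which this deck transformation moves the
          -- first coordinate.
          K∣ = period _ k∣
          a = _∣_.quotient K∣
          W≡ : α ℤ.* P ℤ.+ β ℤ.* Q ≡ a ℤ.* ℤ.+ K
          W≡ = _∣_.equality K∣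

        edgeBound : ∃[ D ] (0ℚ ≤ D × (∀ t i j →
          ∣ linear xA xB (corners t i) - linear xA xB (corners t j) ∣ ≤ D ×
          ∣ linear yA yB (corners t i) - linear yA yB (corners t j) ∣ ≤ D))
        edgeBound = Dx + Dy , +-nonNeg 0≤Dx 0≤Dy , λ t i j →
          ≤-trans (linear-edge xA xB t i j) (subst (_≤ Dx + Dy) (+-identityʳ Dx) (+-monoʳ-≤ Dx 0≤Dy)) ,
          ≤-trans (linear-edge yA yB t i j) (subst (_≤ Dx + Dy) (+-identityˡ Dy) (+-monoˡ-≤ Dy 0≤Dx))
          where
          Dx = ∣ xA ∣ * 1ℚ + ∣ xB ∣ * 1ℚ
          Dy = ∣ yA ∣ * 1ℚ + ∣ yB ∣ * 1ℚ
          0≤Dx : 0ℚ ≤ Dx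
          0≤Dx = +-nonNeg (*-nonNeg (0≤∣p∣ xA) (nonNegative⁻¹ 1ℚ)) (*-nonNeg (0≤∣p∣ xB) (nonNegative⁻¹ 1ℚ))
          0≤Dy : 0ℚ ≤ Dy
          0≤Dy = +-nonNeg (*-nonNeg (0≤∣p∣ yA) (nonNegative⁻¹ 1ℚ)) (*-nonNeg (0≤∣p∣ yB) (nonNegative⁻¹ 1ℚ))

        module _ (h : Fin 6) where
          private
            n₁ = fromℤ (normalX h)
            n₂ = fromℤ (normalY h)

          -- The slopes of `1 - form h` pulled back along the inverse matrix, so that the integral
          -- forms on the lattice become affine functions of the torus coordinates.
          P Q : ℚ
          P = (n₁ * - u′ + n₂ * - v′) * K′
          Q = n₁ * β′ + n₂ * - α′

          Bx By : ℚ
          Bx = (1ℚ * ∣ - u′ ∣ + 1ℚ * ∣ - v′ ∣) * ∣ K′ ∣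
          By = 1ℚ * ∣ β′ ∣ + 1ℚ * ∣ - α′ ∣

          private
            ∣normals∣ : ∀ p q → ∣ n₁ * p + n₂ * q ∣ ≤ 1ℚ * ∣ p ∣ + 1ℚ * ∣ q ∣
            ∣normals∣ p q = ∣p+q∣≤ (n₁ * p) (n₂ * q)
              (∣p*q∣≤ n₁ p (∣fromℤ∣≤ (normalX h) (proj₁ (∣normal∣≤1 h))) ≤-refl (nonNegative⁻¹ 1ℚ))
              (∣p*q∣≤ n₂ q (∣fromℤ∣≤ (normalY h) (proj₂ (∣normal∣≤1 h))) ≤-refl (nonNegative⁻¹ 1ℚ))

          0≤Bx : 0ℚ ≤ Bx
          0≤Bx = *-nonNeg (+-nonNeg (*-nonNeg (nonNegative⁻¹ 1ℚ) (0≤∣p∣ (- u′))) (*-nonNeg (nonNegative⁻¹ 1ℚ) (0≤∣p∣ (- v′)))) (0≤∣p∣ K′)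

          0≤By : 0ℚ ≤ By
          0≤By = +-nonNeg (*-nonNeg (nonNegative⁻¹ 1ℚ) (0≤∣p∣ β′)) (*-nonNeg (nonNegative⁻¹ 1ℚ) (0≤∣p∣ (- α′)))

          ∣P∣≤ : ∣ P ∣ ≤ Bx
          ∣P∣≤ = ∣p*q∣≤ (n₁ * - u′ + n₂ * - v′) K′ (∣normals∣ (- u′) (- v′)) ≤-refl
            (+-nonNeg (*-nonNeg (nonNegative⁻¹ 1ℚ) (0≤∣p∣ (- u′))) (*-nonNeg (nonNegative⁻¹ 1ℚ) (0≤∣p∣ (- v′))))

          ∣Q∣≤ : ∣ Q ∣ ≤ By
          ∣Q∣≤ = ∣normals∣ β′ (- α′)

          value≡ : ∀ w w′ → affine P Q (linear xA xB w - linear xA xB w′) (linear yA yB w - linear yA yB w′) ≡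
                   fromℤ (1ℤ ℤ.- form h (px w ℤ.- px w′) (py w ℤ.- py w′))
          value≡ w w′ = begin
            affine P Q (linear xA xB w - linear xA xB w′) (linear yA yB w - linear yA yB w′)
              ≡⟨ cong₂ (affine P Q) (linear-minus xA xB w w′) (linear-minus yA yB w w′) ⟩
            affine P Q (xA * a + xB * b) (yA * a + yB * b)
              ≡⟨ solve 10 (λ n₁ n₂ α β u v K κ a b →
                   con 1ℚ :+ ((n₁ :* (:- u) :+ n₂ :* (:- v)) :* K :* (α :* κ :* a :+ β :* κ :* b) :+ (n₁ :* β :+ n₂ :* (:- α)) :* (:- v :* a :+ u :* b))
                   := con 1ℚ :+ ((n₁ :* (:- u) :+ n₂ :* (:- v)) :* (α :* a :+ β :* b) :* (K :* κ) :+ (n₁ :* β :+ n₂ :* (:- α)) :* (:- v :* a :+ u :* b)))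
                   refl n₁ n₂ α′ β′ u′ v′ K′ κ a b ⟩
            expression (K′ * κ) ≡⟨ cong expression Kκ≡1 ⟩
            expression 1ℚ
              ≡⟨ solve 8 (λ n₁ n₂ α β u v a b →
                   con 1ℚ :+ ((n₁ :* (:- u) :+ n₂ :* (:- v)) :* (α :* a :+ β :* b) :* con 1ℚ :+ (n₁ :* β :+ n₂ :* (:- α)) :* (:- v :* a :+ u :* b))
                   := con 1ℚ :- (u :* α :+ v :* β) :* (n₁ :* a :+ n₂ :* b))
                   refl n₁ n₂ α′ β′ u′ v′ a b ⟩
            1ℚ - (u′ * α′ + v′ * β′) * (n₁ * a + n₂ * b)
              ≡⟨ cong (λ s → 1ℚ - s) (trans (cong (_* (n₁ * a + n₂ * b)) unimodular′) (*-identityˡ (n₁ * a + n₂ * b))) ⟩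
            1ℚ - (n₁ * a + n₂ * b)
              ≡⟨ cong (λ s → 1ℚ - s) (trans (fromℤ-+ (normalX h ℤ.* i) (normalY h ℤ.* j)) (cong₂ _+_ (fromℤ-* (normalX h) i) (fromℤ-* (normalY h) j))) ⟨
            1ℚ - fromℤ (form h i j)
              ≡⟨ fromℤ-minus 1ℤ (form h i j) ⟨
            fromℤ (1ℤ ℤ.- form h i j) ∎
            where
            open ≡-Reasoning
            i = px w ℤ.- px w′
            j = py w ℤ.- py w′
            a = fromℤ i
            b = fromℤ j
            expression : ℚ → ℚ
            expression z = 1ℚ + ((n₁ * - u′ + n₂ * - v′) * (α′ * a + β′ * b) * z + (n₁ * β′ + n₂ * - α′) * (- v′ * a + u′ * b))

        -- `Bx` and `By` have the same value for all six forms, since the normals were replaced by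
        -- the bound 1; `0F` stands for any of them.
        B : ℚ
        B = Bx 0F + By 0F

        separates : ∀ t i t′ → Separates B (corners t i) t t′
        separates t@(τ , (p , q)) i t′@(τ′ , (p′ , q′)) = record
          { p       = P h
          ; q       = Q h
          ; ∣p∣≤    = ≤-trans (∣P∣≤ h) (subst (_≤ B) (+-identityʳ (Bx h)) (+-monoʳ-≤ (Bx h) (0≤By h)))
          ; ∣q∣≤    = ≤-trans (∣Q∣≤ h) (subst (_≤ B) (+-identityˡ (By h)) (+-monoˡ-≤ (By h) (0≤Bx h)))
          ; value≥0 = λ j → subst (0ℚ ≤_) (sym (value≡ h (corners t j) w))
              (fromℤ-mono-≤ {0ℤ} (ℤₚ.i≤j⇒0≤j-i (subst (ℤ._≤ 1ℤ)
                (cong₂ (form h) (sym (corners-minus p (offX τ j) (offX τ i))) (sym (corners-minus q (offY τ j) (offY τ i))))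
                (form-edge h τ j i))))
          ; value≤0 = nonpositive
          }
          where
          w = corners t i
          choice = separating-form τ′ (p′ ℤ.- px w) (q′ ℤ.- py w)
          h = proj₁ choice
          regroup : ∀ p w o → p ℤ.- w ℤ.+ o ≡ p ℤ.+ o ℤ.- w
          regroup = solve-∀
          nonpositive : ∀ j → affine (P h) (Q h) (linear xA xB (corners t′ j) - linear xA xB w) (linear yA yB (corners t′ j) - linear yA yB w) ≤ 0ℚ
                            ⊎ corners t′ j ≡ w
          nonpositive j with proj₂ choice j
          ... | inj₁ 1≤ = inj₁ (subst (_≤ 0ℚ) (sym (value≡ h (corners t′ j) w))
            (fromℤ-mono-≤ {b = 0ℤ} (ℤₚ.i≤j⇒i-j≤0 (subst (1ℤ ℤ.≤_)
              (cong₂ (form h) (regroup p′ (px w) (offX τ′ j)) (regroup q′ (py w) (offY τ′ j))) 1≤))))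
          ... | inj₂ (ex , ey) = inj₂ (Lattice-≡ (corners t′ j) w
            (trans (sym (regroup p′ (px w) (offX τ′ j))) ex) (trans (sym (regroup q′ (py w) (offY τ′ j))) ey))

      torusCover : Cover X Torus
      torusCover = record
        { lifting      = lifting
        ; π∘vertex-inj = label∘corners-injective
        ; isTriangle   = isTriangle
        ; triangleOf   = triangleOf
        ; at           = at
        ; locate       = locate
        ; near⇒within  = near⇒within
        ; lift         = lift
        ; star-inj     = star-injective
        ; edgeBound    = edgeBound
        ; separation   = B , +-nonNeg (0≤Bx 0F) (0≤By 0F) , separates
        }

-- The Möbius strip as a quotient of a triangulated strip.

module MoebiusCovers where

  open import Defs
  open Rationals
  open Atlases
  open Covers
  open Residues
  open import Data.Nat.Base as ℕ using (zero; suc; NonZero)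
  import Data.Nat.Properties as ℕₚ
  open import Data.Integer.Base as ℤ using (ℤ; 0ℤ; 1ℤ)
  import Data.Integer.Properties as ℤₚ
  open import Data.Integer.Divisibility.Signed using (_∣_; ∣n⇒∣m*n)
  open import Data.Integer.Tactic.RingSolver using (solve-∀)
  open import Data.Rational.Base hiding (NonZero)
  open import Data.Rational.Properties
  open import Data.Fin.Subset using (_∈_)
  open import Relation.Nullary.Decidable using (from-yes)

  -1ℚ : ℚ
  -1ℚ = - 1ℚ

  -- The sign (-1)^a, built from `flip^` of the absolute value because the gluing in `MöbiusStrip`
  -- has that form.
  sgn : ℤ → ℚ
  sgn a = flip^ ℤ.∣ a ∣ 1ℚ

  neg-involutive : ∀ p → - (- p) ≡ p
  neg-involutive = solve 1 (λ p → :- (:- p) := p) refl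

  sgn-suc : ∀ a → sgn (1ℤ ℤ.+ a) ≡ - sgn a
  sgn-suc (ℤ.+ n)             = refl
  sgn-suc ℤ.-[1+ zero ]       = refl
  sgn-suc ℤ.-[1+ suc n ]      = sym (neg-involutive (sgn ℤ.-[1+ n ]))

  sgn-±1 : ∀ a → sgn a ≡ 1ℚ ⊎ sgn a ≡ -1ℚ
  sgn-±1 a = go ℤ.∣ a ∣
    where
    go : ∀ n → flip^ n 1ℚ ≡ 1ℚ ⊎ flip^ n 1ℚ ≡ -1ℚ
    go zero = inj₁ refl
    go (suc n) with go n
    ... | inj₁ e = inj₂ (cong -_ e)
    ... | inj₂ e = inj₁ (cong -_ e)

  sgn*sgn : ∀ a → sgn a * sgn a ≡ 1ℚ
  sgn*sgn a with sgn-±1 a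
  ... | inj₁ e = cong₂ _*_ e e
  ... | inj₂ e = cong₂ _*_ e e

  ∣sgn∣≤1 : ∀ a → ∣ sgn a ∣ ≤ 1ℚ
  ∣sgn∣≤1 a with sgn-±1 a
  ... | inj₁ e = ≤-reflexive (cong ∣_∣ e)
  ... | inj₂ e = ≤-reflexive (cong ∣_∣ e)

  sgn≤1 : ∀ a → sgn a ≤ 1ℚ
  sgn≤1 a = ≤-trans (p≤∣p∣ (sgn a)) (∣sgn∣≤1 a)

  sgn-ℕ+ : ∀ n b → sgn (ℤ.+ n ℤ.+ b) ≡ sgn (ℤ.+ n) * sgn b
  sgn-ℕ+ zero b = trans (cong sgn (ℤₚ.+-identityˡ b)) (sym (*-identityˡ (sgn b)))
  sgn-ℕ+ (suc n) b = begin
    sgn (1ℤ ℤ.+ ℤ.+ n ℤ.+ b)     ≡⟨ cong sgn (ℤₚ.+-assoc 1ℤ (ℤ.+ n) b) ⟩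
    sgn (1ℤ ℤ.+ (ℤ.+ n ℤ.+ b))   ≡⟨ sgn-suc (ℤ.+ n ℤ.+ b) ⟩
    - sgn (ℤ.+ n ℤ.+ b)          ≡⟨ cong -_ (sgn-ℕ+ n b) ⟩
    - (sgn (ℤ.+ n) * sgn b)      ≡⟨ neg-distribˡ-* (sgn (ℤ.+ n)) (sgn b) ⟩
    - sgn (ℤ.+ n) * sgn b        ∎
    where open ≡-Reasoning

  sgn-+ : ∀ a b → sgn (a ℤ.+ b) ≡ sgn a * sgn b
  sgn-+ (ℤ.+ n) b = sgn-ℕ+ n b
  -- `a` and `- a` have the same sign, whose square is 1. Multiplying by it twice reduces the claim
  -- to adding the positive number `- a` to `a + b`.
  sgn-+ a@(ℤ.-[1+ n ]) b = begin
    sgn (a ℤ.+ b)                        ≡⟨ *-identityˡ _ ⟨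
    1ℚ * sgn (a ℤ.+ b)                   ≡⟨ cong (_* sgn (a ℤ.+ b)) (sgn*sgn a) ⟨
    sgn a * sgn a * sgn (a ℤ.+ b)        ≡⟨ *-assoc (sgn a) (sgn a) (sgn (a ℤ.+ b)) ⟩
    sgn a * (sgn a * sgn (a ℤ.+ b))      ≡⟨ cong (sgn a *_) (sgn-ℕ+ (suc n) (a ℤ.+ b)) ⟨
    sgn a * sgn (ℤ.- a ℤ.+ (a ℤ.+ b))    ≡⟨ cong (λ c → sgn a * sgn c) (cancel a b) ⟩
    sgn a * sgn b                        ∎
    where
    open ≡-Reasoning
    cancel : ∀ a b → ℤ.- a ℤ.+ (a ℤ.+ b) ≡ b
    cancel = solve-∀

  sgn-double : ∀ a → sgn (a ℤ.+ a) ≡ 1ℚ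
  sgn-double a = trans (sgn-+ a a) (sgn*sgn a)

  -- A translation by `a` periods of odd length must flip heights exactly as often as the gluing in
  -- the Möbius strip does, namely `a` times.
  sgn-*-odd : ∀ a h → sgn (a ℤ.* (1ℤ ℤ.+ (h ℤ.+ h))) ≡ sgn a
  sgn-*-odd a h = begin
    sgn (a ℤ.* (1ℤ ℤ.+ (h ℤ.+ h)))             ≡⟨ cong sgn (expand a h) ⟩
    sgn (a ℤ.+ (a ℤ.* h ℤ.+ a ℤ.* h))          ≡⟨ sgn-+ a _ ⟩
    sgn a * sgn (a ℤ.* h ℤ.+ a ℤ.* h)          ≡⟨ cong (sgn a *_) (sgn-double (a ℤ.* h)) ⟩
    sgn a * 1ℚ                                 ≡⟨ *-identityʳ (sgn a) ⟩
    sgn a                                      ∎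
    where
    open ≡-Reasoning
    expand : ∀ a h → a ℤ.* (1ℤ ℤ.+ (h ℤ.+ h)) ≡ a ℤ.+ (a ℤ.* h ℤ.+ a ℤ.* h)
    expand = solve-∀

  flip^≡sgn* : ∀ n y → flip^ n y ≡ flip^ n 1ℚ * y
  flip^≡sgn* zero    y = sym (*-identityˡ y)
  flip^≡sgn* (suc n) y = trans (cong -_ (flip^≡sgn* n y)) (neg-distribˡ-* (flip^ n 1ℚ) y)

  off : Fin 3 → ℤ
  off 0F = 0ℤ
  off 1F = 1ℤ
  off 2F = ℤ.+ 2

  ∣off-off∣≤2 : ∀ i j → ℤ.∣ off i ℤ.- off j ∣ ℕ.≤ 2
  ∣off-off∣≤2 = from-yes (Finₚ.all? λ i → Finₚ.all? λ j → ℤ.∣ off i ℤ.- off j ∣ ℕₚ.≤? 2)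

  off-injective : ∀ i j → off i ℤ.- off j ≡ 0ℤ → i ≡ j
  off-injective 0F 0F _ = refl
  off-injective 0F 1F ()
  off-injective 0F 2F ()
  off-injective 1F 0F ()
  off-injective 1F 1F _ = refl
  off-injective 1F 2F ()
  off-injective 2F 0F ()
  off-injective 2F 1F ()
  off-injective 2F 2F _ = refl

  -- The star of a vertex w of the strip is where three affine functions are
  -- nonnegative; stripForm gives their values at the vertex w + h.

  slopeX slopeY : Fin 3 → ℚ
  slopeX 0F = 0ℚ
  slopeX 1F = - ½
  slopeX 2F = ½
  slopeY 0F = ½
  slopeY 1F = ½ * ½
  slopeY 2F = ½ * ½

  stripForm : Fin 3 → ℤ → ℚ
  stripForm f h = 1ℚ + (slopeX f * fromℤ h + slopeY f * (sgn h - 1ℚ))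

  stripForm-edge : ∀ f i j → 0ℚ ≤ stripForm f (off i ℤ.- off j)
  stripForm-edge = from-yes (Finₚ.all? λ f → Finₚ.all? λ i → Finₚ.all? λ j → 0ℚ ≤? stripForm f (off i ℤ.- off j))

  ∣slope∣≤1 : ∀ f → ∣ slopeX f ∣ ≤ 1ℚ × ∣ slopeY f ∣ ≤ 1ℚ
  ∣slope∣≤1 f = from-yes (Finₚ.all? λ f → ∣ slopeX f ∣ ≤? 1ℚ) f , from-yes (Finₚ.all? λ f → ∣ slopeY f ∣ ≤? 1ℚ) f

  -- The form `1F` vanishes at `h = 1` and `h = 2`, that is, along the edge bounding the star on the
  -- right. Its negative is ½ (h - 2) + ¼ (1 - s), a sum of nonnegative terms from `h = 2` on.
  stripForm-right : ∀ n → stripForm 1F (ℤ.+ suc n) ≤ 0ℚ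
  stripForm-right zero = ≤-refl
  stripForm-right (suc n) = 0≤q-p⇒p≤q (subst (0ℚ ≤_)
    (solve 2 (λ x s → con ½ :* (x :- con (1ℚ + 1ℚ)) :+ con (½ * ½) :* (con 1ℚ :- s) :=
       con 0ℚ :- (con 1ℚ :+ (con (- ½) :* x :+ con (½ * ½) :* (s :- con 1ℚ)))) refl x s)
    (+-nonNeg (*-nonNeg (nonNegative⁻¹ ½) (p≤q⇒0≤q-p (fromℤ-mono-≤ {ℤ.+ 2} {h} (ℤ.+≤+ (ℕ.s≤s (ℕ.s≤s ℕ.z≤n))))))
              (*-nonNeg (nonNegative⁻¹ (½ * ½)) (p≤q⇒0≤q-p (sgn≤1 h)))))
    where
    h = ℤ.+ suc (suc n)
    x = fromℤ h
    s = sgn h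

  stripForm-left : ∀ n → stripForm 2F ℤ.-[1+ n ] ≤ 0ℚ
  stripForm-left n = subst (_≤ 0ℚ) (cong (λ z → 1ℚ + (z + slopeY 1F * (sgn h - 1ℚ))) (begin
    - ½ * fromℤ h       ≡⟨ solve 1 (λ x → con (- ½) :* x := con ½ :* (:- x)) refl (fromℤ h) ⟩
    ½ * - fromℤ h       ≡⟨ cong (½ *_) (fromℤ-neg h) ⟨
    ½ * fromℤ ℤ.-[1+ n ] ∎)) (stripForm-right n)
    where
    open ≡-Reasoning
    h = ℤ.+ suc n

  -- Triangles that begin at or to the right of the origin are cut off by `1F`, those that end at or
  -- to the left of it by the mirror image `2F`. One triangle remains, with the origin as its middle
  -- corner; `0F` vanishes at all odd vertices, on the opposite boundary line.
  separating-stripForm : ∀ m → ∃[ f ] (∀ i → stripForm f (m ℤ.+ off i) ≤ 0ℚ ⊎ m ℤ.+ off i ≡ 0ℤ)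
  separating-stripForm (ℤ.+ 0) = 1F , λ { 0F → inj₂ refl ; 1F → inj₁ (stripForm-right 0) ; 2F → inj₁ (stripForm-right 1) }
  separating-stripForm (ℤ.+ suc n) = 1F , λ
    { 0F → inj₁ (stripForm-right (n ℕ.+ 0)) ; 1F → inj₁ (stripForm-right (n ℕ.+ 1)) ; 2F → inj₁ (stripForm-right (n ℕ.+ 2)) }
  separating-stripForm ℤ.-[1+ 0 ] = 0F , λ { 0F → inj₁ ≤-refl ; 1F → inj₂ refl ; 2F → inj₁ ≤-refl }
  separating-stripForm ℤ.-[1+ 1 ] = 2F , λ { 0F → inj₁ (stripForm-left 1) ; 1F → inj₁ (stripForm-left 0) ; 2F → inj₂ refl }
  separating-stripForm ℤ.-[1+ suc (suc n) ] = 2F , λ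
    { 0F → inj₁ (stripForm-left (2 ℕ.+ n)) ; 1F → inj₁ (stripForm-left (1 ℕ.+ n)) ; 2F → inj₁ (stripForm-left n) }

  -- The vertex w of the strip ℝ × [-1 , 1] has height (-1)^w, and any three
  -- consecutive vertices span a triangle.

  module MöbiusLifting {k : ℕ} .{{_ : NonZero k}} (e d : ℤ) where

    corners : ℤ → Fin 3 → ℤ
    corners t i = t ℤ.+ off i

    index : ℤ → ℤ
    index w = e ℤ.+ d ℤ.* w

    label : ℤ → Fin k
    label w = ι (index w)

    index-minus : ∀ w w′ → index w ℤ.- index w′ ≡ d ℤ.* (w ℤ.- w′)
    index-minus = regroup e d
      where regroup : ∀ e d w w′ → e ℤ.+ d ℤ.* w ℤ.- (e ℤ.+ d ℤ.* w′) ≡ d ℤ.* (w ℤ.- w′)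
            regroup = solve-∀

    module _
      (X : SimplicialComplex k)
      (isTriangle : ∀ t → Face X (vertexSet (label ∘ corners t)))
      (triangleOf : ∀ {σ} → Face X σ → Σ[ t ∈ ℤ ] (∀ {x} → x ∈ σ → ∃[ i ] label (corners t i) ≡ x))
      (nondegenerate : ∀ a → ℤ.∣ a ∣ ℕ.≤ 4 → ℤ.+ k ∣ d ℤ.* a → a ≡ 0ℤ)
      (K : ℕ) .{{_ : NonZero K}}
      (period : ∀ w → ℤ.+ k ∣ d ℤ.* w → ℤ.+ K ∣ w) (isPeriod : ℤ.+ k ∣ d ℤ.* ℤ.+ K)
      (h : ℤ) (odd : ℤ.+ K ≡ 1ℤ ℤ.+ (h ℤ.+ h))
      where

      private
        K′ = fromℤ (ℤ.+ K)
        κ = proj₁ (reciprocal K)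

        Kκ≡1 : K′ * κ ≡ 1ℚ
        Kκ≡1 = proj₂ (reciprocal K)

        posX : ℤ → ℚ
        posX w = fromℤ w * κ

        lifting : Lifting k
        lifting = record
          { Vertex   = ℤ
          ; π        = label
          ; x        = posX
          ; y        = sgn
          ; Triangle = ℤ
          ; vertex   = corners
          }

        open Lifting lifting using (centreX; centreY; _∼_; Within; within; Separates)

        corners-minus : ∀ t i j → corners t i ℤ.- corners t j ≡ off i ℤ.- off j
        corners-minus t i j = cancel t (off i) (off j)
          where cancel : ∀ t a b → (t ℤ.+ a) ℤ.- (t ℤ.+ b) ≡ a ℤ.- b
                cancel = solve-∀

        ∣corners--∣ : ∀ t i j → ℤ.∣ corners t i ℤ.- corners t j ∣ ℕ.≤ 2
        ∣corners--∣ t i j = subst (λ z → ℤ.∣ z ∣ ℕ.≤ 2) (sym (corners-minus t i j)) (∣off-off∣≤2 i j)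

        label-injective : ∀ w w′ → ℤ.∣ w ℤ.- w′ ∣ ℕ.≤ 4 → label w ≡ label w′ → w ℤ.- w′ ≡ 0ℤ
        label-injective w w′ ≤4 eq = nondegenerate (w ℤ.- w′) ≤4 (∣-resp (index-minus w w′) (ι-injective (index w) (index w′) eq))

        label∘corners-injective : ∀ t → Injective _≡_ _≡_ (label ∘ corners t)
        label∘corners-injective t {i} {j} eq = off-injective i j (trans (sym (corners-minus t i j))
          (label-injective (corners t i) (corners t j) (ℕₚ.≤-trans (∣corners--∣ t i j) (ℕ.s≤s (ℕ.s≤s ℕ.z≤n))) eq))

        -- Corners of one triangle differ by at most 2, so through the common corner the two
        -- vertices differ by at most 4, the range of `nondegenerate`.
        star-injective : ∀ t i t′ i′ → corners t i ≡ corners t′ i′ →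
          ∀ j j′ → label (corners t j) ≡ label (corners t′ j′) → corners t j ≡ corners t′ j′
        star-injective t i t′ i′ common j j′ eq = ℤₚ.i-j≡0⇒i≡j (corners t j) (corners t′ j′)
          (label-injective (corners t j) (corners t′ j′) (subst (λ z → ℤ.∣ z ∣ ℕ.≤ 4)
            (through (corners t j) (corners t′ j′) (corners t i))
            (ℕₚ.≤-trans (ℤₚ.∣i-j∣≤∣i∣+∣j∣ (corners t j ℤ.- corners t i) (corners t′ j′ ℤ.- corners t i))
              (ℕₚ.+-mono-≤ (∣corners--∣ t j i)
                (subst (λ w → ℤ.∣ corners t′ j′ ℤ.- w ∣ ℕ.≤ 2) (sym common) (∣corners--∣ t′ j′ i′))))) eq)
          where
          through : ∀ x y z → (x ℤ.- z) ℤ.- (y ℤ.- z) ≡ x ℤ.- y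
          through = solve-∀

        corners-shift : ∀ a t i → corners (t ℤ.+ a) i ≡ corners t i ℤ.+ a
        corners-shift a t i = swap t a (off i)
          where swap : ∀ t a o → (t ℤ.+ a) ℤ.+ o ≡ (t ℤ.+ o) ℤ.+ a
                swap = solve-∀

        deck : ℤ → ℤ
        deck a = a ℤ.* ℤ.+ K

        deck-∼ : ∀ a t → t ℤ.+ deck a ∼ t
        deck-∼ a t i = ι-cong (index (corners (t ℤ.+ deck a) i)) (index (corners t i)) (∣-resp
          (trans (swap d a (ℤ.+ K)) (sym (trans (index-minus (corners (t ℤ.+ deck a) i) (corners t i)) (cong (d ℤ.*_)
            (trans (cong (ℤ._- corners t i) (corners-shift (deck a) t i)) (cancel (corners t i) (deck a)))))))
          (∣n⇒∣m*n a isPeriod))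
          where
          swap : ∀ d a K → a ℤ.* (d ℤ.* K) ≡ d ℤ.* (a ℤ.* K)
          swap = solve-∀
          cancel : ∀ a P → a ℤ.+ P ℤ.- a ≡ P
          cancel = solve-∀

        centreX-deck : ∀ a t b → centreX (t ℤ.+ deck a) b ≡ centreX t b + fromℤ a
        centreX-deck a t b = trans
          (mean-cong (weight b) λ i → begin
            fromℤ (corners (t ℤ.+ deck a) i) * κ          ≡⟨ cong (λ w → fromℤ w * κ) (corners-shift (deck a) t i) ⟩
            fromℤ (corners t i ℤ.+ deck a) * κ            ≡⟨ cong (_* κ) (trans (fromℤ-+ (corners t i) (deck a)) (cong (fromℤ (corners t i) +_) (fromℤ-* a (ℤ.+ K)))) ⟩
            (fromℤ (corners t i) + fromℤ a * K′) * κ      ≡⟨ solve 4 (λ w a K κ → (w :+ a :* K) :* κ := w :* κ :+ a :* (K :* κ)) refl (fromℤ (corners t i)) (fromℤ a) K′ κ ⟩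
            fromℤ (corners t i) * κ + fromℤ a * (K′ * κ)  ≡⟨ cong (λ z → fromℤ (corners t i) * κ + fromℤ a * z) Kκ≡1 ⟩
            fromℤ (corners t i) * κ + fromℤ a * 1ℚ        ≡⟨ cong (fromℤ (corners t i) * κ +_) (*-identityʳ (fromℤ a)) ⟩
            fromℤ (corners t i) * κ + fromℤ a             ∎)
          (mean-translate b (posX ∘ corners t) (fromℤ a))
          where open ≡-Reasoning

        -- Every height is multiplied by the sign of `a K`, which is the sign of `a` as `K` is odd;
        -- the mean is linear in the heights.
        centreY-deck : ∀ a t b → centreY (t ℤ.+ deck a) b ≡ flip^ ℤ.∣ a ∣ (centreY t b)
        centreY-deck a t b = begin
          mean (weight b) (sgn ∘ corners (t ℤ.+ deck a))   ≡⟨ mean-cong (weight b) sgn-deck ⟩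
          mean (weight b) (λ i → sgn a * sgn (corners t i)) ≡⟨ ∑₃-cong (λ i → solve 3 (λ b s t → b :* (s :* t) := s :* (b :* t)) refl (weight b i) (sgn a) (sgn (corners t i))) ⟩
          ∑₃ (λ i → sgn a * (weight b i * sgn (corners t i))) ≡⟨ ∑₃-* (sgn a) (λ i → weight b i * sgn (corners t i)) ⟩
          sgn a * centreY t b                              ≡⟨ flip^≡sgn* ℤ.∣ a ∣ (centreY t b) ⟨
          flip^ ℤ.∣ a ∣ (centreY t b)                      ∎
          where
          open ≡-Reasoning
          sgn-deck : ∀ i → sgn (corners (t ℤ.+ deck a) i) ≡ sgn a * sgn (corners t i)
          sgn-deck i = begin
            sgn (corners (t ℤ.+ deck a) i)          ≡⟨ cong sgn (trans (corners-shift (deck a) t i) (ℤₚ.+-comm (corners t i) (deck a))) ⟩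
            sgn (deck a ℤ.+ corners t i)            ≡⟨ sgn-+ (deck a) (corners t i) ⟩
            sgn (deck a) * sgn (corners t i)        ≡⟨ cong (λ z → sgn (a ℤ.* z) * sgn (corners t i)) odd ⟩
            sgn (a ℤ.* (1ℤ ℤ.+ (h ℤ.+ h))) * sgn (corners t i) ≡⟨ cong (_* sgn (corners t i)) (sgn-*-odd a h) ⟩
            sgn a * sgn (corners t i)               ∎

        ∣centreY∣≤1 : ∀ t b → ∣ centreY t b ∣ ≤ 1ℚ
        ∣centreY∣≤1 t b = subst (∣ centreY t b ∣ ≤_) (∑weight≡1 b)
          (∣p+q∣≤ (f 0F + f 1F) (f 2F) (∣p+q∣≤ (f 0F) (f 1F) (∣f∣≤ 0F) (∣f∣≤ 1F)) (∣f∣≤ 2F))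
          where
          f : Fin 3 → ℚ
          f i = weight b i * sgn (corners t i)
          ∣f∣≤ : ∀ i → ∣ f i ∣ ≤ weight b i
          ∣f∣≤ i = subst (∣ f i ∣ ≤_) (*-identityʳ (weight b i))
            (∣p*q∣≤ (weight b i) (sgn (corners t i)) (≤-reflexive (0≤p⇒∣p∣≡p (weight≥0 b i))) (∣sgn∣≤1 (corners t i)) (weight≥0 b i))

        at : ℤ → Weights → Point MöbiusStrip
        at t b = centreX t b , centreY t b , ∣centreY∣≤1 t b

        point-≡ : ∀ {X X′ Y Y′} {p : ∣ Y ∣ ≤ 1ℚ} {p′ : ∣ Y′ ∣ ≤ 1ℚ} → X ≡ X′ → Y ≡ Y′ →
                  _≡_ {A = Point MöbiusStrip} (X , Y , p) (X′ , Y′ , p′)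
        point-≡ {X} {Y = Y} refl refl = cong (λ p → X , Y , p) (≤-irrelevant _ _)

        centre≡ : ∀ t (b : Weights) X Y →
                  fromℤ t + (weight b 1F + (weight b 2F + weight b 2F)) ≡ K′ * X →
                  sgn t * (1ℚ - (weight b 1F + weight b 1F)) ≡ Y →
                  (∣Y∣≤1 : ∣ Y ∣ ≤ 1ℚ) → at t b ≡ (X , Y , ∣Y∣≤1)
        centre≡ t b X Y eqX eqY ∣Y∣≤1 = point-≡ x≡ (trans y≡ eqY)
          where
          open ≡-Reasoning
          b₀ = weight b 0F
          b₁ = weight b 1F
          b₂ = weight b 2F
          x≡ : centreX t b ≡ X
          x≡ = begin
            mean (weight b) (posX ∘ corners t)
              ≡⟨ mean-cong (weight b) (λ i → cong (_* κ) (fromℤ-+ t (off i))) ⟩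
            b₀ * ((fromℤ t + 0ℚ) * κ) + b₁ * ((fromℤ t + 1ℚ) * κ) + b₂ * ((fromℤ t + fromℤ (off 2F)) * κ)
              ≡⟨ solve 5 (λ b₀ b₁ b₂ t κ → b₀ :* ((t :+ con 0ℚ) :* κ) :+ b₁ :* ((t :+ con 1ℚ) :* κ) :+ b₂ :* ((t :+ con (1ℚ + 1ℚ)) :* κ)
                   := ((b₀ :+ b₁ :+ b₂) :* t :+ (b₁ :+ (b₂ :+ b₂))) :* κ) refl b₀ b₁ b₂ (fromℤ t) κ ⟩
            (∑₃ (weight b) * fromℤ t + (b₁ + (b₂ + b₂))) * κ
              ≡⟨ cong (λ z → (z + (b₁ + (b₂ + b₂))) * κ) (trans (cong (_* fromℤ t) (∑weight≡1 b)) (*-identityˡ (fromℤ t))) ⟩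
            (fromℤ t + (b₁ + (b₂ + b₂))) * κ
              ≡⟨ cong (_* κ) eqX ⟩
            K′ * X * κ
              ≡⟨ solve 3 (λ K X κ → K :* X :* κ := K :* κ :* X) refl K′ X κ ⟩
            K′ * κ * X
              ≡⟨ trans (cong (_* X) Kκ≡1) (*-identityˡ X) ⟩
            X ∎
          y≡ : centreY t b ≡ sgn t * (1ℚ - (b₁ + b₁))
          y≡ = begin
            mean (weight b) (sgn ∘ corners t)
              ≡⟨ mean-cong (weight b) (λ i → sgn-+ t (off i)) ⟩
            b₀ * (sgn t * 1ℚ) + b₁ * (sgn t * -1ℚ) + b₂ * (sgn t * 1ℚ)
              ≡⟨ solve 4 (λ b₀ b₁ b₂ s → b₀ :* (s :* con 1ℚ) :+ b₁ :* (s :* con -1ℚ) :+ b₂ :* (s :* con 1ℚ)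
                   := s :* ((b₀ :+ b₁ :+ b₂) :- (b₁ :+ b₁))) refl b₀ b₁ b₂ (sgn t) ⟩
            sgn t * (∑₃ (weight b) - (b₁ + b₁))
              ≡⟨ cong (λ z → sgn t * (z - (b₁ + b₁))) (∑weight≡1 b) ⟩
            sgn t * (1ℚ - (b₁ + b₁)) ∎

        -- The height Y determines the weight of the middle vertex up to the parity
        -- of t; hence the two cases.

        locate : ∀ P → Σ[ t ∈ ℤ ] Σ[ b ∈ Weights ] at t b ≡ P
        locate (X , Y , ∣Y∣≤1) with integerPart (½ * (K′ * X - ½ * (1ℚ - Y)))
        -- Put I = K X and c = ½ (1 - Y). At height `Y` the triangle `2 n` covers 2n + c ≤ I ≤ 2n +
        -- 2 - c and the triangle `2 n + 1` covers the interval from there to 2n + 2 + c. Together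
        -- they have length 2 and start at 2n + c, so `n` is the integer part of ½ (I - c), and the
        -- remaining comparison is with the common endpoint.
        ... | n , n≤J , J≤n+1 with ≤-total (K′ * X - (fromℤ n + fromℤ n)) ((1ℚ + 1ℚ) - ½ * (1ℚ - Y))
        ...   | inj₁ low = n ℤ.+ n , b , centre≡ (n ℤ.+ n) b X Y
          (trans (cong (_+ (w 1F + (w 2F + w 2F))) (fromℤ-+ n n)) (solve 3 (λ I n c → n :+ n :+ (c :+ (con ½ :* (I :- (n :+ n) :- c) :+ con ½ :* (I :- (n :+ n) :- c))) := I) refl I n′ c))
          (trans (cong (_* (1ℚ - (c + c))) (sgn-double n)) (solve 1 (λ y → con 1ℚ :* (con 1ℚ :- (con ½ :* (con 1ℚ :- y) :+ con ½ :* (con 1ℚ :- y))) := y) refl Y))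
          ∣Y∣≤1
          where
          I = K′ * X
          n′ = fromℤ n
          c = ½ * (1ℚ - Y)
          w : Fin 3 → ℚ
          w 0F = ½ * ((1ℚ + 1ℚ) - c - (I - (n′ + n′)))
          w 1F = c
          w 2F = ½ * (I - (n′ + n′) - c)
          b : Weights
          b = record
            { weight = w
            ; weight≥0 = λ
              { 0F → *-nonNeg (nonNegative⁻¹ ½) (p≤q⇒0≤q-p low)
              ; 1F → *-nonNeg (nonNegative⁻¹ ½) (p≤q⇒0≤q-p (≤-trans (p≤∣p∣ Y) ∣Y∣≤1))
              ; 2F → subst (0ℚ ≤_) (solve 3 (λ I n c → con ½ :* (I :- c) :- n := con ½ :* (I :- (n :+ n) :- c)) refl I n′ c) (p≤q⇒0≤q-p n≤J) }
            ; ∑weight≡1 = solve 3 (λ I n c → con ½ :* (con (1ℚ + 1ℚ) :- c :- (I :- (n :+ n))) :+ c :+ con ½ :* (I :- (n :+ n) :- c) := con 1ℚ) refl I n′ c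
            }
        ...   | inj₂ high = 1ℤ ℤ.+ (n ℤ.+ n) , b , centre≡ (1ℤ ℤ.+ (n ℤ.+ n)) b X Y
          (trans (cong (_+ (w 1F + (w 2F + w 2F))) (trans (fromℤ-+ 1ℤ (n ℤ.+ n)) (cong (1ℚ +_) (fromℤ-+ n n))))
            (solve 3 (λ I n c → con 1ℚ :+ (n :+ n) :+ ((con 1ℚ :- c) :+ (con ½ :* (I :- (n :+ n) :- (con (1ℚ + 1ℚ) :- c)) :+ con ½ :* (I :- (n :+ n) :- (con (1ℚ + 1ℚ) :- c)))) := I) refl I n′ c))
          (trans (cong (_* (1ℚ - ((1ℚ - c) + (1ℚ - c)))) (trans (sgn-suc (n ℤ.+ n)) (cong -_ (sgn-double n))))
            (solve 1 (λ y → con -1ℚ :* (con 1ℚ :- ((con 1ℚ :- con ½ :* (con 1ℚ :- y)) :+ (con 1ℚ :- con ½ :* (con 1ℚ :- y)))) := y) refl Y))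
          ∣Y∣≤1
          where
          I = K′ * X
          n′ = fromℤ n
          c = ½ * (1ℚ - Y)
          -Y≤1 : - Y ≤ 1ℚ
          -Y≤1 = ≤-trans (p≤∣p∣ (- Y)) (subst (_≤ 1ℚ) (sym (∣-p∣≡∣p∣ Y)) ∣Y∣≤1)
          w : Fin 3 → ℚ
          w 0F = ½ * ((1ℚ + 1ℚ) + c - (I - (n′ + n′)))
          w 1F = 1ℚ - c
          w 2F = ½ * (I - (n′ + n′) - ((1ℚ + 1ℚ) - c))
          b : Weights
          b = record
            { weight = w
            ; weight≥0 = λ
              { 0F → subst (0ℚ ≤_) (solve 3 (λ I n c → n :+ con 1ℚ :- con ½ :* (I :- c) := con ½ :* (con (1ℚ + 1ℚ) :+ c :- (I :- (n :+ n)))) refl I n′ c) (p≤q⇒0≤q-p J≤n+1)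
              ; 1F → subst (0ℚ ≤_) (solve 1 (λ y → con ½ :* (con 1ℚ :- (:- y)) := con 1ℚ :- con ½ :* (con 1ℚ :- y)) refl Y) (*-nonNeg (nonNegative⁻¹ ½) (p≤q⇒0≤q-p -Y≤1))
              ; 2F → *-nonNeg (nonNegative⁻¹ ½) (p≤q⇒0≤q-p high) }
            ; ∑weight≡1 = solve 3 (λ I n c → con ½ :* (con (1ℚ + 1ℚ) :+ c :- (I :- (n :+ n))) :+ (con 1ℚ :- c) :+ con ½ :* (I :- (n :+ n) :- (con (1ℚ + 1ℚ) :- c)) := con 1ℚ) refl I n′ c
            }

        near⇒within : ∀ δ t b t′ b′ → Near MöbiusStrip δ (at t b) (at t′ b′) →
                      Σ[ t″ ∈ ℤ ] t″ ∼ t′ × Within δ t b t″ b′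
        near⇒within δ t b t′ b′ (a , near-x , near-y) = t′ ℤ.+ deck a , deck-∼ a t′ , within
          (subst (λ z → ∣ centreX t b - z ∣ < δ) (sym (centreX-deck a t′ b′)) near-x)
          (subst (λ z → ∣ centreY t b - z ∣ < δ) (sym (centreY-deck a t′ b′)) near-y)

        lift : ∀ t i t′ i′ → label (corners t i) ≡ label (corners t′ i′) →
               Σ[ t″ ∈ ℤ ] t″ ∼ t′ × corners t″ i′ ≡ corners t i ×
               (∀ δ b b′ → Within δ t b t″ b′ → Near MöbiusStrip δ (at t b) (at t′ b′))
        lift t i t′ i′ eq = t′ ℤ.+ deck a , deck-∼ a t′ ,
          trans (corners-shift (deck a) t′ i′) (trans (cong (λ z → corners t′ i′ ℤ.+ z) (sym (_∣_.equality K∣)))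
            (cancel (corners t i) (corners t′ i′))) ,
          λ δ b b′ (within close-x close-y) → a ,
            subst (λ z → ∣ centreX t b - z ∣ < δ) (centreX-deck a t′ b′) close-x ,
            subst (λ z → ∣ centreY t b - z ∣ < δ) (centreY-deck a t′ b′) close-y
          where
          K∣ : ℤ.+ K ∣ corners t i ℤ.- corners t′ i′
          K∣ = period (corners t i ℤ.- corners t′ i′)
            (∣-resp (index-minus (corners t i) (corners t′ i′)) (ι-injective (index (corners t i)) (index (corners t′ i′)) eq))
          a = _∣_.quotient K∣
          cancel : ∀ a b → b ℤ.+ (a ℤ.- b) ≡ a
          cancel = solve-∀

        posX-minus : ∀ w w′ → posX w - posX w′ ≡ fromℤ (w ℤ.- w′) * κ
        posX-minus w w′ = trans (solve 3 (λ a b κ → a :* κ :- b :* κ := (a :- b) :* κ) refl (fromℤ w) (fromℤ w′) κ)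
          (cong (_* κ) (sym (fromℤ-minus w w′)))

        2ℚ : ℚ
        2ℚ = fromℤ (ℤ.+ 2)

        edgeBound : ∃[ D ] (0ℚ ≤ D × (∀ t i j →
          ∣ posX (corners t i) - posX (corners t j) ∣ ≤ D × ∣ sgn (corners t i) - sgn (corners t j) ∣ ≤ D))
        edgeBound = 2ℚ * ∣ κ ∣ + 2ℚ , +-nonNeg 0≤2∣κ∣ (nonNegative⁻¹ 2ℚ) , λ t i j →
          ≤-trans (subst (_≤ 2ℚ * ∣ κ ∣) (cong ∣_∣ (sym (posX-minus (corners t i) (corners t j))))
              (∣p*q∣≤ (fromℤ (corners t i ℤ.- corners t j)) κ (∣fromℤ∣≤ (corners t i ℤ.- corners t j) (∣corners--∣ t i j)) ≤-refl (nonNegative⁻¹ 2ℚ)))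
            (subst (_≤ 2ℚ * ∣ κ ∣ + 2ℚ) (+-identityʳ (2ℚ * ∣ κ ∣)) (+-monoʳ-≤ (2ℚ * ∣ κ ∣) (nonNegative⁻¹ 2ℚ))) ,
          ≤-trans (∣p+q∣≤ (sgn (corners t i)) (- sgn (corners t j)) (∣sgn∣≤1 (corners t i))
              (subst (_≤ 1ℚ) (sym (∣-p∣≡∣p∣ (sgn (corners t j)))) (∣sgn∣≤1 (corners t j))))
            (subst (_≤ 2ℚ * ∣ κ ∣ + 2ℚ) (+-identityˡ 2ℚ) (+-monoˡ-≤ 2ℚ 0≤2∣κ∣))
          where
          0≤2∣κ∣ : 0ℚ ≤ 2ℚ * ∣ κ ∣
          0≤2∣κ∣ = *-nonNeg (nonNegative⁻¹ 2ℚ) (0≤∣p∣ κ)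

        -- The factor `sgn w′` in the vertical slope reflects the picture when `w′` is on the lower
        -- boundary: (sgn w - sgn w′) sgn w′ is sgn (w - w′) - 1, which depends on the difference
        -- only.
        value≡ : ∀ f w w′ → affine (slopeX f * K′) (slopeY f * sgn w′) (posX w - posX w′) (sgn w - sgn w′) ≡ stripForm f (w ℤ.- w′)
        value≡ f w w′ = begin
          affine (slopeX f * K′) (slopeY f * s′) (posX w - posX w′) (sgn w - s′)
            ≡⟨ cong₂ (affine (slopeX f * K′) (slopeY f * s′)) (posX-minus w w′)
                 (cong (_- s′) (trans (cong sgn (expand w w′)) (sgn-+ (w ℤ.- w′) w′))) ⟩
          affine (slopeX f * K′) (slopeY f * s′) (a * κ) (s * s′ - s′)
            ≡⟨ solve 7 (λ cx cy K κ a s s′ → con 1ℚ :+ (cx :* K :* (a :* κ) :+ cy :* s′ :* (s :* s′ :- s′))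
                  := con 1ℚ :+ (cx :* a :* (K :* κ) :+ cy :* (s :- con 1ℚ) :* (s′ :* s′))) refl (slopeX f) (slopeY f) K′ κ a s s′ ⟩
          1ℚ + (slopeX f * a * (K′ * κ) + slopeY f * (s - 1ℚ) * (s′ * s′))
            ≡⟨ cong₂ (λ y z → 1ℚ + (slopeX f * a * y + slopeY f * (s - 1ℚ) * z)) Kκ≡1 (sgn*sgn w′) ⟩
          1ℚ + (slopeX f * a * 1ℚ + slopeY f * (s - 1ℚ) * 1ℚ)
            ≡⟨ cong₂ (λ y z → 1ℚ + (y + z)) (*-identityʳ (slopeX f * a)) (*-identityʳ (slopeY f * (s - 1ℚ))) ⟩
          stripForm f (w ℤ.- w′) ∎
          where
          open ≡-Reasoning
          s = sgn (w ℤ.- w′)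
          s′ = sgn w′
          a = fromℤ (w ℤ.- w′)
          expand : ∀ w w′ → w ≡ (w ℤ.- w′) ℤ.+ w′
          expand = solve-∀

        B : ℚ
        B = ∣ K′ ∣ + 1ℚ

        separates : ∀ t i t′ → Separates B (corners t i) t t′
        separates t i t′ = record
          { p       = slopeX f * K′
          ; q       = slopeY f * sgn w
          ; ∣p∣≤    = ≤-trans (subst (∣ slopeX f * K′ ∣ ≤_) (*-identityˡ ∣ K′ ∣) (∣p*q∣≤ (slopeX f) K′ (proj₁ (∣slope∣≤1 f)) ≤-refl (nonNegative⁻¹ 1ℚ)))
                        (subst (_≤ B) (+-identityʳ ∣ K′ ∣) (+-monoʳ-≤ ∣ K′ ∣ (nonNegative⁻¹ 1ℚ)))
          ; ∣q∣≤    = ≤-trans (∣p*q∣≤ (slopeY f) (sgn w) (proj₂ (∣slope∣≤1 f)) (∣sgn∣≤1 w) (nonNegative⁻¹ 1ℚ))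
                        (subst (_≤ B) (+-identityˡ 1ℚ) (+-monoˡ-≤ 1ℚ (0≤∣p∣ K′)))
          ; value≥0 = λ j → subst (0ℚ ≤_) (sym (trans (value≡ f (corners t j) w) (cong (stripForm f) (corners-minus t j i)))) (stripForm-edge f j i)
          ; value≤0 = nonpositive
          }
          where
          w = corners t i
          choice = separating-stripForm (t′ ℤ.- w)
          f = proj₁ choice
          regroup : ∀ p w o → p ℤ.- w ℤ.+ o ≡ p ℤ.+ o ℤ.- w
          regroup = solve-∀
          nonpositive : ∀ j → affine (slopeX f * K′) (slopeY f * sgn w) (posX (corners t′ j) - posX w) (sgn (corners t′ j) - sgn w) ≤ 0ℚ
                            ⊎ corners t′ j ≡ w
          nonpositive j with proj₂ choice j
          ... | inj₁ le = inj₁ (subst (_≤ 0ℚ) (trans (cong (stripForm f) (regroup t′ w (off j))) (sym (value≡ f (corners t′ j) w))) le)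
          ... | inj₂ eq = inj₂ (ℤₚ.i-j≡0⇒i≡j (corners t′ j) w (trans (sym (regroup t′ w (off j))) eq))

      möbiusCover : Cover X MöbiusStrip
      möbiusCover = record
        { lifting      = lifting
        ; π∘vertex-inj = label∘corners-injective
        ; isTriangle   = isTriangle
        ; triangleOf   = triangleOf
        ; at           = at
        ; locate       = locate
        ; near⇒within  = near⇒within
        ; lift         = lift
        ; star-inj     = star-injective
        ; edgeBound    = edgeBound
        ; separation   = B , +-nonNeg (0≤∣p∣ K′) (nonNegative⁻¹ 1ℚ) , separates
        }

-- Components as cosets, their sizes and isomorphisms.

module Components where

  open import Defs
  open Residues
  open import Data.Bool.Base using (Bool; true; false)
  open import Data.Nat.Base as ℕ using (zero; suc; NonZero)
  import Data.Nat.Divisibility as ℕ∣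
  open import Data.Integer.Base hiding (NonZero; suc; ∣_∣)
  open import Data.Integer.Properties
  open import Data.Integer.Divisibility.Signed
  open import Data.Integer.Tactic.RingSolver using (solve-∀)
  open import Data.Fin.Base using (zero; suc; _↑ˡ_; _↑ʳ_; inject≤)
  open import Data.Fin.Permutation using (Permutation′; permutation; _⟨$⟩ˡ_; _⟨$⟩ʳ_; inverseˡ; inverseʳ)
  open import Data.Fin.Subset using (Subset; _∈_; Nonempty; ⁅_⁆; _∪_) renaming (∣_∣ to cardinality)
  open import Data.Fin.Subset.Properties using (⊆-antisym; x∈⁅x⁆; x∈⁅y⁆⇒x≡y; x∈p∪q⁺; x∈p∪q⁻; ∣⁅x⁆∣≡1)
  open import Data.Vec.Base using (_∷_; tabulate)
  open import Data.Vec.Properties using (lookup∘tabulate; tabulate-cong; lookup⇒[]=; []=⇒lookup)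
  open import Relation.Binary.Construct.Closure.Transitive using ([_]; _∷_; _++_)
  open import Relation.Nullary using (does)
  open import Relation.Nullary.Decidable using (dec-true)

  count : ∀ {n} → (Fin n → Bool) → ℕ
  count f = cardinality (tabulate f)

  count-+ : ∀ m {n} (f : Fin (m ℕ.+ n) → Bool) → count f ≡ count (λ v → f (v ↑ˡ n)) ℕ.+ count (λ v → f (m ↑ʳ v))
  count-+ zero    f = refl
  count-+ (suc m) f with f zero
  ... | true  = cong ℕ.suc (count-+ m (f ∘ suc))
  ... | false = count-+ m (f ∘ suc)

  module _ {m : ℕ} .{{_ : NonZero m}} where

    residue : ∀ {n} → Fin n → Fin m
    residue v = ι (+ toℕ v)

    coset : ∀ {n} → Fin m → Subset n
    coset i = tabulate λ v → does (residue v Finₚ.≟ i)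

    ∈coset⁺ : ∀ {n} i (v : Fin n) → residue v ≡ i → v ∈ coset i
    ∈coset⁺ i v eq = lookup⇒[]= v _ (trans (lookup∘tabulate _ v) (dec-true (residue v Finₚ.≟ i) eq))

    ∈coset⁻ : ∀ {n} i (v : Fin n) → v ∈ coset i → residue v ≡ i
    ∈coset⁻ i v v∈ with residue v Finₚ.≟ i in dec-eq
    ... | yes eq = eq
    ... | no _ with trans (sym ([]=⇒lookup v∈)) (trans (lookup∘tabulate _ v) (cong does dec-eq))
    ...   | ()

    residue-cong : ∀ {n} (u v : Fin n) → + m ∣ + toℕ u - + toℕ v → residue u ≡ residue v
    residue-cong u v = ι-cong (+ toℕ u) (+ toℕ v)

    residue-injective : ∀ {n} (u v : Fin n) → residue u ≡ residue v → + m ∣ + toℕ u - + toℕ v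
    residue-injective u v = ι-injective (+ toℕ u) (+ toℕ v)

    -- A block of `m` consecutive numbers contains each residue once, and removing it shifts the
    -- others by `m`, which preserves residues.
    ∣coset∣ : ∀ q i → cardinality (coset {q ℕ.* m} i) ≡ q
    ∣coset∣ zero    i = refl
    ∣coset∣ (suc q) i = begin
      count f                                                  ≡⟨ count-+ m f ⟩
      count (λ v → f (v ↑ˡ q ℕ.* m)) ℕ.+ count (λ v → f (m ↑ʳ v)) ≡⟨ cong₂ ℕ._+_ first rest ⟩
      1 ℕ.+ q                                                  ∎
      where
      open ≡-Reasoning
      f : Fin (m ℕ.+ q ℕ.* m) → Bool
      f v = does (residue v Finₚ.≟ i)
      singleton : tabulate (λ v → f (v ↑ˡ q ℕ.* m)) ≡ ⁅ i ⁆
      singleton = ⊆-antisym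
        (λ {v} v∈ → subst (_∈ ⁅ i ⁆) (sym (trans (sym (residue-↑ˡ v)) (∈-tabulate⁻ v v∈))) (x∈⁅x⁆ i))
        (λ {v} v∈ → lookup⇒[]= v _ (trans (lookup∘tabulate _ v)
          (dec-true (residue (v ↑ˡ q ℕ.* m) Finₚ.≟ i) (trans (residue-↑ˡ v) (x∈⁅y⁆⇒x≡y i v∈)))))
        where
        residue-↑ˡ : ∀ v → residue (v ↑ˡ q ℕ.* m) ≡ v
        residue-↑ˡ v = trans (cong (ι ∘ +_) (Finₚ.toℕ-↑ˡ v (q ℕ.* m))) (ι-toℕ v)
        ∈-tabulate⁻ : ∀ v → v ∈ tabulate (λ v → f (v ↑ˡ q ℕ.* m)) → residue (v ↑ˡ q ℕ.* m) ≡ i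
        ∈-tabulate⁻ v v∈ with residue (v ↑ˡ q ℕ.* m) Finₚ.≟ i in dec-eq
        ... | yes eq = eq
        ... | no _ with trans (sym ([]=⇒lookup v∈)) (trans (lookup∘tabulate _ v) (cong does dec-eq))
        ...   | ()
      first : count (λ v → f (v ↑ˡ q ℕ.* m)) ≡ 1
      first = trans (cong cardinality singleton) (∣⁅x⁆∣≡1 i)
      rest : count (λ v → f (m ↑ʳ v)) ≡ q
      rest = trans (cong cardinality (tabulate-cong λ v → cong (λ r → does (r Finₚ.≟ i)) (residue-↑ʳ v))) (∣coset∣ q i)
        where
        residue-↑ʳ : ∀ (v : Fin (q ℕ.* m)) → residue (m ↑ʳ v) ≡ residue v
        residue-↑ʳ v = ι-cong (+ toℕ (m ↑ʳ v)) (+ toℕ v) (divides 1ℤ (trans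
          (cong (λ n → + n - + toℕ v) (Finₚ.toℕ-↑ʳ m v)) (cancel (+ m) (+ toℕ v))))
          where cancel : ∀ m v → m + v - v ≡ 1ℤ * m
                cancel = solve-∀

  module _ {k m : ℕ} .{{_ : NonZero k}} .{{_ : NonZero m}} (m∣k : m ℕ∣.∣ k)
           (X : SimplicialComplex k)
           (connected : ∀ u v → Connected X u v ⇔ + m ∣ + toℕ u - + toℕ v) where

    component-mod : ∀ {C u} → IsComponent X C → u ∈ C → ∀ v → v ∈ C ⇔ + m ∣ + toℕ u - + toℕ v
    component-mod (_ , comp) u∈C v = mk⇔
      (Equivalence.to (connected _ v) ∘ Equivalence.to (comp u∈C v))
      (Equivalence.from (comp u∈C v) ∘ Equivalence.from (connected _ v))

    component≡coset : ∀ {C u} → IsComponent X C → u ∈ C → C ≡ coset {m} (residue u)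
    component≡coset {C} {u} comp u∈C = ⊆-antisym
      (λ {v} v∈C → ∈coset⁺ _ v (residue-cong v u (∣-swap (+ toℕ u) (+ toℕ v) (Equivalence.to (component-mod comp u∈C v) v∈C))))
      (λ {v} v∈ → Equivalence.from (component-mod comp u∈C v)
        (∣-swap (+ toℕ v) (+ toℕ u) (residue-injective v u (∈coset⁻ _ v v∈))))

    coset-isComponent : ∀ i → IsComponent X (coset {m} i)
    coset-isComponent i = (v₀ , ∈coset⁺ i v₀ residue-v₀) , λ {u} u∈ v → mk⇔
      (λ v∈ → Equivalence.from (connected u v) (residue-injective u v (trans (∈coset⁻ i u u∈) (sym (∈coset⁻ i v v∈)))))
      (λ conn → ∈coset⁺ i v (trans (sym (residue-cong u v (Equivalence.to (connected u v) conn))) (∈coset⁻ i u u∈)))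
      where
      v₀ = inject≤ i (ℕ∣.∣⇒≤ m∣k)
      residue-v₀ : residue v₀ ≡ i
      residue-v₀ = trans (cong (ι ∘ +_) (Finₚ.toℕ-inject≤ i (ℕ∣.∣⇒≤ m∣k))) (ι-toℕ i)

    hasComponents : HasComponents X m
    hasComponents = coset , coset-isComponent , coset-injective ,
      λ { D comp@((u , u∈D) , _) → residue u , component≡coset comp u∈D }
      where
      coset-injective : Injective _≡_ _≡_ (coset {m} {n = k})
      coset-injective {i} {j} eq with proj₁ (coset-isComponent i)
      ... | u , u∈ = trans (sym (∈coset⁻ i u u∈)) (∈coset⁻ j u (subst (u ∈_) eq u∈))

    component-size : ∀ C → IsComponent X C → cardinality C ℕ.* m ≡ k
    component-size C comp@((u , u∈C) , _) = trans (cong (λ D → cardinality D ℕ.* m) (component≡coset comp u∈C))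
      (size k (ℕ∣.quotient m∣k) (ℕ∣._∣_.equality m∣k) (residue u))
      where
      size : ∀ k q → k ≡ q ℕ.* m → ∀ i → cardinality (coset {m} {n = k} i) ℕ.* m ≡ k
      size _ q refl i = cong (ℕ._* m) (∣coset∣ q i)

  module _ {k : ℕ} .{{_ : NonZero k}} {m : ℤ} (m∣k : m ∣ + k) where

    ι-≡⇒m∣ : ∀ x v → ι {k} x ≡ v → m ∣ x - + toℕ v
    ι-≡⇒m∣ x _ refl = ∣-trans m∣k (ι-toℕ-∣ x)

    private
      corner-m∣ : ∀ {a b} s → m ∣ a → m ∣ b → ∀ i → m ∣ corner {k} s a b i - s
      corner-m∣ s m∣a m∣b 0F = divides 0ℤ (+-inverseʳ s)
      corner-m∣ {a} s m∣a m∣b 1F = ∣-resp (cancel s a) m∣a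
        where cancel : ∀ s a → a ≡ s + a - s
              cancel = solve-∀
      corner-m∣ {a} {b} s m∣a m∣b 2F = ∣-resp (cancel s a b) (∣m∣n⇒∣m+n m∣a m∣b)
        where cancel : ∀ s a b → a + b ≡ s + a + b - s
              cancel = solve-∀

    Fits⇒m∣base : ∀ {σ a b v} → m ∣ a → m ∣ b → (fits : Fits {k} σ a b) → v ∈ σ → m ∣ + toℕ v - proj₁ fits
    Fits⇒m∣base {a = a} {b} {v} m∣a m∣b (s , fits) v∈ with fits v∈
    ... | i , eq = ∣-chain (+ toℕ v) (corner {k} s a b i) s
      (∣-swap (corner {k} s a b i) (+ toℕ v) (ι-≡⇒m∣ (corner {k} s a b i) v eq)) (corner-m∣ s m∣a m∣b i)

    Fits⇒m∣ : ∀ {σ a b u v} → m ∣ a → m ∣ b → Fits σ a b → u ∈ σ → v ∈ σ → m ∣ + toℕ u - + toℕ v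
    Fits⇒m∣ {u = u} {v} m∣a m∣b fits@(s , _) u∈ v∈ = ∣-chain (+ toℕ u) s (+ toℕ v)
      (Fits⇒m∣base m∣a m∣b fits u∈) (∣-swap (+ toℕ v) s (Fits⇒m∣base m∣a m∣b fits v∈))

  -- `face⇒` lets the gaps vary with the face, while `face⇐` fixes them: in `S` faces come from two
  -- difference cycles, but the edges of one already connect everything that can be connected.
  module _ {k : ℕ} .{{_ : NonZero k}} (X : SimplicialComplex k) {m : ℤ} {a b : ℤ}
           (m∣k : m ∣ + k)
           (face⇒ : ∀ {σ} → Face X σ → Σ[ a′ ∈ ℤ ] Σ[ b′ ∈ ℤ ] (m ∣ a′ × m ∣ b′ × Fits σ a′ b′))
           (face⇐ : ∀ {σ} → Nonempty σ → Fits σ a b → Face X σ)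
           (spans : Σ[ x ∈ ℤ ] Σ[ y ∈ ℤ ] Σ[ z ∈ ℤ ] x * a + y * b + z * + k ≡ m) where

    connected⇒m∣ : ∀ {u v} → Connected X u v → m ∣ + toℕ u - + toℕ v
    connected⇒m∣ {u} {v} [ adj ] with face⇒ adj
    ... | _ , _ , m∣a , m∣b , fits = Fits⇒m∣ m∣k m∣a m∣b fits
      (x∈p∪q⁺ (inj₁ (x∈⁅x⁆ u))) (x∈p∪q⁺ {p = ⁅ u ⁆} (inj₂ (x∈⁅x⁆ v)))
    connected⇒m∣ {u} {v} (_∷_ {y = w} adj conn) = ∣-chain (+ toℕ u) (+ toℕ w) (+ toℕ v) (connected⇒m∣ [ adj ]) (connected⇒m∣ conn)

    private
      edge : ∀ s i j → Adjacent X (ι (corner {k} s a b i)) (ι (corner {k} s a b j))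
      edge s i j = face⇐ (_ , x∈p∪q⁺ (inj₁ (x∈⁅x⁆ u))) (s , fits)
        where
        u = ι {k} (corner {k} s a b i)
        v = ι {k} (corner {k} s a b j)
        fits : ∀ {w} → w ∈ ⁅ u ⁆ ∪ ⁅ v ⁆ → ∃[ i ] ι (corner {k} s a b i) ≡ w
        fits w∈ with x∈p∪q⁻ ⁅ u ⁆ ⁅ v ⁆ w∈
        ... | inj₁ w∈u = i , sym (x∈⁅y⁆⇒x≡y u w∈u)
        ... | inj₂ w∈v = j , sym (x∈⁅y⁆⇒x≡y v w∈v)

      Step : ℤ → Set
      Step c = ∀ z → Connected X (ι z) (ι (z + c))

      step-0 : Step 0ℤ
      -- The transitive closure has at least one step; staying in place uses the degenerate edge
      -- from a vertex to itself.
      step-0 z = subst (Connected X (ι z) ∘ ι) (sym (+-identityʳ z)) [ edge z 0F 0F ]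

      step-+ : ∀ {c d} → Step c → Step d → Step (c + d)
      step-+ {c} {d} sc sd z = subst (Connected X (ι z) ∘ ι) (+-assoc z c d) (sc z ++ sd (z + c))

      step-multiple : ∀ {c} → Step c → Step (- c) → ∀ n → Step (n * c)
      step-multiple {c} fwd bwd n z = subst (λ d → Connected X (ι z) (ι (z + d))) refl (go n z)
        where
        go-ℕ : ∀ {c} → Step c → ∀ n → Step (+ n * c)
        go-ℕ {c} st zero = subst Step (sym (*-zeroˡ c)) step-0
        go-ℕ {c} st (ℕ.suc n) = subst Step (sym (suc-* (+ n) c)) (step-+ {c} {+ n * c} st (go-ℕ st n))
        go : ∀ n → Step (n * c)
        go (+ n) = go-ℕ fwd n
        go n@(-[1+ n-1 ]) = subst Step (flip (+ ℕ.suc n-1) c) (go-ℕ bwd (ℕ.suc n-1))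
          where flip : ∀ n c → n * - c ≡ - n * c
                flip = solve-∀

      step-a : ∀ n → Step (n * a)
      step-a = step-multiple (λ z → [ edge z 0F 1F ])
        (λ z → [ subst (λ w → Adjacent X (ι w) (ι (z - a))) (cancel z a) (edge (z - a) 1F 0F) ])
        where cancel : ∀ z a → z - a + a ≡ z
              cancel = solve-∀

      step-b : ∀ n → Step (n * b)
      step-b = step-multiple
        (λ z → [ subst (λ w → Adjacent X (ι w) (ι (w + b))) (cancel z a) (edge (z - a) 1F 2F) ])
        (λ z → [ subst₂ (λ v w → Adjacent X (ι v) (ι w)) (cancel′ z a b) (cancel″ z a b) (edge (z - a - b) 2F 1F) ])
        where
        cancel : ∀ z a → z - a + a ≡ z
        cancel = solve-∀
        cancel′ : ∀ z a b → z - a - b + a + b ≡ z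
        cancel′ = solve-∀
        cancel″ : ∀ z a b → z - a - b + a ≡ z - b
        cancel″ = solve-∀

    -- If `u - v = q m`, walking `- q x` times along `a` and `- q y` times along `b` leads from `u`
    -- to a number that differs from `v` by `q z k`.
    m∣⇒connected : ∀ u v → m ∣ + toℕ u - + toℕ v → Connected X u v
    m∣⇒connected u v (divides q eq) = subst₂ (Connected X) (ι-toℕ u) (trans (ι-cong target (+ toℕ v) (divides (q * z) (begin
        target - + toℕ v                                        ≡⟨ regroup (+ toℕ u) (- q * x) (- q * y) a b (+ toℕ v) ⟩
        (+ toℕ u - + toℕ v) + (- q * x * a + - q * y * b)       ≡⟨ cong (_+ (- q * x * a + - q * y * b)) (trans eq (cong (q *_) (sym span))) ⟩
        q * (x * a + y * b + z * + k) + (- q * x * a + - q * y * b) ≡⟨ simplify q x y z a b (+ k) ⟩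
        q * z * + k                                             ∎))) (ι-toℕ v))
      (step-+ {(- q * x) * a} {(- q * y) * b} (step-a (- q * x)) (step-b (- q * y)) (+ toℕ u))
      where
      open ≡-Reasoning
      x = proj₁ spans
      y = proj₁ (proj₂ spans)
      z = proj₁ (proj₂ (proj₂ spans))
      span = proj₂ (proj₂ (proj₂ spans))
      target = + toℕ u + ((- q * x) * a + (- q * y) * b)
      regroup : ∀ u p r a b v → u + (p * a + r * b) - v ≡ (u - v) + (p * a + r * b)
      regroup = solve-∀
      simplify : ∀ q x y z a b k → q * (x * a + y * b + z * k) + (- q * x * a + - q * y * b) ≡ q * z * k
      simplify = solve-∀

    connected⇔m∣ : ∀ u v → Connected X u v ⇔ m ∣ + toℕ u - + toℕ v
    connected⇔m∣ u v = mk⇔ connected⇒m∣ (m∣⇒connected u v)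

  module _ {k : ℕ} .{{_ : NonZero k}} where

    private
      add : ℤ → Fin k → Fin k
      add c v = ι (+ toℕ v + c)

      add-ι : ∀ c z → add c (ι z) ≡ ι (z + c)
      add-ι c z = ι-translate (+ toℕ (ι z)) z c (∣-swap z (+ toℕ (ι z)) (ι-toℕ-∣ z))

      add-inverse : ∀ c d → d + c ≡ 0ℤ → ∀ v → add c (add d v) ≡ v
      add-inverse c d eq v = trans (add-ι c (+ toℕ v + d)) (trans
        (cong ι (trans (+-assoc (+ toℕ v) d c) (trans (cong (λ e → + toℕ v + e) eq) (+-identityʳ (+ toℕ v)))))
        (ι-toℕ v))

    translation : ℤ → Permutation′ k
    translation c = permutation (add c) (add (- c)) (add-inverse c (- c) (+-inverseˡ c)) (add-inverse (- c) c (+-inverseʳ c))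

    ∈relabel⁺ : ∀ (π : Permutation′ k) σ v → π ⟨$⟩ˡ v ∈ σ → v ∈ relabel π σ
    ∈relabel⁺ π σ v v∈ = lookup⇒[]= v _ (trans (lookup∘tabulate _ v) ([]=⇒lookup v∈))

    ∈relabel⁻ : ∀ (π : Permutation′ k) σ v → v ∈ relabel π σ → π ⟨$⟩ˡ v ∈ σ
    ∈relabel⁻ π σ v v∈ = lookup⇒[]= _ σ (trans (sym (lookup∘tabulate _ v)) ([]=⇒lookup v∈))

    ∈relabel-image : ∀ (π : Permutation′ k) σ v → v ∈ σ → π ⟨$⟩ʳ v ∈ relabel π σ
    ∈relabel-image π σ v v∈ = ∈relabel⁺ π σ (π ⟨$⟩ʳ v) (subst (_∈ σ) (sym (inverseˡ π)) v∈)

    private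
      corner-+ : ∀ s a b c i → corner {k} (s + c) a b i ≡ corner {k} s a b i + c
      corner-+ s a b c 0F = refl
      corner-+ s a b c 1F = swap s a c
        where swap : ∀ s a c → s + c + a ≡ s + a + c
              swap = solve-∀
      corner-+ s a b c 2F = swap s a b c
        where swap : ∀ s a b c → s + c + a + b ≡ s + a + b + c
              swap = solve-∀

    Fits-relabel : ∀ c {σ a b} → Fits σ a b → Fits (relabel (translation c) σ) a b
    Fits-relabel c {σ} {a} {b} (s , fits) = s + c , λ {v} v∈ →
      let π = translation c
          i , eq = fits (∈relabel⁻ π σ v v∈)
      in i , (begin
        ι (corner {k} (s + c) a b i)          ≡⟨ cong ι (corner-+ s a b c i) ⟩
        ι (corner {k} s a b i + c)            ≡⟨ add-ι c (corner {k} s a b i) ⟨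
        π ⟨$⟩ʳ ι (corner {k} s a b i)         ≡⟨ cong (π ⟨$⟩ʳ_) eq ⟩
        π ⟨$⟩ʳ (π ⟨$⟩ˡ v)                     ≡⟨ inverseʳ π ⟩
        v                                     ∎)
      where open ≡-Reasoning

    Fits-relabel⁻ : ∀ c {σ a b} → Fits (relabel (translation c) σ) a b → Fits σ a b
    Fits-relabel⁻ c {σ} {a} {b} (s , fits) = s - c , λ {v} v∈ →
      let π = translation c
          i , eq = fits (∈relabel-image π σ v v∈)
      in i , (begin
        ι (corner {k} (s - c) a b i)          ≡⟨ cong ι (corner-+ s a b (- c) i) ⟩
        ι (corner {k} s a b i - c)            ≡⟨ add-ι (- c) (corner {k} s a b i) ⟨
        π ⟨$⟩ˡ ι (corner {k} s a b i)         ≡⟨ cong (π ⟨$⟩ˡ_) eq ⟩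
        π ⟨$⟩ˡ (π ⟨$⟩ʳ v)                     ≡⟨ inverseˡ π ⟩
        v                                     ∎)
      where open ≡-Reasoning

    Nonempty-relabel : ∀ c {σ} → Nonempty σ → Nonempty (relabel (translation c) σ)
    Nonempty-relabel c {σ} (v , v∈) = _ , ∈relabel-image (translation c) σ v v∈

    Nonempty-relabel⁻ : ∀ c {σ} → Nonempty (relabel (translation c) σ) → Nonempty σ
    Nonempty-relabel⁻ c {σ} (v , v∈) = _ , ∈relabel⁻ (translation c) σ v v∈

    translation-∣ : ∀ c v → + k ∣ + toℕ (translation c ⟨$⟩ʳ v) - (+ toℕ v + c)
    translation-∣ c v = ∣-swap (+ toℕ v + c) (+ toℕ (translation c ⟨$⟩ʳ v)) (ι-toℕ-∣ (+ toℕ v + c))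

    module _ (X : SimplicialComplex k) {m a b : ℤ} (m∣k : m ∣ + k)
             (face⇔ : ∀ {σ} → Face X σ ⇔ (Nonempty σ × Fits σ a b))
             (connected : ∀ u v → Connected X u v ⇔ m ∣ + toℕ u - + toℕ v) where

      private
        module _ {C D u v} (C-comp : IsComponent X C) (D-comp : IsComponent X D) (u∈C : u ∈ C) (v∈D : v ∈ D) where

          c = + toℕ v - + toℕ u
          π = translation c

          C⇔ : ∀ w → w ∈ C ⇔ m ∣ + toℕ u - + toℕ w
          C⇔ w = mk⇔ (Equivalence.to (connected u w) ∘ Equivalence.to (proj₂ C-comp u∈C w))
                     (Equivalence.from (proj₂ C-comp u∈C w) ∘ Equivalence.from (connected u w))

          D⇔ : ∀ w → w ∈ D ⇔ m ∣ + toℕ v - + toℕ w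
          D⇔ w = mk⇔ (Equivalence.to (connected v w) ∘ Equivalence.to (proj₂ D-comp v∈D w))
                     (Equivalence.from (proj₂ D-comp v∈D w) ∘ Equivalence.from (connected v w))

          move : ∀ u v w w′ → (u - w) - (w′ - (w + (v - u))) ≡ v - w′
          move = solve-∀

          C⇒D : ∀ w → w ∈ C → π ⟨$⟩ʳ w ∈ D
          C⇒D w w∈C = Equivalence.from (D⇔ (π ⟨$⟩ʳ w)) (∣-resp (move (+ toℕ u) (+ toℕ v) (+ toℕ w) (+ toℕ (π ⟨$⟩ʳ w)))
            (∣m∣n⇒∣m-n (Equivalence.to (C⇔ w) w∈C) (∣-trans m∣k (translation-∣ c w))))

          D⇒C : ∀ w → π ⟨$⟩ʳ w ∈ D → w ∈ C
          D⇒C w πw∈D = Equivalence.from (C⇔ w) (∣-resp (move⁻ (+ toℕ u) (+ toℕ v) (+ toℕ w) (+ toℕ (π ⟨$⟩ʳ w)))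
            (∣m∣n⇒∣m+n (Equivalence.to (D⇔ (π ⟨$⟩ʳ w)) πw∈D) (∣-trans m∣k (translation-∣ c w))))
            where move⁻ : ∀ u v w w′ → (v - w′) + (w′ - (w + (v - u))) ≡ u - w
                  move⁻ = solve-∀

      -- The translation by `v - u` preserves gaps, hence faces, and carries the class of `u` modulo
      -- `m` to that of `v`; reduction modulo `k` does not disturb classes because `m` divides `k`.
      components-isomorphic : ∀ C D → IsComponent X C → IsComponent X D → Isomorphic (X ↾ C) (X ↾ D)
      components-isomorphic C D C-comp@((u , u∈C) , _) D-comp@((v , v∈D) , _) = translation d , λ σ → mk⇔
        (λ (σ∈X , σ⊆C) → let ne , fits = Equivalence.to face⇔ σ∈X in
          Equivalence.from face⇔ (Nonempty-relabel d ne , Fits-relabel d fits) ,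
          λ {w} w∈ → subst (_∈ D) (inverseʳ (translation d)) (C⇒D C-comp D-comp u∈C v∈D _ (σ⊆C (∈relabel⁻ (translation d) σ w w∈))))
        (λ (πσ∈X , πσ⊆D) → let ne , fits = Equivalence.to face⇔ πσ∈X in
          Equivalence.from face⇔ (Nonempty-relabel⁻ d ne , Fits-relabel⁻ d fits) ,
          λ {w} w∈ → D⇒C C-comp D-comp u∈C v∈D w (πσ⊆D (∈relabel-image (translation d) σ w w∈)))
        where
        d = + toℕ v - + toℕ u

-- The Möbius strips and the tori.

module Families where

  open import Defs hiding (positive)
  open Atlases using (vertexSet; ∈vertexSet⁺; ∈vertexSet⁻; homeomorphic)
  open Covers using (atlas)
  open Residues
  open KuhnPlane hiding (corners)
  open TorusCovers using (module TorusLifting)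
  open MoebiusCovers using (module MöbiusLifting)
  open Components
  open import Data.Nat.Base as ℕ using (suc; NonZero; s≤s)
  import Data.Nat.Properties as ℕₚ
  import Data.Nat.Divisibility as ℕ∣
  import Data.Nat.DivMod as ℕD
  open import Data.Nat.GCD using (gcd; gcd[m,n]∣m; gcd[m,n]∣n; gcd[m,n]≢0)
  open import Data.Integer.Base hiding (NonZero; suc; positive)
  open import Data.Integer.Properties
  open import Data.Integer.Divisibility.Signed
  open import Data.Integer.Tactic.RingSolver using (solve-∀)
  open import Data.Fin.Subset using (Subset; _∈_; _⊆_; Nonempty) renaming (∣_∣ to cardinality)
  open import Data.List.Relation.Unary.Any using (here; there)

  module Congruence (d k : ℕ) .{{_ : NonZero k}} where

    m : ℕ
    m = gcd d k

    instance
      m-nonZero : NonZero m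
      m-nonZero = ℕ.≢-nonZero (gcd[m,n]≢0 d k (inj₂ (ℕ.≢-nonZero⁻¹ k)))

    m∣k : m ℕ∣.∣ k
    m∣k = gcd[m,n]∣n d k

    +m∣k : + m ∣ + k
    +m∣k = ∣-ℕ m∣k

    +m∣d : + m ∣ + d
    +m∣d = ∣-ℕ (gcd[m,n]∣m d k)

    K : ℕ
    K = ℕ∣.quotient m∣k

    k≡K*m : k ≡ K ℕ.* m
    k≡K*m = ℕ∣._∣_.equality m∣k

    instance
      K-nonZero : NonZero K
      K-nonZero = ℕₚ.m*n≢0⇒m≢0 K {{subst NonZero k≡K*m (ℕ.≢-nonZero (ℕ.≢-nonZero⁻¹ k))}}

    private
      x = proj₁ (bézout d k)
      z = proj₁ (proj₂ (bézout d k))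
      span : x * + d + z * + k ≡ + m
      span = proj₂ (proj₂ (bézout d k))

      +k≡K*m : + k ≡ + K * + m
      +k≡K*m = trans (cong +_ k≡K*m) (pos-* K m)

    -- Scaling the Bézout identity by the quotient `q` solves the congruence. It supplies the lifted
    -- triangle above a face whose base is `s`.
    solution : ∀ e s → + m ∣ s - e → Σ[ w ∈ ℤ ] + k ∣ e + + d * w - s
    solution e s (divides q eq) = q * x , divides (- q * z) (begin
      e + + d * (q * x) - s                      ≡⟨ regroup e s (+ d) q x ⟩
      q * x * + d - (s - e)                      ≡⟨ cong (λ c → q * x * + d - c) (trans eq (cong (q *_) (sym span))) ⟩
      q * x * + d - q * (x * + d + z * + k)      ≡⟨ simplify q x z (+ d) (+ k) ⟩
      - q * z * + k                              ∎)
      where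
      open ≡-Reasoning
      regroup : ∀ e s d q x → e + d * (q * x) - s ≡ q * x * d - (s - e)
      regroup = solve-∀
      simplify : ∀ q x z d k → q * x * d - q * (x * d + z * k) ≡ - q * z * k
      simplify = solve-∀

    -- By Bézout `w m` is a combination of `d w` and `k`, both divisible by `k = K m`; then `m` is
    -- cancelled.
    period : ∀ w → + k ∣ + d * w → + K ∣ w
    period w k∣dw = *-cancelʳ-∣ (+ m) (subst (_∣ w * + m) +k≡K*m
      (∣-resp (trans (regroup x z (+ d) (+ k) w) (cong (w *_) span))
        (∣m∣n⇒∣m+n (∣n⇒∣m*n x k∣dw) (∣n⇒∣m*n (w * z) ∣-refl))))
      where regroup : ∀ x z d k w → x * (d * w) + w * z * k ≡ w * (x * d + z * k)
            regroup = solve-∀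

    isPeriod : + k ∣ + d * + K
    isPeriod with +m∣d
    ... | divides q eq = divides q (begin
      + d * + K         ≡⟨ cong (_* + K) eq ⟩
      q * + m * + K     ≡⟨ swap q (+ m) (+ K) ⟩
      q * (+ K * + m)   ≡⟨ cong (q *_) +k≡K*m ⟨
      q * + k           ∎)
      where
      open ≡-Reasoning
      swap : ∀ q m K → q * m * K ≡ q * (K * m)
      swap = solve-∀

    spans : Σ[ x ∈ ℤ ] Σ[ z ∈ ℤ ] x * + d + z * + k ≡ + m
    spans = bézout d k

  module Coprime6 {k : ℕ} (k%6 : k ℕ.% 6 ≡ 1 ⊎ k ℕ.% 6 ≡ 5) where

    private
      q = + (k ℕ./ 6)

      expansion : ∀ {r} → k ℕ.% 6 ≡ r → + k ≡ + r + q * + 6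
      expansion {r} eq = trans (cong +_ (ℕD.m≡m%n+[m/n]*n k 6)) (trans
        (cong (λ r → + (r ℕ.+ k ℕ./ 6 ℕ.* 6)) eq)
        (cong (λ e → + r + e) (pos-* (k ℕ./ 6) 6)))

    half : Σ[ h ∈ ℤ ] + k ≡ 1ℤ + (h + h)
    half = cases k%6
      where
      cases : k ℕ.% 6 ≡ 1 ⊎ k ℕ.% 6 ≡ 5 → Σ[ h ∈ ℤ ] + k ≡ 1ℤ + (h + h)
      cases (inj₁ eq) = + 3 * q , trans (expansion eq) (lemma q)
        where lemma : ∀ q → + 1 + q * + 6 ≡ 1ℤ + (+ 3 * q + + 3 * q)
              lemma = solve-∀
      cases (inj₂ eq) = + 3 * q + + 2 , trans (expansion eq) (lemma q)
        where lemma : ∀ q → + 5 + q * + 6 ≡ 1ℤ + (+ 3 * q + + 2 + (+ 3 * q + + 2))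
              lemma = solve-∀

    -- For `k = 1 + 2 h` the number `x` equals `x k - h (2 x)`.
    k∣2*⇒k∣ : ∀ x → + k ∣ + 2 * x → + k ∣ x
    k∣2*⇒k∣ x k∣2x with half
    ... | h , eq = ∣-resp (trans (cong (λ k → x * k - h * (+ 2 * x)) eq) (simplify x h))
      (∣m∣n⇒∣m-n (∣n⇒∣m*n x ∣-refl) (∣n⇒∣m*n h k∣2x))
      where simplify : ∀ x h → x * (1ℤ + (h + h)) - h * (+ 2 * x) ≡ x
            simplify = solve-∀

    -- For `k = 1 + 6 q`, `x` equals `x k - 2 q (3 x)`. For `k = 5 + 6 q` the analogous combination
    -- `x k - (2 q + 1) (3 x)` gives `2 x`, from which the 2 is cancelled.
    k∣3*⇒k∣ : ∀ x → + k ∣ + 3 * x → + k ∣ x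
    k∣3*⇒k∣ x k∣3x = cases k%6
      where
      cases : k ℕ.% 6 ≡ 1 ⊎ k ℕ.% 6 ≡ 5 → + k ∣ x
      cases (inj₁ eq) = ∣-resp (trans (cong (λ k → x * k - + 2 * q * (+ 3 * x)) (expansion eq)) (simplify x q))
        (∣m∣n⇒∣m-n (∣n⇒∣m*n x ∣-refl) (∣n⇒∣m*n (+ 2 * q) k∣3x))
        where simplify : ∀ x q → x * (+ 1 + q * + 6) - + 2 * q * (+ 3 * x) ≡ x
              simplify = solve-∀
      cases (inj₂ eq) = k∣2*⇒k∣ x (∣-resp (trans (cong (λ k → x * k - (+ 2 * q + 1ℤ) * (+ 3 * x)) (expansion eq)) (simplify x q))
        (∣m∣n⇒∣m-n (∣n⇒∣m*n x ∣-refl) (∣n⇒∣m*n (+ 2 * q + 1ℤ) k∣3x)))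
        where simplify : ∀ x q → x * (+ 5 + q * + 6) - (+ 2 * q + 1ℤ) * (+ 3 * x) ≡ + 2 * x
              simplify = solve-∀

  module _ {k : ℕ} (k%6 : k ℕ.% 6 ≡ 1 ⊎ k ℕ.% 6 ≡ 5) where
    open Coprime6 {k} k%6

    -- The numbers 1 to 4 have only the prime factors 2 and 3, and these can be cancelled modulo
    -- `k`.
    multiples≢0 : ∀ {l} → ¬ + k ∣ l → ∀ a → ∣ a ∣ ℕ.≤ 4 → + k ∣ l * a → a ≡ 0ℤ
    multiples≢0 {l} k∤l = go
      where
      times : ∀ a {b} → b ≡ l * a → + k ∣ l * a → + k ∣ b
      times a eq = ∣-resp (sym eq)
      1* : ∀ l → l ≡ l * + 1
      1* = solve-∀
      2* : ∀ l → + 2 * l ≡ l * + 2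
      2* = solve-∀
      3* : ∀ l → + 3 * l ≡ l * + 3
      3* = solve-∀
      4* : ∀ l → + 2 * (+ 2 * l) ≡ l * + 4
      4* = solve-∀
      positive : ∀ n → suc n ℕ.≤ 4 → ¬ + k ∣ l * + suc n
      positive 0 _ = k∤l ∘ times (+ 1) (1* l)
      positive 1 _ = k∤l ∘ k∣2*⇒k∣ l ∘ times (+ 2) (2* l)
      positive 2 _ = k∤l ∘ k∣3*⇒k∣ l ∘ times (+ 3) (3* l)
      positive 3 _ = k∤l ∘ k∣2*⇒k∣ l ∘ k∣2*⇒k∣ (+ 2 * l) ∘ times (+ 4) (4* l)
      positive (suc (suc (suc (suc n)))) (s≤s (s≤s (s≤s (s≤s ()))))
      go : ∀ a → ∣ a ∣ ℕ.≤ 4 → + k ∣ l * a → a ≡ 0ℤ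
      go (+ 0) _ _ = refl
      go (+ suc n) ≤4 k∣ = contradiction k∣ (positive n ≤4)
      go -[1+ n ] ≤4 k∣ = contradiction (∣-resp (flip l (+ suc n)) (∣m⇒∣-m k∣)) (positive n ≤4)
        where flip : ∀ l a → - (l * - a) ≡ l * a
              flip = solve-∀

    -- Up to sign and modulo k, the nonzero points of the hexagon of radius 2 give
    -- L, J, C, their doubles and their differences.

    combinations≢0 : ∀ {L J C} → L + J + C ≡ + k →
      ¬ + k ∣ L → ¬ + k ∣ J → ¬ + k ∣ C → ¬ + k ∣ J - L → ¬ + k ∣ C - L → ¬ + k ∣ C - J →
      ∀ a b → Hexagon 2 a b → + k ∣ L * a + J * b → a ≡ 0ℤ × b ≡ 0ℤ
    combinations≢0 {L} {J} {C} sum ∤L ∤J ∤C ∤J-L ∤C-L ∤C-J = go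
      where
      complement : ∀ {x y} → x + y ≡ + k → + k ∣ x → + k ∣ y
      complement {x} {y} eq k∣x = ∣m+n∣m⇒∣n (∣-reflexive (sym eq)) k∣x

      D : ℤ → ℤ → Set
      D a b = + k ∣ L * a + J * b

      ∤10 : ¬ D (+ 1) (+ 0)
      ∤10 k∣ = ∤L (∣-resp (lemma L J) k∣)
        where lemma : ∀ L J → L * + 1 + J * + 0 ≡ L
              lemma = solve-∀
      ∤01 : ¬ D (+ 0) (+ 1)
      ∤01 k∣ = ∤J (∣-resp (lemma L J) k∣)
        where lemma : ∀ L J → L * + 0 + J * + 1 ≡ J
              lemma = solve-∀
      ∤11 : ¬ D (+ 1) (+ 1)
      ∤11 k∣ = ∤C (complement (trans (lemma L J C) sum) k∣)
        where lemma : ∀ L J C → L * + 1 + J * + 1 + C ≡ L + J + C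
              lemma = solve-∀
      ∤20 : ¬ D (+ 2) (+ 0)
      ∤20 k∣ = ∤10 (k∣2*⇒k∣ _ (∣-resp (lemma L J) k∣))
        where lemma : ∀ L J → L * + 2 + J * + 0 ≡ + 2 * (L * + 1 + J * + 0)
              lemma = solve-∀
      ∤02 : ¬ D (+ 0) (+ 2)
      ∤02 k∣ = ∤01 (k∣2*⇒k∣ _ (∣-resp (lemma L J) k∣))
        where lemma : ∀ L J → L * + 0 + J * + 2 ≡ + 2 * (L * + 0 + J * + 1)
              lemma = solve-∀
      ∤22 : ¬ D (+ 2) (+ 2)
      ∤22 k∣ = ∤11 (k∣2*⇒k∣ _ (∣-resp (lemma L J) k∣))
        where lemma : ∀ L J → L * + 2 + J * + 2 ≡ + 2 * (L * + 1 + J * + 1)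
              lemma = solve-∀
      ∤-11 : ¬ D -1ℤ (+ 1)
      ∤-11 k∣ = ∤J-L (∣-resp (lemma L J) k∣)
        where lemma : ∀ L J → L * -1ℤ + J * + 1 ≡ J - L
              lemma = solve-∀
      ∤21 : ¬ D (+ 2) (+ 1)
      ∤21 k∣ = ∤C-L (complement (trans (lemma L J C) sum) k∣)
        where lemma : ∀ L J C → L * + 2 + J * + 1 + (C - L) ≡ L + J + C
              lemma = solve-∀
      ∤12 : ¬ D (+ 1) (+ 2)
      ∤12 k∣ = ∤C-J (complement (trans (lemma L J C) sum) k∣)
        where lemma : ∀ L J C → L * + 1 + J * + 2 + (C - J) ≡ L + J + C
              lemma = solve-∀

      minus : ∀ {a b} → D a b → D (- a) (- b)
      minus {a} {b} k∣ = ∣-resp (lemma L J a b) (∣m⇒∣-m k∣)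
        where lemma : ∀ L J a b → - (L * a + J * b) ≡ L * - a + J * - b
              lemma = solve-∀

      big : ∀ {n} {A : Set} → suc (suc (suc n)) ℕ.≤ 2 → A
      big (s≤s (s≤s ()))

      go : ∀ a b → Hexagon 2 a b → D a b → a ≡ 0ℤ × b ≡ 0ℤ
      go (+ 0) (+ 0) _ _ = refl , refl
      go (+ 0) (+ 1) _ k∣ = contradiction k∣ ∤01
      go (+ 0) (+ 2) _ k∣ = contradiction k∣ ∤02
      go (+ 0) -[1+ 0 ] _ k∣ = contradiction (minus {+ 0} { -1ℤ} k∣) ∤01
      go (+ 0) -[1+ 1 ] _ k∣ = contradiction (minus {+ 0} { -[1+ 1 ]} k∣) ∤02
      go (+ 1) (+ 0) _ k∣ = contradiction k∣ ∤10
      go (+ 1) (+ 1) _ k∣ = contradiction k∣ ∤11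
      go (+ 1) (+ 2) _ k∣ = contradiction k∣ ∤12
      go (+ 1) -[1+ 0 ] _ k∣ = contradiction (minus {+ 1} { -1ℤ} k∣) ∤-11
      go (+ 1) -[1+ 1 ] (_ , _ , ≤2) _ = big ≤2
      go (+ 2) (+ 0) _ k∣ = contradiction k∣ ∤20
      go (+ 2) (+ 1) _ k∣ = contradiction k∣ ∤21
      go (+ 2) (+ 2) _ k∣ = contradiction k∣ ∤22
      go (+ 2) -[1+ 0 ] (_ , _ , ≤2) _ = big ≤2
      go (+ 2) -[1+ 1 ] (_ , _ , ≤2) _ = big ≤2
      go -[1+ 0 ] (+ 0) _ k∣ = contradiction (minus { -1ℤ} {+ 0} k∣) ∤10
      go -[1+ 0 ] (+ 1) _ k∣ = contradiction k∣ ∤-11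
      go -[1+ 0 ] (+ 2) (_ , _ , ≤2) _ = big ≤2
      go -[1+ 0 ] -[1+ 0 ] _ k∣ = contradiction (minus { -1ℤ} { -1ℤ} k∣) ∤11
      go -[1+ 0 ] -[1+ 1 ] _ k∣ = contradiction (minus { -1ℤ} { -[1+ 1 ]} k∣) ∤12
      go -[1+ 1 ] (+ 0) _ k∣ = contradiction (minus { -[1+ 1 ]} {+ 0} k∣) ∤20
      go -[1+ 1 ] (+ 1) (_ , _ , ≤2) _ = big ≤2
      go -[1+ 1 ] (+ 2) (_ , _ , ≤2) _ = big ≤2
      go -[1+ 1 ] -[1+ 0 ] _ k∣ = contradiction (minus { -[1+ 1 ]} { -1ℤ} k∣) ∤21
      go -[1+ 1 ] -[1+ 1 ] _ k∣ = contradiction (minus { -[1+ 1 ]} { -[1+ 1 ]} k∣) ∤22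
      go (+ suc (suc (suc _))) _ (≤2 , _) _ = big ≤2
      go -[1+ suc (suc _) ] _ (≤2 , _) _ = big ≤2
      go (+ 0) (+ suc (suc (suc _))) (_ , ≤2 , _) _ = big ≤2
      go (+ 1) (+ suc (suc (suc _))) (_ , ≤2 , _) _ = big ≤2
      go (+ 2) (+ suc (suc (suc _))) (_ , ≤2 , _) _ = big ≤2
      go -[1+ 0 ] (+ suc (suc (suc _))) (_ , ≤2 , _) _ = big ≤2
      go -[1+ 1 ] (+ suc (suc (suc _))) (_ , ≤2 , _) _ = big ≤2
      go (+ 0) -[1+ suc (suc _) ] (_ , ≤2 , _) _ = big ≤2
      go (+ 1) -[1+ suc (suc _) ] (_ , ≤2 , _) _ = big ≤2
      go (+ 2) -[1+ suc (suc _) ] (_ , ≤2 , _) _ = big ≤2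
      go -[1+ 0 ] -[1+ suc (suc _) ] (_ , ≤2 , _) _ = big ≤2
      go -[1+ 1 ] -[1+ suc (suc _) ] (_ , ≤2 , _) _ = big ≤2

  +-∸ : ∀ {a b} → a ℕ.≤ b → + (b ℕ.∸ a) ≡ + b - + a
  +-∸ {a} {b} a≤b = sym (trans (m-n≡m⊖n b a) (⊖-≥ a≤b))

  module MöbiusFamily {k-1 : ℕ} (k%6 : suc k-1 ℕ.% 6 ≡ 1 ⊎ suc k-1 ℕ.% 6 ≡ 5) (i : MöbiusIndex (suc k-1)) where

    private
      k = suc k-1

    open MöbiusIndex i

    X : SimplicialComplex k
    X = M k i

    l<k : l ℕ.< k
    l<k = s≤s (ℕₚ.≤-trans l≤ (ℕD.m/n≤m k-1 2))

    face⇒ : ∀ {σ} → Face X σ → Nonempty σ × Fits σ (+ l) (+ l)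
    face⇒ (σ≠∅ , here fits) = σ≠∅ , ⊆translate⇒Fits fits

    face⇐ : ∀ {σ} → Nonempty σ → Fits σ (+ l) (+ l) → Face X σ
    face⇐ σ≠∅ fits = σ≠∅ , here (Fits⇒⊆translate fits)

    open Congruence l k

    connected : ∀ u v → Connected X u v ⇔ + m ∣ + toℕ u - + toℕ v
    connected = connected⇔m∣ X +m∣k (λ σ∈X → + l , + l , +m∣d , +m∣d , proj₂ (face⇒ σ∈X)) face⇐
      (let x , z , eq = spans in x , 0ℤ , z , trans (drop x z (+ l) (+ k)) eq)
      where drop : ∀ x z l k → x * l + 0ℤ * l + z * k ≡ x * l + z * k
            drop = solve-∀

    components : HasComponents X m
    components = hasComponents m∣k X connected

    size : ∀ C → IsComponent X C → cardinality C ℕ.* m ≡ k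
    size = component-size m∣k X connected

    isomorphic : ∀ C D → IsComponent X C → IsComponent X D → Isomorphic (X ↾ C) (X ↾ D)
    isomorphic = components-isomorphic X +m∣k (mk⇔ face⇒ (λ (σ≠∅ , fits) → face⇐ σ≠∅ fits)) connected

    K-odd : Σ[ h ∈ ℤ ] + K ≡ 1ℤ + (h + h)
    K-odd = odd (K ℕ.% 2) (ℕD.m%n<n K 2) refl
      where
      h = + (K ℕ./ 2)
      K≡ : + K ≡ + (K ℕ.% 2) + h * + 2
      K≡ = trans (cong +_ (ℕD.m≡m%n+[m/n]*n K 2)) (cong (λ e → + (K ℕ.% 2) + e) (pos-* (K ℕ./ 2) 2))
      double : ∀ h → + 1 + h * + 2 ≡ 1ℤ + (h + h)
      double = solve-∀
      odd : ∀ r → r ℕ.< 2 → K ℕ.% 2 ≡ r → Σ[ h ∈ ℤ ] + K ≡ 1ℤ + (h + h)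
      odd 1 _ eq = h , trans K≡ (trans (cong (λ r → + r + h * + 2) eq) (double h))
      odd (suc (suc _)) (s≤s (s≤s ()))
      -- If `K` were even, `k` would be twice `K / 2 * m`; cancelling the 2, `k` would divide this
      -- positive number smaller than `k`.
      odd 0 _ eq = contradiction (Coprime6.k∣2*⇒k∣ k%6 (+ (K ℕ./ 2 ℕ.* m)) (divides 1ℤ (begin
        + 2 * + (K ℕ./ 2 ℕ.* m)      ≡⟨ cong (+ 2 *_) (pos-* (K ℕ./ 2) m) ⟩
        + 2 * (h * + m)              ≡⟨ regroup h (+ m) ⟩
        (+ 0 + h * + 2) * + m        ≡⟨ cong (λ r → (+ r + h * + 2) * + m) eq ⟨
        (+ (K ℕ.% 2) + h * + 2) * + m ≡⟨ cong (_* + m) K≡ ⟨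
        + K * + m                    ≡⟨ trans (cong +_ k≡K*m) (pos-* K m) ⟨
        + k                          ≡⟨ *-identityˡ (+ k) ⟨
        1ℤ * + k                     ∎)))
        (0<n<d⇒d∤n (ℕ.>-nonZero⁻¹ _ {{half*m-nonZero}}) half*m<k)
        where
        open ≡-Reasoning
        regroup : ∀ h m → + 2 * (h * m) ≡ (+ 0 + h * + 2) * m
        regroup = solve-∀
        K≡h*2 : K ≡ K ℕ./ 2 ℕ.* 2
        K≡h*2 = trans (ℕD.m≡m%n+[m/n]*n K 2) (cong (ℕ._+ K ℕ./ 2 ℕ.* 2) eq)
        half-nonZero : NonZero (K ℕ./ 2)
        half-nonZero = ℕₚ.m*n≢0⇒m≢0 (K ℕ./ 2) {{subst NonZero K≡h*2 K-nonZero}}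
        half*m-nonZero : NonZero (K ℕ./ 2 ℕ.* m)
        half*m-nonZero = ℕₚ.m*n≢0 (K ℕ./ 2) m {{half-nonZero}}
        half*m<k : K ℕ./ 2 ℕ.* m ℕ.< k
        half*m<k = subst (K ℕ./ 2 ℕ.* m ℕ.<_) (sym k≡K*m)
          (ℕₚ.*-monoˡ-< m (ℕD.m/n<m K 2 ℕₚ.≤-refl))

    module _ {C : Subset k} {u : Fin k} (C-comp : IsComponent X C) (u∈C : u ∈ C) where

      e : ℤ
      e = + toℕ u

      open MöbiusLifting {k} e (+ l)

      private
        corner≡ : ∀ t j → corner {k} (index t) (+ l) (+ l) j ≡ index (corners t j)
        corner≡ t 0F = lemma e (+ l) t
          where lemma : ∀ e l t → e + l * t ≡ e + l * (t + 0ℤ)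
                lemma = solve-∀
        corner≡ t 1F = lemma e (+ l) t
          where lemma : ∀ e l t → e + l * t + l ≡ e + l * (t + 1ℤ)
                lemma = solve-∀
        corner≡ t 2F = lemma e (+ l) t
          where lemma : ∀ e l t → e + l * t + l + l ≡ e + l * (t + + 2)
                lemma = solve-∀

        label∈C : ∀ w → label w ∈ C
        label∈C w = Equivalence.from (component-mod m∣k X connected C-comp u∈C (label w))
          (∣-resp (cancel e (+ l * w) (+ toℕ (label w)))
            (∣m∣n⇒∣m-n (∣-trans +m∣k (ι-toℕ-∣ (index w))) (∣m⇒∣m*n w +m∣d)))
          where cancel : ∀ e lw v → (e + lw - v) - lw ≡ e - v
                cancel = solve-∀

      isTriangle : ∀ t → Face (X ↾ C) (vertexSet (label ∘ corners t))
      isTriangle t = face⇐ (_ , ∈vertexSet⁺ (label ∘ corners t) 0F) (index t , fits) , ⊆C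
        where
        fits : ∀ {v} → v ∈ vertexSet (label ∘ corners t) → ∃[ j ] ι (corner {k} (index t) (+ l) (+ l) j) ≡ v
        fits v∈ with ∈vertexSet⁻ (label ∘ corners t) v∈
        ... | j , eq = j , trans (cong ι (corner≡ t j)) eq
        ⊆C : vertexSet (label ∘ corners t) ⊆ C
        ⊆C v∈ with ∈vertexSet⁻ (label ∘ corners t) v∈
        ... | j , eq = subst (_∈ C) eq (label∈C (corners t j))

      -- Since the face lies in `C`, its base is congruent to `e` modulo `m`, hence is `e + l t`
      -- modulo `k` for some `t`.
      triangleOf : ∀ {σ} → Face (X ↾ C) σ → Σ[ t ∈ ℤ ] (∀ {x} → x ∈ σ → ∃[ j ] label (corners t j) ≡ x)
      triangleOf {σ} (σ∈X , σ⊆C) = t , λ x∈ → let j , eq = proj₂ fits x∈ in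
        j , trans (cong ι (sym (corner≡ t j))) (trans (corner-cong (index t) s (+ l) (+ l) j k∣) eq)
        where
        v = proj₁ (proj₁ (face⇒ σ∈X))
        v∈ = proj₂ (proj₁ (face⇒ σ∈X))
        fits = proj₂ (face⇒ σ∈X)
        s = proj₁ fits
        solved = solution e s (∣-swap e s (∣-chain e (+ toℕ v) s
          (Equivalence.to (component-mod m∣k X connected C-comp u∈C v) (σ⊆C v∈))
          (Fits⇒m∣base +m∣k +m∣d +m∣d fits v∈)))
        t = proj₁ solved
        k∣ = proj₂ solved

      component-homeomorphic : Homeomorphic (Realisation (X ↾ C)) MöbiusStrip
      component-homeomorphic = homeomorphic (atlas (möbiusCover (X ↾ C) isTriangle triangleOf
        (multiples≢0 k%6 (0<n<d⇒d∤n 1≤l l<k)) K period isPeriod (proj₁ K-odd) (proj₂ K-odd)))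

    collection : CollectionOf MöbiusStrip X
    collection C C-comp@((_ , u∈C) , _) = component-homeomorphic C-comp u∈C

  module TorusFamily {k : ℕ} .{{_ : NonZero k}} (k%6 : k ℕ.% 6 ≡ 1 ⊎ k ℕ.% 6 ≡ 5) (i : TorusIndex k) where

    open TorusIndex i
    open KuhnPlane using (corners)

    X : SimplicialComplex k
    X = S k i

    c : ℕ
    c = k ℕ.∸ l ℕ.∸ j

    0<j : 0 ℕ.< j
    0<j = ℕₚ.<-trans 1≤l l<j

    0<c : 0 ℕ.< c
    0<c = ℕₚ.<-trans 0<j j<

    l+j+c≡k : l ℕ.+ j ℕ.+ c ≡ k
    l+j+c≡k = trans (cong (l ℕ.+ j ℕ.+_) (ℕₚ.∸-+-assoc k l j)) (ℕₚ.m+[n∸m]≡n (ℕₚ.<⇒≤ l+j<k))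
      where
      l+j<k : l ℕ.+ j ℕ.< k
      l+j<k = ℕₚ.m∸n≢0⇒n<m (ℕₚ.>⇒≢ (subst (0 ℕ.<_) (ℕₚ.∸-+-assoc k l j) 0<c))

    +l+j+c≡k : + l + + j + + c ≡ + k
    +l+j+c≡k = cong +_ l+j+c≡k

    l<k : l ℕ.< k
    l<k = subst (l ℕ.<_) l+j+c≡k (ℕₚ.<-≤-trans (ℕₚ.m<m+n l 0<j) (ℕₚ.m≤m+n (l ℕ.+ j) c))

    j<k : j ℕ.< k
    j<k = subst (j ℕ.<_) l+j+c≡k (ℕₚ.<-≤-trans (ℕₚ.m<n+m j 1≤l) (ℕₚ.m≤m+n (l ℕ.+ j) c))

    c<k : c ℕ.< k
    c<k = subst (c ℕ.<_) l+j+c≡k (ℕₚ.m<n+m c (ℕₚ.<-≤-trans 1≤l (ℕₚ.m≤m+n l j)))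

    -- Rotating `(l : c : j)` to `(j : l : c)` shows the two cycles as the halves of a
    -- parallelogram: from the base one goes to `s + l + j` by `l` then `j`, or by `j` then `l`.
    -- These are the two types of triangles in the plane.
    face⇒ : ∀ {σ} → Face X σ → Nonempty σ × (Fits σ (+ l) (+ j) ⊎ Fits σ (+ j) (+ l))
    face⇒ (σ≠∅ , here fits) = σ≠∅ , inj₁ (⊆translate⇒Fits fits)
    face⇒ (σ≠∅ , there (here fits)) = σ≠∅ , inj₂
      (Fits-rotate (trans (cycle₂ (+ l) (+ j) (+ c)) +l+j+c≡k)
        (Fits-rotate (trans (cycle₁ (+ l) (+ j) (+ c)) +l+j+c≡k) (⊆translate⇒Fits fits)))
      where
      cycle₁ : ∀ l j c → l + c + j ≡ l + j + c
      cycle₁ = solve-∀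
      cycle₂ : ∀ l j c → c + j + l ≡ l + j + c
      cycle₂ = solve-∀

    face⇐ : ∀ {σ} → Nonempty σ → Fits σ (+ l) (+ j) ⊎ Fits σ (+ j) (+ l) → Face X σ
    face⇐ σ≠∅ (inj₁ fits) = σ≠∅ , here (Fits⇒⊆translate fits)
    face⇐ σ≠∅ (inj₂ fits) = σ≠∅ , there (here (Fits⇒⊆translate
      (Fits-rotate (trans (cycle₃ (+ l) (+ j) (+ c)) +l+j+c≡k) fits)))
      where
      cycle₃ : ∀ l j c → j + l + c ≡ l + j + c
      cycle₃ = solve-∀

    d : ℕ
    d = gcd l j

    instance
      d-nonZero : NonZero d
      d-nonZero = ℕ.≢-nonZero (gcd[m,n]≢0 l j (inj₁ (ℕₚ.>⇒≢ 1≤l)))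

    α β : ℤ
    α = + ℕ∣.quotient (gcd[m,n]∣m l j)
    β = + ℕ∣.quotient (gcd[m,n]∣n l j)

    dα≡l : + d * α ≡ + l
    dα≡l = trans (*-comm (+ d) α) (sym (trans (cong +_ (ℕ∣._∣_.equality (gcd[m,n]∣m l j))) (pos-* (ℕ∣.quotient (gcd[m,n]∣m l j)) d)))

    dβ≡j : + d * β ≡ + j
    dβ≡j = trans (*-comm (+ d) β) (sym (trans (cong +_ (ℕ∣._∣_.equality (gcd[m,n]∣n l j))) (pos-* (ℕ∣.quotient (gcd[m,n]∣n l j)) d)))

    u v : ℤ
    u = proj₁ (bézout l j)
    v = proj₁ (proj₂ (bézout l j))

    unimodular : u * α + v * β ≡ 1ℤ
    unimodular = *-cancelˡ-≡ (+ d) (u * α + v * β) 1ℤ (begin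
      + d * (u * α + v * β)            ≡⟨ regroup (+ d) u v α β ⟩
      u * (+ d * α) + v * (+ d * β)    ≡⟨ cong₂ (λ x y → u * x + v * y) dα≡l dβ≡j ⟩
      u * + l + v * + j                ≡⟨ proj₂ (proj₂ (bézout l j)) ⟩
      + d                              ≡⟨ *-identityʳ (+ d) ⟨
      + d * 1ℤ                         ∎)
      where
      open ≡-Reasoning
      regroup : ∀ d u v α β → d * (u * α + v * β) ≡ u * (d * α) + v * (d * β)
      regroup = solve-∀

    open Congruence d k

    m∣l : + m ∣ + l
    m∣l = ∣-trans +m∣d (∣-ℕ (gcd[m,n]∣m l j))

    m∣j : + m ∣ + j
    m∣j = ∣-trans +m∣d (∣-ℕ (gcd[m,n]∣n l j))

    connected : ∀ u v → Connected X u v ⇔ + m ∣ + toℕ u - + toℕ v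
    connected = connected⇔m∣ X +m∣k face⇒′ (λ σ≠∅ fits → face⇐ σ≠∅ (inj₁ fits)) spans′
      where
      face⇒′ : ∀ {σ} → Face X σ → Σ[ a ∈ ℤ ] Σ[ b ∈ ℤ ] ((+ m ∣ a) × (+ m ∣ b) × Fits σ a b)
      face⇒′ σ∈X with face⇒ σ∈X
      ... | _ , inj₁ fits = + l , + j , m∣l , m∣j , fits
      ... | _ , inj₂ fits = + j , + l , m∣j , m∣l , fits
      spans′ : Σ[ x ∈ ℤ ] Σ[ y ∈ ℤ ] Σ[ z ∈ ℤ ] x * + l + y * + j + z * + k ≡ + m
      spans′ with spans
      ... | x , z , eq = x * u , x * v , z , (begin
        x * u * + l + x * v * + j + z * + k  ≡⟨ regroup x z u v (+ l) (+ j) (+ k) ⟩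
        x * (u * + l + v * + j) + z * + k    ≡⟨ cong (λ d → x * d + z * + k) (proj₂ (proj₂ (bézout l j))) ⟩
        x * + d + z * + k                    ≡⟨ eq ⟩
        + m                                  ∎)
        where
        open ≡-Reasoning
        regroup : ∀ x z u v l j k → x * u * l + x * v * j + z * k ≡ x * (u * l + v * j) + z * k
        regroup = solve-∀

    components : HasComponents X m
    components = hasComponents m∣k X connected

    size : ∀ C → IsComponent X C → cardinality C ℕ.* m ≡ k
    size = component-size m∣k X connected

    -- The strict inequalities 0 < l < j < c < k enter here: they make the gaps and their
    -- differences nonzero modulo `k`.
    nondegenerate : ∀ a b → Hexagon 2 a b → + k ∣ + d * (α * a + β * b) → a ≡ 0ℤ × b ≡ 0ℤ
    nondegenerate a b hex k∣ = combinations≢0 k%6 +l+j+c≡k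
      (0<n<d⇒d∤n 1≤l l<k) (0<n<d⇒d∤n 0<j j<k) (0<n<d⇒d∤n 0<c c<k)
      (difference l<j j<k) (difference (ℕₚ.<-trans l<j j<) c<k) (difference j< c<k)
      a b hex (∣-resp (trans (regroup (+ d) α β a b) (cong₂ (λ x y → x * a + y * b) dα≡l dβ≡j)) k∣)
      where
      regroup : ∀ d α β a b → d * (α * a + β * b) ≡ d * α * a + d * β * b
      regroup = solve-∀
      difference : ∀ {a b} → a ℕ.< b → b ℕ.< k → ¬ + k ∣ + b - + a
      difference {a} {b} a<b b<k = subst (λ z → ¬ + k ∣ z) (+-∸ (ℕₚ.<⇒≤ a<b))
        (0<n<d⇒d∤n (ℕₚ.m<n⇒0<n∸m a<b) (ℕₚ.≤-<-trans (ℕₚ.m∸n≤m b a) b<k))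

    module _ {C : Subset k} {o : Fin k} (C-comp : IsComponent X C) (o∈C : o ∈ C) where

      e : ℤ
      e = + toℕ o

      open TorusLifting {k} e (+ d) α β

      private
        side : Fin 2 → ℤ × ℤ
        side 0F = + l , + j
        side 1F = + j , + l

        corner≡ : ∀ t n → let a , b = side (proj₁ t) in
                  corner {k} (index (proj₂ t)) a b n ≡ index (corners t n)
        corner≡ (0F , (p , q)) 0F = cong₂ (λ p q → index (p , q)) (sym (+-identityʳ p)) (sym (+-identityʳ q))
        corner≡ (1F , (p , q)) 0F = cong₂ (λ p q → index (p , q)) (sym (+-identityʳ p)) (sym (+-identityʳ q))
        corner≡ (0F , (p , q)) 1F = trans (cong (λ x → index (p , q) + x) (sym dα≡l)) (lemma e (+ d) α β p q)
          where lemma : ∀ e d α β p q → e + d * (α * p + β * q) + d * α ≡ e + d * (α * (p + 1ℤ) + β * (q + 0ℤ))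
                lemma = solve-∀
        corner≡ (1F , (p , q)) 1F = trans (cong (λ x → index (p , q) + x) (sym dβ≡j)) (lemma e (+ d) α β p q)
          where lemma : ∀ e d α β p q → e + d * (α * p + β * q) + d * β ≡ e + d * (α * (p + 0ℤ) + β * (q + 1ℤ))
                lemma = solve-∀
        corner≡ (0F , (p , q)) 2F = trans (cong₂ (λ x y → index (p , q) + x + y) (sym dα≡l) (sym dβ≡j)) (lemma e (+ d) α β p q)
          where lemma : ∀ e d α β p q → e + d * (α * p + β * q) + d * α + d * β ≡ e + d * (α * (p + 1ℤ) + β * (q + 1ℤ))
                lemma = solve-∀
        corner≡ (1F , (p , q)) 2F = trans (cong₂ (λ x y → index (p , q) + x + y) (sym dβ≡j) (sym dα≡l)) (lemma e (+ d) α β p q)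
          where lemma : ∀ e d α β p q → e + d * (α * p + β * q) + d * β + d * α ≡ e + d * (α * (p + 1ℤ) + β * (q + 1ℤ))
                lemma = solve-∀

        label∈C : ∀ w → label w ∈ C
        label∈C w@(p , q) = Equivalence.from (component-mod m∣k X connected C-comp o∈C (label w))
          (∣-resp (cancel e (+ d * (α * p + β * q)) (+ toℕ (label w)))
            (∣m∣n⇒∣m-n (∣-trans +m∣k (ι-toℕ-∣ (index w))) (∣m⇒∣m*n (α * p + β * q) +m∣d)))
          where cancel : ∀ e lw v → (e + lw - v) - lw ≡ e - v
                cancel = solve-∀

        side-fits : ∀ τ {σ} → (let a , b = side τ in Fits σ a b) → Fits σ (+ l) (+ j) ⊎ Fits σ (+ j) (+ l)
        side-fits 0F = inj₁
        side-fits 1F = inj₂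

      isTriangle : ∀ t → Face (X ↾ C) (vertexSet (label ∘ corners t))
      isTriangle t@(τ , w) = face⇐ (_ , ∈vertexSet⁺ (label ∘ corners t) 0F) (side-fits τ (index w , fits)) , ⊆C
        where
        fits : ∀ {v} → v ∈ vertexSet (label ∘ corners t) →
               ∃[ n ] ι (corner {k} (index w) (proj₁ (side τ)) (proj₂ (side τ)) n) ≡ v
        fits v∈ with ∈vertexSet⁻ (label ∘ corners t) v∈
        ... | n , eq = n , trans (cong ι (corner≡ t n)) eq
        ⊆C : vertexSet (label ∘ corners t) ⊆ C
        ⊆C v∈ with ∈vertexSet⁻ (label ∘ corners t) v∈
        ... | n , eq = subst (_∈ C) eq (label∈C (corners t n))

      private
        side-m∣ : ∀ τ → (+ m ∣ proj₁ (side τ)) × (+ m ∣ proj₂ (side τ))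
        side-m∣ 0F = m∣l , m∣j
        side-m∣ 1F = m∣j , m∣l

        triangle : ∀ {σ} τ → Fits σ (proj₁ (side τ)) (proj₂ (side τ)) → Nonempty σ → σ ⊆ C →
                   Σ[ t ∈ Cell ] (∀ {x} → x ∈ σ → ∃[ n ] label (corners t n) ≡ x)
        triangle {σ} τ fits (x , x∈) σ⊆C = (τ , p,q) , λ y∈ → let n , eq = proj₂ fits y∈ in
          n , trans (cong ι (sym (corner≡ (τ , p,q) n))) (trans (corner-cong (index p,q) s a b n k∣) eq)
          where
          a = proj₁ (side τ)
          b = proj₂ (side τ)
          s = proj₁ fits
          solved = solution e s (∣-swap e s (∣-chain e (+ toℕ x) s
            (Equivalence.to (component-mod m∣k X connected C-comp o∈C x) (σ⊆C x∈))
            (Fits⇒m∣base +m∣k (proj₁ (side-m∣ τ)) (proj₂ (side-m∣ τ)) fits x∈)))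
          w = proj₁ solved
          -- By `unimodular` this lattice point satisfies `α p + β q = w`.
          p,q : Lattice
          p,q = u * w , v * w
          expand : ∀ α β u v w → α * (u * w) + β * (v * w) ≡ (u * α + v * β) * w
          expand = solve-∀
          k∣ : + k ∣ index p,q - s
          k∣ = subst (λ x → + k ∣ e + + d * x - s)
            (sym (trans (expand α β u v w) (trans (cong (_* w) unimodular) (*-identityˡ w)))) (proj₂ solved)

      triangleOf : ∀ {σ} → Face (X ↾ C) σ → Σ[ t ∈ Cell ] (∀ {x} → x ∈ σ → ∃[ n ] label (corners t n) ≡ x)
      triangleOf (σ∈X , σ⊆C) with face⇒ σ∈X
      ... | σ≠∅ , inj₁ fits = triangle 0F fits σ≠∅ σ⊆C
      ... | σ≠∅ , inj₂ fits = triangle 1F fits σ≠∅ σ⊆C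

      component-homeomorphic : Homeomorphic (Realisation (X ↾ C)) Torus
      component-homeomorphic = homeomorphic (atlas
        (torusCover (X ↾ C) isTriangle triangleOf nondegenerate K period isPeriod u v unimodular))

    collection : CollectionOf Torus X
    collection C C-comp@((_ , o∈C) , _) = component-homeomorphic C-comp o∈C

-- Counting the members of the two families.

module Indices where

  open import Defs
  open import Data.Nat.Base
  open import Data.Nat.Properties
  open import Data.Nat.DivMod using (_%_; _/_; m≡m%n+[m/n]*n; m*n/n≡m; /-monoˡ-≤)
  open import Data.Nat.Tactic.RingSolver using (solve-∀)
  open import Data.Fin.Base using (fromℕ<)
  open import Data.Sum.Function.Propositional using (_⊎-↔_)
  open import Function.Bundles using (mk↔ₛ′)
  open import Function.Properties.Inverse using (↔-sym; ↔-trans)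

  möbiusIndex-≡ : ∀ {k} {i i′ : MöbiusIndex k} → MöbiusIndex.l i ≡ MöbiusIndex.l i′ → i ≡ i′
  möbiusIndex-≡ {i = möbiusIndex l p q} {möbiusIndex .l p′ q′} refl =
    cong₂ (möbiusIndex l) (≤-irrelevant p p′) (≤-irrelevant q q′)

  torusIndex-≡ : ∀ {k} {i i′ : TorusIndex k} →
                 TorusIndex.l i ≡ TorusIndex.l i′ → TorusIndex.j i ≡ TorusIndex.j i′ → i ≡ i′
  torusIndex-≡ {i = torusIndex l j p q r} {torusIndex .l .j p′ q′ r′} refl refl =
    trans (cong₂ (λ p q → torusIndex l j p q r) (≤-irrelevant p p′) (≤-irrelevant q q′))
          (cong (torusIndex l j p′ q′) (≤-irrelevant r r′))

  möbius↔ : ∀ k → MöbiusIndex k ↔ Fin ((k ∸ 1) / 2)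
  möbius↔ k = mk↔ₛ′ to from
    (λ i → Finₚ.fromℕ<-toℕ i (Finₚ.toℕ<n i))
    λ { (möbiusIndex (suc l) _ l<) → möbiusIndex-≡ (cong suc (Finₚ.toℕ-fromℕ< l<)) }
    where
    to : MöbiusIndex k → Fin ((k ∸ 1) / 2)
    to (möbiusIndex (suc l) _ l<) = fromℕ< l<
    from : Fin ((k ∸ 1) / 2) → MöbiusIndex k
    from i = möbiusIndex (suc (toℕ i)) (s≤s z≤n) (Finₚ.toℕ<n i)

  2*half+1 : ∀ {k} → k % 6 ≡ 1 ⊎ k % 6 ≡ 5 → 2 * ((k ∸ 1) / 2) + 1 ≡ k
  2*half+1 {k} k%6 with k / 6 in quot | k%6
  ... | q | inj₁ eq = begin
    2 * ((k ∸ 1) / 2) + 1          ≡⟨ cong (λ k → 2 * ((k ∸ 1) / 2) + 1) k≡ ⟩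
    2 * (q * 6 / 2) + 1            ≡⟨ cong (λ x → 2 * (x / 2) + 1) (lemma q) ⟩
    2 * (q * 3 * 2 / 2) + 1        ≡⟨ cong (λ x → 2 * x + 1) (m*n/n≡m (q * 3) 2) ⟩
    2 * (q * 3) + 1                ≡⟨ lemma′ q ⟩
    1 + q * 6                      ≡⟨ k≡ ⟨
    k                              ∎
    where
    open ≡-Reasoning
    k≡ : k ≡ 1 + q * 6
    k≡ = trans (m≡m%n+[m/n]*n k 6) (cong₂ (λ r q → r + q * 6) eq quot)
    lemma : ∀ q → q * 6 ≡ q * 3 * 2
    lemma = solve-∀
    lemma′ : ∀ q → 2 * (q * 3) + 1 ≡ 1 + q * 6
    lemma′ = solve-∀
  ... | q | inj₂ eq = begin
    2 * ((k ∸ 1) / 2) + 1          ≡⟨ cong (λ k → 2 * ((k ∸ 1) / 2) + 1) k≡ ⟩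
    2 * ((4 + q * 6) / 2) + 1      ≡⟨ cong (λ x → 2 * (x / 2) + 1) (lemma q) ⟩
    2 * ((2 + q * 3) * 2 / 2) + 1  ≡⟨ cong (λ x → 2 * x + 1) (m*n/n≡m (2 + q * 3) 2) ⟩
    2 * (2 + q * 3) + 1            ≡⟨ lemma′ q ⟩
    5 + q * 6                      ≡⟨ k≡ ⟨
    k                              ∎
    where
    open ≡-Reasoning
    k≡ : k ≡ 5 + q * 6
    k≡ = trans (m≡m%n+[m/n]*n k 6) (cong₂ (λ r q → r + q * 6) eq quot)
    lemma : ∀ q → 4 + q * 6 ≡ (2 + q * 3) * 2
    lemma = solve-∀
    lemma′ : ∀ q → 2 * (2 + q * 3) + 1 ≡ 5 + q * 6
    lemma′ = solve-∀

  2*m<k⇒m≤half : ∀ {m k} → 2 * m < k → m ≤ (k ∸ 1) / 2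
  2*m<k⇒m≤half {m} {suc k} (s≤s 2m≤k) = subst (_≤ k / 2) (m*n/n≡m m 2)
    (/-monoˡ-≤ 2 (subst (_≤ k) (*-comm 2 m) 2m≤k))

  -- Frees the condition `j < c` from truncated subtraction. In the form l + 2j < k it is plain that
  -- adding 2 to `l` and `j` corresponds to adding 6 to `k`.
  <∸∸⇒+< : ∀ {l j k} → j < k ∸ l ∸ j → l + (j + j) < k
  <∸∸⇒+< {l} {j} {k} j< = subst (_≤ k) (regroup l j)
    (m≤o∸n⇒m+n≤o (suc j) (<⇒≤ l+j<k) j<′)
    where
    j<′ : j < k ∸ (l + j)
    j<′ = subst (j <_) (∸-+-assoc k l j) j<
    l+j<k : l + j < k
    l+j<k = m∸n≢0⇒n<m (>⇒≢ (≤-<-trans z≤n j<′))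
    regroup : ∀ l j → suc j + (l + j) ≡ suc (l + (j + j))
    regroup = solve-∀

  +<⇒<∸∸ : ∀ {l j k} → l + (j + j) < k → j < k ∸ l ∸ j
  +<⇒<∸∸ {l} {j} {k} lt = subst (j <_) (sym (∸-+-assoc k l j))
    (m+n≤o⇒m≤o∸n (suc j) (subst (_≤ k) (regroup l j) lt))
    where
    regroup : ∀ l j → suc (l + (j + j)) ≡ suc j + (l + j)
    regroup = solve-∀

  n+n-cancel-< : ∀ {m n} → m + m < n + n → m < n
  n+n-cancel-< {m} {n} lt = ≰⇒> λ n≤m → <⇒≱ lt (+-mono-≤ n≤m n≤m)

  -- The indices with l ≥ 3 arise from those for k by adding 2 to l and j; there
  -- are h + 1 indices with l = 1 and h with l = 2.

  module _ (h : ℕ) where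
    private
      k = suc (h + h)

      index₁ : ∀ j → j < suc h → TorusIndex (6 + k)
      index₁ j (s≤s j≤h) = torusIndex 1 (2 + j) (s≤s z≤n) (s≤s (s≤s z≤n))
        (+<⇒<∸∸ {1} {2 + j} (subst (_≤ 6 + k) (regroup j) (+-monoʳ-≤ 6 (m≤n⇒m≤1+n (+-mono-≤ j≤h j≤h)))))
        where regroup : ∀ j → 6 + (j + j) ≡ suc (1 + (2 + j + (2 + j)))
              regroup = solve-∀

      index₂ : ∀ j → j < h → TorusIndex (6 + k)
      index₂ j j<h = torusIndex 2 (3 + j) (s≤s z≤n) (s≤s (s≤s (s≤s z≤n)))
        (+<⇒<∸∸ {2} {3 + j} (subst (_≤ 6 + k) (regroup j) (+-monoʳ-≤ 7 (+-mono-≤ j<h j<h))))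
        where regroup : ∀ j → 7 + (suc j + suc j) ≡ suc (2 + (3 + j + (3 + j)))
              regroup = solve-∀

      regroup₃ : ∀ l j → 6 + suc (l + (j + j)) ≡ suc (2 + l + (2 + j + (2 + j)))
      regroup₃ = solve-∀

      index₃ : TorusIndex k → TorusIndex (6 + k)
      index₃ (torusIndex l j 1≤l l<j j<) = torusIndex (2 + l) (2 + j) (s≤s z≤n) (s≤s (s≤s l<j))
        (+<⇒<∸∸ {2 + l} {2 + j} (subst (_≤ 6 + k) (regroup₃ l j) (+-monoʳ-≤ 6 (<∸∸⇒+< {l} {j} j<))))

      bound₁ : ∀ j → 2 + j < 6 + k ∸ 1 ∸ (2 + j) → j < suc h
      bound₁ j j< = n+n-cancel-< (+-cancelˡ-< 5 _ _ (subst₂ _<_ (left j) (right h) (<∸∸⇒+< {1} {2 + j} {6 + k} j<)))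
        where
        left : ∀ j → 1 + (2 + j + (2 + j)) ≡ 5 + (j + j)
        left = solve-∀
        right : ∀ h → 6 + suc (h + h) ≡ 5 + (suc h + suc h)
        right = solve-∀

      bound₂ : ∀ j → 3 + j < 6 + k ∸ 2 ∸ (3 + j) → j < h
      bound₂ j j< = n+n-cancel-< (≤-trans (n≤1+n _)
        (+-cancelˡ-≤ 7 _ _ (subst (_≤ 7 + (h + h)) (left j) (<∸∸⇒+< {2} {3 + j} {6 + k} j<))))
        where
        left : ∀ j → suc (2 + (3 + j + (3 + j))) ≡ 7 + suc (suc (j + j))
        left = solve-∀

      to : TorusIndex (6 + k) → (Fin (suc h) ⊎ Fin h) ⊎ TorusIndex k
      to (torusIndex 1 (suc (suc j)) _ _ j<) = inj₁ (inj₁ (fromℕ< (bound₁ j j<)))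
      to (torusIndex 1 1 _ (s≤s ()) _)
      to (torusIndex 2 (suc (suc (suc j))) _ _ j<) = inj₁ (inj₂ (fromℕ< (bound₂ j j<)))
      to (torusIndex 2 1 _ (s≤s ()) _)
      to (torusIndex 2 2 _ (s≤s (s≤s ())) _)
      to (torusIndex (suc (suc (suc l))) (suc (suc j)) _ (s≤s (s≤s l<j)) j<) = inj₂
        (torusIndex (suc l) j (s≤s z≤n) l<j (+<⇒<∸∸ {suc l} {j} (+-cancelˡ-≤ 6 _ _
          (subst (_≤ 6 + k) (sym (regroup₃ (suc l) j)) (<∸∸⇒+< {3 + l} {2 + j} {6 + k} j<)))))
      to (torusIndex (suc (suc (suc l))) 1 _ (s≤s ()) _)

      from : (Fin (suc h) ⊎ Fin h) ⊎ TorusIndex k → TorusIndex (6 + k)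
      from (inj₁ (inj₁ i)) = index₁ (toℕ i) (Finₚ.toℕ<n i)
      from (inj₁ (inj₂ i)) = index₂ (toℕ i) (Finₚ.toℕ<n i)
      from (inj₂ i) = index₃ i

      l-index₁ : ∀ j p → TorusIndex.l (index₁ j p) ≡ 1
      l-index₁ j (s≤s p) = refl

      j-index₁ : ∀ j p → TorusIndex.j (index₁ j p) ≡ 2 + j
      j-index₁ j (s≤s p) = refl

      to∘index₁ : ∀ j p → to (index₁ j p) ≡ inj₁ (inj₁ (fromℕ< p))
      to∘index₁ j (s≤s p) = refl

      to∘from : ∀ i → to (from i) ≡ i
      to∘from (inj₁ (inj₁ i)) = trans (to∘index₁ (toℕ i) (Finₚ.toℕ<n i)) (cong (λ x → inj₁ (inj₁ x)) (Finₚ.fromℕ<-toℕ i (Finₚ.toℕ<n i)))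
      to∘from (inj₁ (inj₂ i)) = cong (λ x → inj₁ (inj₂ x)) (Finₚ.fromℕ<-toℕ i _)
      to∘from (inj₂ (torusIndex (suc l) (suc j) _ _ _)) = cong inj₂ (torusIndex-≡ refl refl)

      from∘to : ∀ i → from (to i) ≡ i
      from∘to (torusIndex 1 (suc (suc j)) _ _ j<) = torusIndex-≡
        (l-index₁ _ (Finₚ.toℕ<n (fromℕ< (bound₁ j j<))))
        (trans (j-index₁ _ (Finₚ.toℕ<n (fromℕ< (bound₁ j j<)))) (cong (2 +_) (Finₚ.toℕ-fromℕ< (bound₁ j j<))))
      from∘to (torusIndex 1 1 _ (s≤s ()) _)
      from∘to (torusIndex 2 (suc (suc (suc j))) _ _ j<) = torusIndex-≡ refl (cong (3 +_) (Finₚ.toℕ-fromℕ< (bound₂ j j<)))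
      from∘to (torusIndex 2 1 _ (s≤s ()) _)
      from∘to (torusIndex 2 2 _ (s≤s (s≤s ())) _)
      from∘to (torusIndex (suc (suc (suc l))) (suc (suc j)) _ (s≤s (s≤s l<j)) j<) = torusIndex-≡ refl refl
      from∘to (torusIndex (suc (suc (suc l))) 1 _ (s≤s ()) _)

    torus-step : ∀ {N} → TorusIndex (suc (h + h)) ↔ Fin N → TorusIndex (6 + suc (h + h)) ↔ Fin (suc (h + h) + N)
    torus-step iso = ↔-trans (mk↔ₛ′ to from to∘from from∘to)
      (↔-trans (↔-sym (Finₚ.+↔⊎ {suc h} {h}) ⊎-↔ iso) (↔-sym Finₚ.+↔⊎))

  -- From `1 ≤ l` and `2 ≤ j` the sum l + 2j is at least 5. This covers both initial cases, 1 and 5,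
  -- of the recursion.
  ¬torus : ∀ {k} → k ≤ 5 → ¬ TorusIndex k
  ¬torus {k} k≤5 (torusIndex l j 1≤l l<j j<) = <⇒≱ (<∸∸⇒+< {l} {j} {k} j<)
    (≤-trans k≤5 (+-mono-≤ 1≤l (+-mono-≤ 2≤j 2≤j)))
    where 2≤j = ≤-trans (s≤s 1≤l) l<j

  torus-none : ∀ {k} → k ≤ 5 → TorusIndex k ↔ Fin 0
  torus-none k≤5 = mk↔ₛ′ (λ i → contradiction i (¬torus k≤5)) (λ ()) (λ ()) (λ i → contradiction i (¬torus k≤5))

  private
    -- The equation is N = (k² - 6k + 5) / 12, rearranged to contain neither division nor
    -- subtraction.
    TorusCount : ℕ → Set
    TorusCount k = ∃[ N ] (12 * N + 6 * k ≡ k * k + 5 × (TorusIndex k ↔ Fin N))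

    -- With `k = 2 h + 1`, the new indices number (h + 1) + h = k, and k² - 6k grows by 12k when `k`
    -- grows by 6.
    count-step : ∀ {k} h → k ≡ suc (h + h) → TorusCount k → TorusCount (6 + k)
    count-step {k} h refl (N , eq , iso) = k + N , count , torus-step h iso
      where
      expand : ∀ k N → 12 * (k + N) + 6 * (6 + k) ≡ (12 * N + 6 * k) + (12 * k + 36)
      expand = solve-∀
      collect : ∀ k → (k * k + 5) + (12 * k + 36) ≡ (6 + k) * (6 + k) + 5
      collect = solve-∀
      count : 12 * (k + N) + 6 * (6 + k) ≡ (6 + k) * (6 + k) + 5
      count = trans (expand k N) (trans (cong (_+ (12 * k + 36)) eq) (collect k))

    count₁ : ∀ q → TorusCount (1 + q * 6)
    count₁ zero    = 0 , refl , torus-none (s≤s z≤n)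
    count₁ (suc q) = subst TorusCount (regroup q) (count-step (q * 3) (odd q) (count₁ q))
      where
      regroup : ∀ q → 6 + (1 + q * 6) ≡ 1 + suc q * 6
      regroup = solve-∀
      odd : ∀ q → 1 + q * 6 ≡ suc (q * 3 + q * 3)
      odd = solve-∀

    count₅ : ∀ q → TorusCount (5 + q * 6)
    count₅ zero    = 0 , refl , torus-none ≤-refl
    count₅ (suc q) = subst TorusCount (regroup q) (count-step (2 + q * 3) (odd q) (count₅ q))
      where
      regroup : ∀ q → 6 + (5 + q * 6) ≡ 5 + suc q * 6
      regroup = solve-∀
      odd : ∀ q → 5 + q * 6 ≡ suc (2 + q * 3 + (2 + q * 3))
      odd = solve-∀

  torus-count : ∀ {k} → k % 6 ≡ 1 ⊎ k % 6 ≡ 5 →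
                ∃[ N ] (12 * N + 6 * k ≡ k * k + 5 × (TorusIndex k ↔ Fin N))
  torus-count {k} (inj₁ eq) = subst TorusCount
    (sym (trans (m≡m%n+[m/n]*n k 6) (cong (_+ k / 6 * 6) eq))) (count₁ (k / 6))
  torus-count {k} (inj₂ eq) = subst TorusCount
    (sym (trans (m≡m%n+[m/n]*n k 6) (cong (_+ k / 6 * 6) eq))) (count₅ (k / 6))

-- Each triangle lies in exactly one member of the families.

module Decomposition where

  open import Defs hiding (positive)
  open Atlases using (vertexSet; ∈vertexSet⁺)
  open Residues
  open Families using (module MöbiusFamily; module TorusFamily)
  open Indices
  open import Data.Nat.Base using (zero; suc; NonZero; _+_; _∸_; _*_; _<_; _≤_; s≤s; z≤n)
  open import Data.Nat.Properties
  open import Data.Nat.DivMod using (_%_; m/n*n≤m)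
  open import Data.Integer.Base as ℤ using (ℤ)
  import Data.Integer.Properties as ℤₚ
  open import Data.Integer.Divisibility.Signed using (_∣_; ∣m∣n⇒∣m-n)
  open import Data.Integer.Tactic.RingSolver using (solve-∀)
  import Data.Nat.Tactic.RingSolver as ℕSolver
  open import Data.Fin.Base using (zero; suc; fromℕ<)
  open import Data.Fin.Subset using (Subset; _∈_; _⊆_; Nonempty; ⁅_⁆; _∪_; ∣_∣; inside; outside)
  open import Data.Fin.Subset.Properties using (∣⁅x⁆∣≡1; p⊆q⇒∣p∣≤∣q∣)
  open import Data.Vec.Base using ([]; _∷_; here; there)
  open import Data.Sum.Base as Sum using ([_,_])
  open import Relation.Binary.Definitions using (Tri; tri<; tri≈; tri>)

  private
    variable
      n : ℕ

  ∣p∪q∣≤∣p∣+∣q∣ : ∀ (p q : Subset n) → ∣ p ∪ q ∣ ≤ ∣ p ∣ + ∣ q ∣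
  ∣p∪q∣≤∣p∣+∣q∣ []            []            = z≤n
  ∣p∪q∣≤∣p∣+∣q∣ (outside ∷ p) (outside ∷ q) = ∣p∪q∣≤∣p∣+∣q∣ p q
  ∣p∪q∣≤∣p∣+∣q∣ (outside ∷ p) (inside ∷ q)  = subst (suc ∣ p ∪ q ∣ ≤_) (sym (+-suc ∣ p ∣ ∣ q ∣)) (s≤s (∣p∪q∣≤∣p∣+∣q∣ p q))
  ∣p∪q∣≤∣p∣+∣q∣ (inside ∷ p)  (outside ∷ q) = s≤s (∣p∪q∣≤∣p∣+∣q∣ p q)
  ∣p∪q∣≤∣p∣+∣q∣ (inside ∷ p)  (inside ∷ q)  = s≤s (≤-trans (∣p∪q∣≤∣p∣+∣q∣ p q) (+-monoʳ-≤ ∣ p ∣ (n≤1+n ∣ q ∣)))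

  ∣vertexSet∣≤3 : ∀ (V : Fin 3 → Fin n) → ∣ vertexSet V ∣ ≤ 3
  ∣vertexSet∣≤3 V = ≤-trans (∣p∪q∣≤∣p∣+∣q∣ ⁅ V 0F ⁆ _) (+-mono-≤ (≤-reflexive (∣⁅x⁆∣≡1 (V 0F)))
    (≤-trans (∣p∪q∣≤∣p∣+∣q∣ ⁅ V 1F ⁆ ⁅ V 2F ⁆) (+-mono-≤ (≤-reflexive (∣⁅x⁆∣≡1 (V 1F))) (≤-reflexive (∣⁅x⁆∣≡1 (V 2F))))))

  -- Removing the least element three times lists a triangle in increasing order, so that its gaps
  -- are differences of natural numbers.
  split-min : ∀ {r} (σ : Subset n) → ∣ σ ∣ ≡ suc r → Σ[ u ∈ Fin n ] u ∈ σ × Σ[ τ ∈ Subset n ]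
    ∣ τ ∣ ≡ r × (∀ {x} → x ∈ τ → x ∈ σ × toℕ u < toℕ x) × (∀ {x} → x ∈ σ → x ≡ u ⊎ x ∈ τ)
  split-min (outside ∷ σ) eq =
    let u , u∈ , τ , ∣τ∣ , τ⊆ , σ⊆ = split-min σ eq in
    suc u , there u∈ , outside ∷ τ , ∣τ∣ ,
    (λ { (there x∈) → let x∈σ , u<x = τ⊆ x∈ in there x∈σ , s≤s u<x }) ,
    λ { (there x∈) → Sum.map (cong suc) there (σ⊆ x∈) }
  split-min (inside ∷ σ) eq = zero , here , outside ∷ σ , suc-injective eq ,
    (λ { (there x∈) → there x∈ , s≤s z≤n }) ,
    λ { here → inj₁ refl ; (there x∈) → inj₂ (there x∈) }

  ∣σ∣≡0⇒∉ : ∀ {σ : Subset n} {x} → ∣ σ ∣ ≡ 0 → ¬ x ∈ σ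
  ∣σ∣≡0⇒∉ {σ = inside ∷ σ}  ()
  ∣σ∣≡0⇒∉ {σ = outside ∷ σ} eq (there x∈) = ∣σ∣≡0⇒∉ eq x∈

  record SortedTriple (σ : Subset n) : Set where
    field
      u v w : Fin n
      u<v   : toℕ u < toℕ v
      v<w   : toℕ v < toℕ w
      u∈    : u ∈ σ
      v∈    : v ∈ σ
      w∈    : w ∈ σ
      σ⊆    : ∀ {x} → x ∈ σ → x ≡ u ⊎ x ≡ v ⊎ x ≡ w

  sortedTriple : ∀ (σ : Subset n) → ∣ σ ∣ ≡ 3 → SortedTriple σ
  sortedTriple σ eq =
    let u , u∈ , τ , ∣τ∣ , τ⊆ , σ⊆ = split-min σ eq
        v , v∈ , ρ , ∣ρ∣ , ρ⊆ , τ⊆′ = split-min τ ∣τ∣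
        w , w∈ , π , ∣π∣ , π⊆ , ρ⊆′ = split-min ρ ∣ρ∣
        v∈σ , u<v = τ⊆ v∈
        w∈τ , v<w = ρ⊆ w∈
    in record
      { u = u ; v = v ; w = w ; u<v = u<v ; v<w = v<w ; u∈ = u∈ ; v∈ = v∈σ ; w∈ = proj₁ (τ⊆ w∈τ)
      ; σ⊆ = λ x∈ → Sum.map₂ (λ x∈τ → Sum.map₂ (λ x∈ρ →
          [ (λ x≡w → x≡w) , (λ x∈π → contradiction x∈π (∣σ∣≡0⇒∉ ∣π∣)) ] (ρ⊆′ x∈ρ)) (τ⊆′ x∈τ)) (σ⊆ x∈)
      }

  -- (a : b : c) and (a′ : b′ : c′) are the same difference cycle.

  data _≈ᶜ_ : ℕ × ℕ × ℕ → ℕ × ℕ × ℕ → Set where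
    rot₀ : ∀ {a b c} → (a , b , c) ≈ᶜ (a , b , c)
    rot₁ : ∀ {a b c} → (a , b , c) ≈ᶜ (b , c , a)
    rot₂ : ∀ {a b c} → (a , b , c) ≈ᶜ (c , a , b)

  -- The cyclically adjacent pair `c`, `a` is included, which makes the property invariant under
  -- rotation; it separates the words of `M` from those of `S`.
  Adjacent-≡ : ℕ × ℕ × ℕ → Set
  Adjacent-≡ (a , b , c) = a ≡ b ⊎ b ≡ c ⊎ c ≡ a

  Adjacent-≡-resp : ∀ {s t} → s ≈ᶜ t → Adjacent-≡ s → Adjacent-≡ t
  Adjacent-≡-resp rot₀ adj = adj
  Adjacent-≡-resp rot₁ (inj₁ e) = inj₂ (inj₂ e)
  Adjacent-≡-resp rot₁ (inj₂ (inj₁ e)) = inj₁ e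
  Adjacent-≡-resp rot₁ (inj₂ (inj₂ e)) = inj₂ (inj₁ e)
  Adjacent-≡-resp rot₂ (inj₁ e) = inj₂ (inj₁ e)
  Adjacent-≡-resp rot₂ (inj₂ (inj₁ e)) = inj₂ (inj₂ e)
  Adjacent-≡-resp rot₂ (inj₂ (inj₂ e)) = inj₁ e

  ≈ᶜ-sym : ∀ {s t} → s ≈ᶜ t → t ≈ᶜ s
  ≈ᶜ-sym rot₀ = rot₀
  ≈ᶜ-sym rot₁ = rot₂
  ≈ᶜ-sym rot₂ = rot₁

  ≈ᶜ-trans : ∀ {s t r} → s ≈ᶜ t → t ≈ᶜ r → s ≈ᶜ r
  ≈ᶜ-trans rot₀ e = e
  ≈ᶜ-trans rot₁ rot₀ = rot₁
  ≈ᶜ-trans rot₁ rot₁ = rot₂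
  ≈ᶜ-trans rot₁ rot₂ = rot₀
  ≈ᶜ-trans rot₂ rot₀ = rot₂
  ≈ᶜ-trans rot₂ rot₁ = rot₀
  ≈ᶜ-trans rot₂ rot₂ = rot₁

  All₃ : (ℕ → Set) → ℕ × ℕ × ℕ → Set
  All₃ P (a , b , c) = P a × P b × P c

  All₃-resp : ∀ P {s t} → s ≈ᶜ t → All₃ P s → All₃ P t
  All₃-resp P rot₀ all = all
  All₃-resp P rot₁ (pa , pb , pc) = pb , pc , pa
  All₃-resp P rot₂ (pa , pb , pc) = pc , pa , pb

  module _ {k : ℕ} .{{_ : NonZero k}} where

    <-unique : ∀ {x y} → x < k → y < k → ℤ.+ k ∣ ℤ.+ x ℤ.- ℤ.+ y → x ≡ y
    <-unique {x} {y} x<k y<k k∣ = begin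
      x                          ≡⟨ Finₚ.toℕ-fromℕ< x<k ⟨
      toℕ (fromℕ< x<k) ≡⟨ cong toℕ (toℕ-unique _ _ (subst₂ (λ x y → ℤ.+ k ∣ ℤ.+ x ℤ.- ℤ.+ y)
                                      (sym (Finₚ.toℕ-fromℕ< x<k)) (sym (Finₚ.toℕ-fromℕ< y<k)) k∣)) ⟩
      toℕ (fromℕ< y<k) ≡⟨ Finₚ.toℕ-fromℕ< y<k ⟩
      y                          ∎
      where open ≡-Reasoning

    module _ {σ : Subset k} (t : SortedTriple σ) where
      open SortedTriple t

      gap₁ gap₂ gap₃ : ℕ
      gap₁ = toℕ v ∸ toℕ u
      gap₂ = toℕ w ∸ toℕ v
      gap₃ = k ∸ toℕ w + toℕ u

      u+gap₁ : toℕ u + gap₁ ≡ toℕ v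
      u+gap₁ = m+[n∸m]≡n (<⇒≤ u<v)

      v+gap₂ : toℕ v + gap₂ ≡ toℕ w
      v+gap₂ = m+[n∸m]≡n (<⇒≤ v<w)

      gaps-sum : gap₁ + gap₂ + gap₃ ≡ k
      gaps-sum = begin
        gap₁ + gap₂ + (k ∸ toℕ w + toℕ u)  ≡⟨ regroup gap₁ gap₂ (k ∸ toℕ w) (toℕ u) ⟩
        toℕ u + gap₁ + gap₂ + (k ∸ toℕ w)  ≡⟨ cong (λ x → x + gap₂ + (k ∸ toℕ w)) u+gap₁ ⟩
        toℕ v + gap₂ + (k ∸ toℕ w)         ≡⟨ cong (_+ (k ∸ toℕ w)) v+gap₂ ⟩
        toℕ w + (k ∸ toℕ w)                ≡⟨ m+[n∸m]≡n (<⇒≤ (Finₚ.toℕ<n w)) ⟩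
        k                                  ∎
        where
        open ≡-Reasoning
        regroup : ∀ a b c d → a + b + (c + d) ≡ d + a + b + c
        regroup = ℕSolver.solve-∀

      0<gap₁ : 0 < gap₁
      0<gap₁ = m<n⇒0<n∸m u<v

      0<gap₂ : 0 < gap₂
      0<gap₂ = m<n⇒0<n∸m v<w

      0<gap₃ : 0 < gap₃
      0<gap₃ = <-≤-trans (m<n⇒0<n∸m (Finₚ.toℕ<n w)) (m≤m+n (k ∸ toℕ w) (toℕ u))

      fits-gaps : Fits σ (ℤ.+ gap₁) (ℤ.+ gap₂)
      fits-gaps = ℤ.+ toℕ u , λ x∈ → member (σ⊆ x∈)
        where
        member : ∀ {x} → x ≡ u ⊎ x ≡ v ⊎ x ≡ w → ∃[ i ] ι (corner {k} (ℤ.+ toℕ u) (ℤ.+ gap₁) (ℤ.+ gap₂) i) ≡ x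
        member (inj₁ refl) = 0F , ι-toℕ u
        member (inj₂ (inj₁ refl)) = 1F , trans (cong (ι ∘ ℤ.+_) u+gap₁) (ι-toℕ v)
        member (inj₂ (inj₂ refl)) = 2F , trans (cong (ι ∘ ℤ.+_) (trans (cong (_+ gap₂) u+gap₁) v+gap₂)) (ι-toℕ w)

      -- The least vertex `u` is one of the three corners; a rotation makes it the base. The other
      -- corners are then at distances `a < a + b` below `k` from it, so they are `v` and `w` in
      -- this order.
      gaps-unique : ∀ {a b c} → 0 < a → 0 < b → 0 < c → a + b + c ≡ k → Fits σ (ℤ.+ a) (ℤ.+ b) →
                    (a , b , c) ≈ᶜ (gap₁ , gap₂ , gap₃)
      gaps-unique {a} {b} {c} 0<a 0<b 0<c sum fits = locate-u fits
        where
        anchored : ∀ {a b c} → 0 < a → 0 < b → 0 < c → a + b + c ≡ k → (fits : Fits σ (ℤ.+ a) (ℤ.+ b)) →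
                   ι (proj₁ fits) ≡ u → (a , b , c) ≡ (gap₁ , gap₂ , gap₃)
        anchored {a} {b} {c} 0<a 0<b 0<c sum (s , fits) base = conclude (fits v∈) (fits w∈)
          where
          a<k : a < k
          a<k = subst (a <_) sum (<-≤-trans (m<m+n a 0<b) (m≤m+n (a + b) c))
          a+b<k : a + b < k
          a+b<k = subst (a + b <_) sum (m<m+n (a + b) 0<c)
          -- Both distances from `u` are below `k` and congruent modulo `k`, hence equal as natural
          -- numbers.
          offset : ∀ (x : Fin k) d → toℕ u ≤ toℕ x → d < k → ι (s ℤ.+ ℤ.+ d) ≡ x → d ≡ toℕ x ∸ toℕ u
          offset x d u≤x d<k eq = <-unique d<k (≤-<-trans (m∸n≤m (toℕ x) (toℕ u)) (Finₚ.toℕ<n x))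
            (subst (λ z → ℤ.+ k ∣ ℤ.+ d ℤ.- z) (trans (ℤₚ.m-n≡m⊖n (toℕ x) (toℕ u)) (ℤₚ.⊖-≥ u≤x))
              (∣-resp (regroup s (ℤ.+ d) (ℤ.+ toℕ x) (ℤ.+ toℕ u)) (∣m∣n⇒∣m-n
                (ι-injective (s ℤ.+ ℤ.+ d) (ℤ.+ toℕ x) (trans eq (sym (ι-toℕ x))))
                (ι-injective s (ℤ.+ toℕ u) (trans base (sym (ι-toℕ u)))))))
            where regroup : ∀ s d x u → s ℤ.+ d ℤ.- x ℤ.- (s ℤ.- u) ≡ d ℤ.- (x ℤ.- u)
                  regroup = solve-∀
          u<w = <-trans u<v v<w
          a+b-corner : ι (s ℤ.+ ℤ.+ a ℤ.+ ℤ.+ b) ≡ ι {k} (s ℤ.+ ℤ.+ (a + b))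
          a+b-corner = cong ι (ℤₚ.+-assoc s (ℤ.+ a) (ℤ.+ b))
          conclude : ∃[ i ] ι (corner {k} s (ℤ.+ a) (ℤ.+ b) i) ≡ v → ∃[ i ] ι (corner {k} s (ℤ.+ a) (ℤ.+ b) i) ≡ w →
                     (a , b , c) ≡ (gap₁ , gap₂ , gap₃)
          conclude (0F , e) _ = contradiction (cong toℕ (trans (sym base) e)) (<⇒≢ u<v)
          conclude (1F , _) (0F , e) = contradiction (cong toℕ (trans (sym base) e)) (<⇒≢ u<w)
          conclude (2F , _) (0F , e) = contradiction (cong toℕ (trans (sym base) e)) (<⇒≢ u<w)
          conclude (1F , e) (1F , e′) = contradiction (cong toℕ (trans (sym e) e′)) (<⇒≢ v<w)
          conclude (2F , e) (2F , e′) = contradiction (cong toℕ (trans (sym e) e′)) (<⇒≢ v<w)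
          -- Here `a` would be the distance from `u` to `w` and `a + b` that from `u` to `v`,
          -- against `v < w`.
          conclude (2F , e) (1F , e′) = contradiction
            (subst₂ _≤_ (offset w a (<⇒≤ u<w) a<k e′) (offset v (a + b) (<⇒≤ u<v) a+b<k (trans (sym a+b-corner) e)) (m≤m+n a b))
            (<⇒≱ (∸-monoˡ-< v<w (<⇒≤ u<v)))
          conclude (1F , e) (2F , e′) = cong₂ _,_ a≡ (cong₂ _,_ b≡ c≡)
            where
            a≡ : a ≡ gap₁
            a≡ = offset v a (<⇒≤ u<v) a<k e
            b≡ : b ≡ gap₂
            b≡ = +-cancelˡ-≡ (toℕ u + a) b gap₂ (begin
              toℕ u + a + b                ≡⟨ +-assoc (toℕ u) a b ⟩
              toℕ u + (a + b)              ≡⟨ cong (toℕ u +_) (offset w (a + b) (<⇒≤ u<w) a+b<k (trans (sym a+b-corner) e′)) ⟩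
              toℕ u + (toℕ w ∸ toℕ u)      ≡⟨ m+[n∸m]≡n (<⇒≤ u<w) ⟩
              toℕ w                        ≡⟨ v+gap₂ ⟨
              toℕ v + gap₂                 ≡⟨ cong (_+ gap₂) (trans (cong (toℕ u +_) a≡) u+gap₁) ⟨
              toℕ u + a + gap₂             ∎)
              where open ≡-Reasoning
            c≡ : c ≡ gap₃
            c≡ = +-cancelˡ-≡ (a + b) c gap₃ (trans sum (trans (sym gaps-sum) (cong₂ (λ a b → a + b + gap₃) (sym a≡) (sym b≡))))

        sum₁ : b + c + a ≡ k
        sum₁ = trans (trans (+-comm (b + c) a) (sym (+-assoc a b c))) sum
        sum₂ : c + a + b ≡ k
        sum₂ = trans (trans (+-assoc c a b) (+-comm c (a + b))) sum

        locate-u : Fits σ (ℤ.+ a) (ℤ.+ b) → (a , b , c) ≈ᶜ (gap₁ , gap₂ , gap₃)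
        locate-u fits@(s , f) with f u∈
        ... | 0F , e = subst ((a , b , c) ≈ᶜ_) (anchored 0<a 0<b 0<c sum fits e) rot₀
        ... | 1F , e = subst ((a , b , c) ≈ᶜ_) (anchored 0<b 0<c 0<a sum₁ (Fits-rotate (cong ℤ.+_ sum) fits) e) rot₁
        ... | 2F , e = subst ((a , b , c) ≈ᶜ_) (anchored 0<c 0<a 0<b sum₂ (Fits-rotate (cong ℤ.+_ sum₁) (Fits-rotate (cong ℤ.+_ sum) fits)) e) rot₂

  private
    ¬Adjacent-≡ : ∀ {a b c} → a ≢ b → b ≢ c → c ≢ a → ¬ Adjacent-≡ (a , b , c)
    ¬Adjacent-≡ a≢b b≢c c≢a (inj₁ e) = a≢b e
    ¬Adjacent-≡ a≢b b≢c c≢a (inj₂ (inj₁ e)) = b≢c e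
    ¬Adjacent-≡ a≢b b≢c c≢a (inj₂ (inj₂ e)) = c≢a e

    -- A proper rotation between two words that both begin with a repeated entry forces all entries
    -- to be equal.
    möbius-l-unique : ∀ {l c l′ c′} → (l , l , c) ≈ᶜ (l′ , l′ , c′) → l ≡ l′
    möbius-l-unique rot₀ = refl
    möbius-l-unique rot₁ = refl
    möbius-l-unique rot₂ = refl

  module _ {k-1 : ℕ} (k%6 : suc k-1 % 6 ≡ 1 ⊎ suc k-1 % 6 ≡ 5) where

    private
      k = suc k-1

      Y : MöbiusIndex k ⊎ TorusIndex k → SimplicialComplex k
      Y = [ M k , S k ]

    ∣face∣≤3 : ∀ i {σ} → Face (Y i) σ → ∣ σ ∣ ≤ 3
    ∣face∣≤3 i {σ} σ∈Y = small (fits i σ∈Y)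
      where
      small : Σ[ a ∈ ℤ ] Σ[ b ∈ ℤ ] Fits σ a b → ∣ σ ∣ ≤ 3
      small (a , b , s , fits) = ≤-trans (p⊆q⇒∣p∣≤∣q∣ σ⊆V) (∣vertexSet∣≤3 V)
        where
        V : Fin 3 → Fin k
        V = ι ∘ corner {k} s a b
        σ⊆V : σ ⊆ vertexSet V
        σ⊆V x∈ = let n , eq = fits x∈ in subst (_∈ vertexSet V) eq (∈vertexSet⁺ V n)
      fits : ∀ i → Face (Y i) σ → Σ[ a ∈ ℤ ] Σ[ b ∈ ℤ ] Fits σ a b
      fits (inj₁ i) σ∈M = _ , _ , proj₂ (MöbiusFamily.face⇒ k%6 i σ∈M)
      fits (inj₂ i) σ∈S with proj₂ (TorusFamily.face⇒ k%6 i σ∈S)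
      ... | inj₁ f = _ , _ , f
      ... | inj₂ f = _ , _ , f

    private
      module _ {σ : Subset k} (σ≠∅ : Nonempty σ) where

        HasFace : Set
        HasFace = Σ[ i ∈ MöbiusIndex k ⊎ TorusIndex k ] Face (Y i) σ

        isosceles : ∀ {a c} → 0 < a → 0 < c → a + a + c ≡ k → Fits σ (ℤ.+ a) (ℤ.+ a) → HasFace
        isosceles {a} {c} 0<a 0<c sum fits = inj₁ i , MöbiusFamily.face⇐ k%6 i σ≠∅ fits
          where
          i : MöbiusIndex k
          i = möbiusIndex a 0<a (2*m<k⇒m≤half (subst₂ _<_ (cong (a +_) (sym (+-identityʳ a))) sum (m<m+n (a + a) 0<c)))

        third : ∀ {a b c} → a + b + c ≡ k → k ∸ a ∸ b ≡ c
        third {a} {b} {c} sum = trans (∸-+-assoc k a b) (trans (cong (_∸ (a + b)) (sym sum)) (m+n∸m≡n (a + b) c))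

        -- With the least entry in front, the order of the other two decides which of the two cycles
        -- of `S` contains the triangle.
        least-first : ∀ {a b c} → 0 < a → a < b → a < c → b ≢ c → a + b + c ≡ k → Fits σ (ℤ.+ a) (ℤ.+ b) → HasFace
        least-first {a} {b} {c} 0<a a<b a<c b≢c sum fits with <-cmp b c
        ... | tri≈ _ b≡c _ = contradiction b≡c b≢c
        ... | tri< b<c _ _ = inj₂ i , TorusFamily.face⇐ k%6 i σ≠∅ (inj₁ fits)
          where
          i : TorusIndex k
          i = torusIndex a b 0<a a<b (subst (b <_) (sym (third {a} {b} sum)) b<c)
        ... | tri> _ _ c<b = inj₂ i , TorusFamily.face⇐ k%6 i σ≠∅
            (inj₂ (Fits-rotate (cong ℤ.+_ sum₁) (Fits-rotate (cong ℤ.+_ sum) fits)))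
          where
          sum′ : a + c + b ≡ k
          sum′ = trans (+-assoc a c b) (trans (cong (a +_) (+-comm c b)) (trans (sym (+-assoc a b c)) sum))
          sum₁ : b + c + a ≡ k
          sum₁ = trans (trans (+-comm (b + c) a) (sym (+-assoc a b c))) sum
          i : TorusIndex k
          i = torusIndex a c 0<a a<c (subst (c <_) (sym (third {a} {c} sum′)) c<b)

        hasFace : ∀ {a b c} → 0 < a → 0 < b → 0 < c → a + b + c ≡ k → Fits σ (ℤ.+ a) (ℤ.+ b) → HasFace
        hasFace {a} {b} {c} 0<a 0<b 0<c sum fits = cases (<-cmp a b) (<-cmp b c) (<-cmp c a)
          where
          sum₁ : b + c + a ≡ k
          sum₁ = trans (trans (+-comm (b + c) a) (sym (+-assoc a b c))) sum
          sum₂ : c + a + b ≡ k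
          sum₂ = trans (trans (+-assoc c a b) (+-comm c (a + b))) sum
          fits₁ : Fits σ (ℤ.+ b) (ℤ.+ c)
          fits₁ = Fits-rotate (cong ℤ.+_ sum) fits
          fits₂ : Fits σ (ℤ.+ c) (ℤ.+ a)
          fits₂ = Fits-rotate (cong ℤ.+_ sum₁) fits₁
          cases : Tri (a < b) (a ≡ b) (b < a) → Tri (b < c) (b ≡ c) (c < b) → Tri (c < a) (c ≡ a) (a < c) → HasFace
          cases (tri≈ _ refl _) _ _ = isosceles 0<a 0<c sum fits
          cases _ (tri≈ _ refl _) _ = isosceles 0<b 0<a sum₁ fits₁
          cases _ _ (tri≈ _ refl _) = isosceles 0<c 0<b sum₂ fits₂
          cases (tri< a<b _ _) (tri< b<c b≢c _) _ = least-first 0<a a<b (<-trans a<b b<c) b≢c sum fits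
          cases (tri< a<b _ _) (tri> _ b≢c _) (tri> _ _ a<c) = least-first 0<a a<b a<c b≢c sum fits
          cases (tri< _ a≢b _) (tri> _ _ c<b) (tri< c<a _ _) = least-first 0<c c<a c<b a≢b sum₂ fits₂
          cases (tri> _ _ b<a) (tri< b<c _ _) (tri< _ c≢a _) = least-first 0<b b<c b<a c≢a sum₁ fits₁
          cases (tri> _ _ b<a) (tri< b<c _ _) (tri> _ c≢a _) = least-first 0<b b<c b<a c≢a sum₁ fits₁
          cases (tri> _ a≢b b<a) (tri> _ _ c<b) _ = least-first 0<c (<-trans c<b b<a) c<b a≢b sum₂ fits₂

      module _ {σ : Subset k} (t : SortedTriple σ) where

        gaps : ℕ × ℕ × ℕ
        gaps = gap₁ t , gap₂ t , gap₃ t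

        möbius-gaps : ∀ i → Face (M k i) σ → let l = MöbiusIndex.l i in (l , l , k ∸ 2 * l) ≈ᶜ gaps
        möbius-gaps i@(möbiusIndex l 1≤l l≤) σ∈M = gaps-unique t 1≤l 1≤l (m<n⇒0<n∸m 2l<k) total
          (proj₂ (MöbiusFamily.face⇒ k%6 i σ∈M))
          where
          2l<k : 2 * l < k
          2l<k = s≤s (≤-trans (≤-reflexive (*-comm 2 l)) (≤-trans (*-monoˡ-≤ 2 l≤) (m/n*n≤m k-1 2)))
          total : l + l + (k ∸ 2 * l) ≡ k
          total = trans (cong (λ x → l + x + (k ∸ 2 * l)) (sym (+-identityʳ l))) (m+[n∸m]≡n (<⇒≤ 2l<k))

        torus-gaps : ∀ i → Face (S k i) σ → let open TorusIndex i; c = k ∸ l ∸ j in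
                     (l , j , c) ≈ᶜ gaps ⊎ (j , l , c) ≈ᶜ gaps
        torus-gaps i σ∈S with proj₂ (TorusFamily.face⇒ k%6 i σ∈S)
        ... | inj₁ fits = inj₁ (gaps-unique t 1≤l 0<j 0<c l+j+c≡k fits)
          where
          open TorusIndex i
          open TorusFamily k%6 i
        ... | inj₂ fits = inj₂ (gaps-unique t 0<j 1≤l 0<c (trans (cong (_+ c) (+-comm j l)) l+j+c≡k) fits)
          where
          open TorusIndex i
          open TorusFamily k%6 i

        module _ (i : TorusIndex k) (σ∈S : Face (S k i) σ) where
          open TorusIndex i
          open TorusFamily k%6 i using (c)

          -- A condition on all three entries ignores both the rotation and the exchange of `l` and
          -- `j`, so that it can be transported without knowing which of the six arrangements
          -- occurs.
          to-gaps : ∀ (P : ℕ → Set) → P l → P j → P c → All₃ P gaps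
          to-gaps P pl pj pc with torus-gaps i σ∈S
          ... | inj₁ e = All₃-resp P e (pl , pj , pc)
          ... | inj₂ e = All₃-resp P e (pj , pl , pc)

          from-gaps : ∀ (P : ℕ → Set) → All₃ P gaps → P l × P j × P c
          from-gaps P all with torus-gaps i σ∈S
          ... | inj₁ e = All₃-resp P (≈ᶜ-sym e) all
          ... | inj₂ e = let pj , pl , pc = All₃-resp P (≈ᶜ-sym e) all in pl , pj , pc

          l≤gaps : All₃ (l ≤_) gaps
          l≤gaps = to-gaps (l ≤_) ≤-refl (<⇒≤ l<j) (<⇒≤ (<-trans l<j j<))

          gaps≤c : All₃ (_≤ c) gaps
          gaps≤c = to-gaps (_≤ c) (<⇒≤ (<-trans l<j j<)) (<⇒≤ j<) ≤-refl

          gaps-distinct : ¬ Adjacent-≡ gaps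
          gaps-distinct adj with torus-gaps i σ∈S
          ... | inj₁ e = ¬Adjacent-≡ (<⇒≢ l<j) (<⇒≢ j<) (>⇒≢ (<-trans l<j j<)) (Adjacent-≡-resp (≈ᶜ-sym e) adj)
          ... | inj₂ e = ¬Adjacent-≡ (>⇒≢ l<j) (<⇒≢ (<-trans l<j j<)) (>⇒≢ j<) (Adjacent-≡-resp (≈ᶜ-sym e) adj)

        -- `l` is the least gap and `c` the greatest, so both are determined by the triangle; `j`
        -- follows from the sum `k`.
        torus-unique : ∀ i i′ → Face (S k i) σ → Face (S k i′) σ → i ≡ i′
        torus-unique i i′ σ∈S σ∈S′ = torusIndex-≡ l≡ j≡
          where
          module I = TorusIndex i
          module I′ = TorusIndex i′
          open TorusFamily k%6 i using (c; l+j+c≡k)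
          open TorusFamily k%6 i′ using () renaming (c to c′; l+j+c≡k to l+j+c≡k′)
          l≡ : I.l ≡ I′.l
          l≡ = ≤-antisym (proj₁ (from-gaps i′ σ∈S′ (I.l ≤_) (l≤gaps i σ∈S))) (proj₁ (from-gaps i σ∈S (I′.l ≤_) (l≤gaps i′ σ∈S′)))
          c≡ : c ≡ c′
          c≡ = ≤-antisym (proj₂ (proj₂ (from-gaps i σ∈S (_≤ c′) (gaps≤c i′ σ∈S′)))) (proj₂ (proj₂ (from-gaps i′ σ∈S′ (_≤ c) (gaps≤c i σ∈S))))
          j≡ : I.j ≡ I′.j
          j≡ = +-cancelˡ-≡ I.l I.j I′.j (+-cancelʳ-≡ c (I.l + I.j) (I.l + I′.j)
            (trans l+j+c≡k (trans (sym l+j+c≡k′) (cong₂ (λ l c → l + I′.j + c) (sym l≡) (sym c≡)))))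

        möbius-torus-disjoint : ∀ i i′ → Face (M k i) σ → ¬ Face (S k i′) σ
        möbius-torus-disjoint i i′ σ∈M σ∈S = gaps-distinct i′ σ∈S (Adjacent-≡-resp (möbius-gaps i σ∈M) (inj₁ refl))

        index-unique : ∀ i i′ → Face (Y i) σ → Face (Y i′) σ → i ≡ i′
        index-unique (inj₁ i) (inj₁ i′) σ∈ σ∈′ = cong inj₁ (möbiusIndex-≡
          (möbius-l-unique (≈ᶜ-trans (möbius-gaps i σ∈) (≈ᶜ-sym (möbius-gaps i′ σ∈′)))))
        index-unique (inj₁ i) (inj₂ i′) σ∈ σ∈′ = contradiction σ∈′ (möbius-torus-disjoint i i′ σ∈)
        index-unique (inj₂ i) (inj₁ i′) σ∈ σ∈′ = contradiction σ∈ (möbius-torus-disjoint i′ i σ∈′)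
        index-unique (inj₂ i) (inj₂ i′) σ∈ σ∈′ = cong inj₂ (torus-unique i i′ σ∈ σ∈′)

    decomposition : DecomposesInto (skel 2 (fullSimplex k)) [ M k , S k ]
    decomposition = (λ i σ∈Y → nonempty (Y i) σ∈Y , ∣face∣≤3 i σ∈Y) , λ σ (σ≠∅ , _) ∣σ∣≡3 →
      let t = sortedTriple σ ∣σ∣≡3
          i , σ∈Y = hasFace σ≠∅ (0<gap₁ t) (0<gap₂ t) (0<gap₃ t) (gaps-sum t) (fits-gaps t)
      in i , σ∈Y , λ {i′} σ∈Y′ → index-unique t i i′ σ∈Y σ∈Y′

open Families
open Indices
open Decomposition
open import Defs
open import Data.Nat.Base using (suc; NonZero; _+_; _*_; _∸_; _<_)
open import Data.Nat.DivMod using (_%_)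
open import Data.Nat.GCD using (gcd)
open import Data.Fin.Subset using (∣_∣)
open import Data.Sum.Base using ([_,_])

theorem1p2 : (k : ℕ) .{{_ : NonZero k}} → 1 < k → (k % 6 ≡ 1 ⊎ k % 6 ≡ 5) →
    DecomposesInto (skel 2 (fullSimplex k)) [ M k , S k ] ×
    (∃[ N ] (2 * N + 1 ≡ k × (MöbiusIndex k ↔ Fin N))) ×
    ((i : MöbiusIndex k) →
    let n = gcd (MöbiusIndex.l i) k in
    CollectionOf MöbiusStrip (M k i) ×
    HasComponents (M k i) n ×
    (∀ C → IsComponent (M k i) C → ∣ C ∣ * n ≡ k) ×
    (∀ C D → IsComponent (M k i) C → IsComponent (M k i) D →
    Isomorphic (M k i ↾ C) (M k i ↾ D))) ×
    (∃[ N ] (12 * N + 6 * k ≡ k * k + 5 × (TorusIndex k ↔ Fin N))) ×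
    ((i : TorusIndex k) →
    let m = gcd (gcd (TorusIndex.l i) (TorusIndex.j i)) k in
    CollectionOf Torus (S k i) ×
    HasComponents (S k i) m ×
    (∀ C → IsComponent (S k i) C → ∣ C ∣ * m ≡ k))
theorem1p2 k@(suc _) _ k%6 =
  decomposition k%6 ,
  (_ , 2*half+1 k%6 , möbius↔ k) ,
  (λ i → let open MöbiusFamily k%6 i in collection , components , size , isomorphic) ,
  torus-count k%6 ,
  (λ i → let open TorusFamily k%6 i in collection , components , size)
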